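{- Let $g\in\mathbb{Q}[t]$ be a monic and even polynomial of degree six with $g(t)\neq t^6$. For $t_1\in\mathbb{Q}$ let $E^{t_1}$ denote the curve $y^2=x^3+g(t_1)$. If there exists $t_{0}\in\mathbb{Q}$ such that there are infinitely many rational points on the curve $E^{t_{0}}$, then the set of $t_1\in\mathbb{Q}$ such that $E^{t_1}$ has positive rank is infinite.
   Context: A polynomial $g$ is even if $g(t)=g(-t)$. "$E^{t_1}$ has positive rank" means that $g(t_1)\neq 0$ and the elliptic curve $E^{t_1}$ over $\mathbb{Q}$ has a rational point of infinite order. -}

module Defs where

open import Algebra.Bundles.Raw using (RawMonoid)
import Algebra.Definitions.RawMonoid as RawMonoidDefinitions
open import Data.List.Base using (List; []; _∷_; map)
import Data.List.Membership.Propositional as List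
open import Data.Nat.Base as ℕ using (ℕ; zero; suc)
open import Data.Product.Base using (_×_; ∃-syntax)
open import Data.Rational.Base
  using (ℚ; 0ℚ; 1ℚ; _+_; _-_; _*_; -_; _÷_; ≢-nonZero)
open import Data.Rational.Properties using (_≟_)
open import Data.Unit.Base using (⊤)
open import Level using (0ℓ)
open import Relation.Binary.PropositionalEquality.Core using (_≡_; _≢_)
open import Relation.Nullary.Decidable.Core using (yes; no)
open import Relation.Unary using (Pred)

-- Constructively positive form of infinitude: no finite list exhausts the
-- subset, and an element outside any given list can be produced.
Infinite : {A : Set} → Pred A 0ℓ → Set
Infinite {A} P = ∀ (xs : List A) → ∃[ x ] (P x × x List.∉ xs)

-- Polynomials in ℚ[t]: coefficient lists, constant term first. Trailing zeros
-- are allowed, so equality of polynomials is _≋_ rather than _≡_.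
Poly : Set
Poly = List ℚ

coeff : Poly → ℕ → ℚ
coeff []       _       = 0ℚ
coeff (c ∷ _)  zero    = c
coeff (_ ∷ cs) (suc n) = coeff cs n

infix 4 _≋_
_≋_ : Poly → Poly → Set
p ≋ q = ∀ n → coeff p n ≡ coeff q n

eval : Poly → ℚ → ℚ
eval []       _ = 0ℚ
eval (c ∷ cs) t = c + t * eval cs t

t^_ : ℕ → Poly
t^ zero  = 1ℚ ∷ []
t^ suc n = 0ℚ ∷ t^ n

-- p(-t): if p(t) = c + t q(t) then p(-t) = c - t q(-t).
reflect : Poly → Poly
reflect []       = []
reflect (c ∷ cs) = c ∷ map -_ (reflect cs)

Even : Poly → Set
Even p = p ≋ reflect p

HasDegree : Poly → ℕ → Set
HasDegree p d = coeff p d ≢ 0ℚ × (∀ n → d ℕ.< n → coeff p n ≡ 0ℚ)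

Monic : Poly → Set
Monic p = ∃[ d ] (HasDegree p d × coeff p d ≡ 1ℚ)

-- ∞ is the point at infinity [0 : 1 : 0] of a Weierstrass curve.
data Point : Set where
  ∞   : Point
  aff : (x y : ℚ) → Point

-- The rational points of the projective closure of y² = x³ + k.
Curve : ℚ → Pred Point 0ℓ
Curve k ∞         = ⊤
Curve k (aff x y) = y * y ≡ x * x * x + k

-- Third intersection, reflected in the x-axis, of y² = x³ + k with the line of
-- slope m through (x₁ , y₁) and a second point of abscissa x₂.
chord : (m x₁ y₁ x₂ : ℚ) → Point
chord m x₁ y₁ x₂ = aff x₃ (m * (x₁ - x₃) - y₁)
  where
  x₃ : ℚ
  x₃ = m * m - x₁ - x₂

-- The chord-and-tangent law. Its formulas do not involve k, so it is defined on
-- all of Point; only its restriction to a single nonsingular curve is a group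
-- law. If x₁ = x₂ and y₁ + y₂ ≠ 0 for two points of the same curve, then
-- y₁ = y₂, and 3x₁² / (y₁ + y₂) is the tangent slope 3x₁² / 2y₁.
infixl 6 _⊕_
_⊕_ : Point → Point → Point
∞         ⊕ Q         = Q
aff x₁ y₁ ⊕ ∞         = aff x₁ y₁
aff x₁ y₁ ⊕ aff x₂ y₂ with x₂ - x₁ ≟ 0ℚ
... | no  x₂-x₁≢0 = chord (((y₂ - y₁) ÷ (x₂ - x₁)) {{≢-nonZero x₂-x₁≢0}}) x₁ y₁ x₂
... | yes _ with y₁ + y₂ ≟ 0ℚ
...   | yes _       = ∞
...   | no  y₁+y₂≢0 =
  chord (((x₁ * x₁ + x₁ * x₁ + x₁ * x₁) ÷ (y₁ + y₂)) {{≢-nonZero y₁+y₂≢0}}) x₁ y₁ x₂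

⊕-rawMonoid : RawMonoid 0ℓ 0ℓ
⊕-rawMonoid = record { Carrier = Point ; _≈_ = _≡_ ; _∙_ = _⊕_ ; ε = ∞ }

open RawMonoidDefinitions ⊕-rawMonoid public using () renaming (_×_ to _·_)

InfiniteOrder : Pred Point 0ℓ
InfiniteOrder P = ∀ n → n ≢ 0 → n · P ≢ ∞

-- k ≢ 0ℚ says that y² = x³ + k is nonsingular, its discriminant being -432k².
PositiveRank : Pred ℚ 0ℓ
PositiveRank k = k ≢ 0ℚ × ∃[ P ] (Curve k P × InfiniteOrder P)

{-# OPTIONS --safe #-}
-- For k ≠ 0 a rational point (x , y) of y² = x³ + k other than the obvious torsion
-- points (x = 0, y = 0, x³ = - 4 k, x³ = 8 k) yields a point of infinite order:
-- writing C = k / x³, its double, its triple or the triple of its double has C in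
-- 4 ℤ₍₂₎. After scaling such a point P to (1 , w₁) in the
-- coordinates z = x / y, w = 1 / y at infinity, addition of P moves z by 1 plus a
-- multiple of 2 that varies 2-adically slowly with z. Iterating, addition of 2ⁱ m P
-- with m odd moves z by an odd multiple of 2ⁱ, so that no multiple of P is ∞.
--
-- It remains to produce infinitely many t with a point on y² = x³ + g(t). Each
-- point (u , v) over t₀ lies on a curve in the surface y² = x³ + g(t) on which a
-- further point can be found, in general by a tangent construction (in one
-- degenerate case the surface contains a rational curve instead). The resulting t and x are
-- algebraic in u with t² and x rational, and comparing leading terms in u shows
-- that only finitely many u give a prescribed t or an excluded point.
module Submission where

open import Defs
open import Agda.Builtin.FromNat using (Number; fromNat)
open import Data.Empty using (⊥; ⊥-elim)
open import Data.Integer.Base as ℤ using (ℤ)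
import Data.Integer.DivMod as ℤ
import Data.Integer.Properties as ℤ
open import Data.List.Base as List using (List; []; _∷_)
open import Data.List.Membership.Propositional using (_∈_)
open import Data.List.Relation.Unary.All as All using (All; []; _∷_)
open import Data.List.Relation.Unary.Any using (here; there)
import Data.Nat.Base as ℕ
import Data.Nat.Coprimality as ℕ
import Data.Nat.Divisibility as ℕ
import Data.Nat.Literals as ℕ
import Data.Nat.Properties as ℕ
open import Data.Product.Base using (_×_; _,_; proj₁; proj₂; ∃-syntax)
open import Data.Rational.Base
  using (ℚ; 0ℚ; 1ℚ; _+_; _-_; _*_; -_; _/_; 1/_; ½; ≢-nonZero)
import Data.Rational.Base as ℚ
import Data.Rational.Unnormalised.Base as ℚᵘ
import Data.Rational.Unnormalised.Properties as ℚᵘ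
open import Data.Rational.Literals using (fromℤ)
import Data.Rational.Literals as ℚ
open import Data.Rational.Properties using (_≟_)
import Data.Rational.Properties as ℚ
open import Data.Sum.Base using (_⊎_; inj₁; inj₂; [_,_]′)
open import Data.Unit.Base using (tt)
open import Function.Base using (_∘_)
open import Relation.Binary.Definitions using (Tri; tri<; tri≈; tri>)
open import Relation.Binary.PropositionalEquality
  using (_≡_; _≢_; refl; sym; trans; cong; cong₂; subst; module ≡-Reasoning)
open import Relation.Nullary.Decidable.Core using (Dec; yes; no; dec⇒maybe)
open import Relation.Nullary.Negation.Core using (¬_)
open import Tactic.RingSolver using (solve-∀)
open import Tactic.RingSolver.Core.AlmostCommutativeRing
  using (AlmostCommutativeRing; fromCommutativeRing)
open import Level using (0ℓ)
open import Relation.Unary using (Pred)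

-- Neither associativity of `_⊕_` nor a classification of rational torsion enters. `n · P` unfolds
-- to P ⊕ (P ⊕ ...), so only the map Q ↦ P ⊕ Q has to be followed; its square is a composite of
-- maps, never identified with addition of a doubled point. The doubling and tripling formulas serve
-- only as sources of new points on the same curve.
--
-- Which multiple works is read off from E = x³ / k. Doubling sends E to E (E - 8)³ / 64 (E + 1)³,
-- tripling sends it to D³ / 729 E² (E + 4)⁶ with D = E³ - 96 E² + 48 E + 64, and the aim is that 1
-- / E lies in 4 ℤ₍₂₎. Doubling succeeds if 1 / E is integral or E is twice a unit, tripling if E is
-- four times a unit or divisible by 16. If E is eight times a unit, tripling yields only a unit,
-- but doubling first makes E divisible by 16.

instance
  number-ℕ : Number ℕ.ℕ
  number-ℕ = ℕ.number

  number-ℚ : Number ℚ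
  number-ℚ = ℚ.number

ℚ-ring : AlmostCommutativeRing _ _
ℚ-ring = fromCommutativeRing ℚ.+-*-commutativeRing (λ x → dec⇒maybe (0ℚ ≟ x))

-- Field identities and cancellation in ℚ.

variable
  x y z A A′ B B′ C C′ L R : ℚ

x≡y⇒x-y≡0 : x ≡ y → x - y ≡ 0
x≡y⇒x-y≡0 {x} refl = ℚ.+-inverseʳ x

x-y≡0⇒x≡y : x - y ≡ 0 → x ≡ y
x-y≡0⇒x≡y {x} {y} eq = begin
  x            ≡⟨ lemma x y ⟩
  (x - y) + y  ≡⟨ cong (_+ y) eq ⟩
  0 + y        ≡⟨ ℚ.+-identityˡ y ⟩
  y            ∎
  where
  open ≡-Reasoning
  lemma : ∀ x y → x ≡ (x - y) + y
  lemma = solve-∀ ℚ-ring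

-- An equation holds if the difference of its sides is a combination of
-- differences of sides of known equations; the last hypothesis of each of the
-- following lemmas is a ring identity.
combine₁ : ∀ c → A ≡ A′ → L - R ≡ c * (A - A′) → L ≡ R
combine₁ {A} c refl eq = x-y≡0⇒x≡y (trans eq (lemma c A))
  where
  lemma : ∀ c A → c * (A - A) ≡ 0
  lemma = solve-∀ ℚ-ring

combine₂ : ∀ c d → A ≡ A′ → B ≡ B′ →
  L - R ≡ c * (A - A′) + d * (B - B′) → L ≡ R
combine₂ {A} {B = B} c d refl refl eq = x-y≡0⇒x≡y (trans eq (lemma c d A B))
  where
  lemma : ∀ c d A B → c * (A - A) + d * (B - B) ≡ 0
  lemma = solve-∀ ℚ-ring

combine₃ : ∀ c d e → A ≡ A′ → B ≡ B′ → C ≡ C′ →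
  L - R ≡ c * (A - A′) + d * (B - B′) + e * (C - C′) → L ≡ R
combine₃ {A} {B = B} {C = C} c d e refl refl refl eq =
  x-y≡0⇒x≡y (trans eq (lemma c d e A B C))
  where
  lemma : ∀ c d e A B C → c * (A - A) + d * (B - B) + e * (C - C) ≡ 0
  lemma = solve-∀ ℚ-ring

inverse : x ≢ 0 → ∃[ y ] x * y ≡ 1
inverse {x} x≢0 = (1/ x) {{≢-nonZero x≢0}} , ℚ.*-inverseʳ x {{≢-nonZero x≢0}}

xy≡0⇒x≡0∨y≡0 : x * y ≡ 0 → x ≡ 0 ⊎ y ≡ 0
xy≡0⇒x≡0∨y≡0 {x} {y} eq with x ≟ 0
... | yes x≡0 = inj₁ x≡0
... | no  x≢0 with inverse x≢0
... | x⁻¹ , inv = inj₂ (combine₂ (- y) x⁻¹ inv eq (lemma x y x⁻¹))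
  where
  lemma : ∀ x y x⁻¹ → y - 0 ≡ - y * (x * x⁻¹ - 1) + x⁻¹ * (x * y - 0)
  lemma = solve-∀ ℚ-ring

xy≢0 : x ≢ 0 → y ≢ 0 → x * y ≢ 0
xy≢0 x≢0 y≢0 eq with xy≡0⇒x≡0∨y≡0 eq
... | inj₁ x≡0 = x≢0 x≡0
... | inj₂ y≡0 = y≢0 y≡0

xx≡0⇒x≡0 : x * x ≡ 0 → x ≡ 0
xx≡0⇒x≡0 eq with xy≡0⇒x≡0∨y≡0 eq
... | inj₁ x≡0 = x≡0
... | inj₂ x≡0 = x≡0

xxx≡0⇒x≡0 : x * x * x ≡ 0 → x ≡ 0
xxx≡0⇒x≡0 eq with xy≡0⇒x≡0∨y≡0 eq
... | inj₁ xx≡0 = xx≡0⇒x≡0 xx≡0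
... | inj₂ x≡0  = x≡0

*-cancelˡ : z ≢ 0 → z * x ≡ z * y → x ≡ y
*-cancelˡ {z} {x} {y} z≢0 eq =
  [ ⊥-elim ∘ z≢0 , x-y≡0⇒x≡y ]′ (xy≡0⇒x≡0∨y≡0 (trans (lemma z x y) (x≡y⇒x-y≡0 eq)))
  where
  lemma : ∀ z x y → z * (x - y) ≡ z * x - z * y
  lemma = solve-∀ ℚ-ring


-- Integers in ℚ, parity, and the localisation ℤ₍₂₎.

fromℤ-+ : ∀ i j → fromℤ i + fromℤ j ≡ fromℤ (i ℤ.+ j)
fromℤ-+ i j = trans
  (cong (_/ 1) (cong₂ ℤ._+_ (ℤ.*-identityʳ i) (ℤ.*-identityʳ j)))
  (ℚ.↥p/↧p≡p (fromℤ (i ℤ.+ j)))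

fromℤ-* : ∀ i j → fromℤ i * fromℤ j ≡ fromℤ (i ℤ.* j)
fromℤ-* i j = ℚ.↥p/↧p≡p (fromℤ (i ℤ.* j))

fromℤ-neg : ∀ i → - fromℤ i ≡ fromℤ (ℤ.- i)
fromℤ-neg (ℤ.+ ℕ.zero)    = refl
fromℤ-neg (ℤ.+ (ℕ.suc _)) = refl
fromℤ-neg ℤ.-[1+ _ ]      = refl

record IsInteger (x : ℚ) : Set where
  constructor isInteger
  field
    int    : ℤ
    ≡int   : x ≡ fromℤ int

isInteger-fromℤ : ∀ i → IsInteger (fromℤ i)
isInteger-fromℤ i = isInteger i refl

isInteger-+ : IsInteger x → IsInteger y → IsInteger (x + y)
isInteger-+ (isInteger i refl) (isInteger j refl) = isInteger (i ℤ.+ j) (fromℤ-+ i j)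

isInteger-* : IsInteger x → IsInteger y → IsInteger (x * y)
isInteger-* (isInteger i refl) (isInteger j refl) = isInteger (i ℤ.* j) (fromℤ-* i j)

isInteger-neg : IsInteger x → IsInteger (- x)
isInteger-neg (isInteger i refl) = isInteger (ℤ.- i) (fromℤ-neg i)

parity : IsInteger x →
  (∃[ y ] IsInteger y × x ≡ 2 * y) ⊎ (∃[ y ] IsInteger y × x ≡ 1 + 2 * y)
parity (isInteger i refl) = split (i ℤ.%ℕ 2) (ℤ.n%ℕd<d i 2) (ℤ.a≡a%ℕn+[a/ℕn]*n i 2)
  where
  q = i ℤ./ℕ 2

  fromℤ-split : ∀ r → fromℤ (r ℤ.+ q ℤ.* ℤ.+ 2) ≡ fromℤ r + fromℤ q * 2
  fromℤ-split r = sym (trans (cong (fromℤ r +_) (fromℤ-* q (ℤ.+ 2))) (fromℤ-+ r (q ℤ.* ℤ.+ 2)))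

  lemma₀ : ∀ q → 0 + q * 2 ≡ 2 * q
  lemma₀ = solve-∀ ℚ-ring

  lemma₁ : ∀ q → 1 + q * 2 ≡ 1 + 2 * q
  lemma₁ = solve-∀ ℚ-ring

  split : ∀ r → r ℕ.< 2 → i ≡ ℤ.+ r ℤ.+ q ℤ.* ℤ.+ 2 →
    (∃[ y ] IsInteger y × fromℤ i ≡ 2 * y) ⊎ (∃[ y ] IsInteger y × fromℤ i ≡ 1 + 2 * y)
  split 0 _ eq = inj₁ (fromℤ q , isInteger-fromℤ q ,
    trans (cong fromℤ eq) (trans (fromℤ-split (ℤ.+ 0)) (lemma₀ (fromℤ q))))
  split 1 _ eq = inj₂ (fromℤ q , isInteger-fromℤ q ,
    trans (cong fromℤ eq) (trans (fromℤ-split (ℤ.+ 1)) (lemma₁ (fromℤ q))))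
  split (ℕ.suc (ℕ.suc _)) (ℕ.s≤s (ℕ.s≤s ())) _

even⇒2∣ : ∀ {i} → IsInteger y → fromℤ i ≡ 2 * y → 2 ℕ.∣ ℤ.∣ i ∣
even⇒2∣ {i = i} (isInteger j refl) eq = ℕ.divides ℤ.∣ j ∣ (begin
  ℤ.∣ i ∣              ≡⟨ cong (ℤ.∣_∣ ∘ ℚ.numerator) (trans eq (fromℤ-* (ℤ.+ 2) j)) ⟩
  ℤ.∣ ℤ.+ 2 ℤ.* j ∣    ≡⟨ ℤ.abs-* (ℤ.+ 2) j ⟩
  2 ℕ.* ℤ.∣ j ∣        ≡⟨ ℕ.*-comm 2 ℤ.∣ j ∣ ⟩
  ℤ.∣ j ∣ ℕ.* 2        ∎)
  where open ≡-Reasoning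

odd≢0 : IsInteger x → 1 + 2 * x ≢ 0
odd≢0 {x} x-int eq = 2≢1 (ℕ.∣1⇒≡1 (even⇒2∣ {i = ℤ.+ 1} (isInteger-neg x-int) (combine₁ 1 eq (lemma x))))
  where
  2≢1 : 2 ≢ 1
  2≢1 ()

  lemma : ∀ x → 1 - 2 * (- x) ≡ 1 * (1 + 2 * x - 0)
  lemma = solve-∀ ℚ-ring

-- The elements of the localisation ℤ₍₂₎.
record Integral (x : ℚ) : Set where
  constructor integral
  field
    {num den}       : ℚ
    num-isInteger   : IsInteger num
    den-isInteger   : IsInteger den
    fraction        : x * (1 + 2 * den) ≡ num

integral-fromℤ : ∀ i → Integral (fromℤ i)
integral-fromℤ i = integral (isInteger-fromℤ i) (isInteger-fromℤ (ℤ.+ 0)) (lemma (fromℤ i))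
  where
  lemma : ∀ x → x * (1 + 2 * 0) ≡ x
  lemma = solve-∀ ℚ-ring

integral-number : ∀ n → Integral (fromNat n)
integral-number n = integral-fromℤ (ℤ.+ n)

integral-+ : Integral x → Integral y → Integral (x + y)
integral-+ {x} {y} (integral {m} {d} mi di p) (integral {n} {e} ni ei q) =
  integral
    (isInteger-+ (isInteger-* mi (isInteger-+ one (isInteger-* two ei)))
                 (isInteger-* ni (isInteger-+ one (isInteger-* two di))))
    (isInteger-+ (isInteger-+ di ei) (isInteger-* two (isInteger-* di ei)))
    (combine₂ (1 + 2 * e) (1 + 2 * d) p q (lemma x y m n d e))
  where
  one = isInteger-fromℤ (ℤ.+ 1)
  two = isInteger-fromℤ (ℤ.+ 2)
  lemma : ∀ x y m n d e →
    (x + y) * (1 + 2 * (d + e + 2 * (d * e))) - (m * (1 + 2 * e) + n * (1 + 2 * d)) ≡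
    (1 + 2 * e) * (x * (1 + 2 * d) - m) + (1 + 2 * d) * (y * (1 + 2 * e) - n)
  lemma = solve-∀ ℚ-ring

integral-* : Integral x → Integral y → Integral (x * y)
integral-* {x} {y} (integral {m} {d} mi di p) (integral {n} {e} ni ei q) =
  integral (isInteger-* mi ni)
    (isInteger-+ (isInteger-+ di ei) (isInteger-* (isInteger-fromℤ (ℤ.+ 2)) (isInteger-* di ei)))
    (combine₂ (y * (1 + 2 * e)) m p q (lemma x y m n d e))
  where
  lemma : ∀ x y m n d e →
    x * y * (1 + 2 * (d + e + 2 * (d * e))) - m * n ≡
    y * (1 + 2 * e) * (x * (1 + 2 * d) - m) + m * (y * (1 + 2 * e) - n)
  lemma = solve-∀ ℚ-ring

integral-neg : Integral x → Integral (- x)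
integral-neg {x} (integral {m} {d} mi di p) =
  integral (isInteger-neg mi) di (combine₁ (- 1) p (lemma x m d))
  where
  lemma : ∀ x m d → - x * (1 + 2 * d) - (- m) ≡ - 1 * (x * (1 + 2 * d) - m)
  lemma = solve-∀ ℚ-ring

integral-minus : Integral x → Integral y → Integral (x - y)
integral-minus xi yi = integral-+ xi (integral-neg yi)

integral-parity : Integral x →
  (∃[ y ] Integral y × x ≡ 2 * y) ⊎ (∃[ y ] Integral y × x ≡ 1 + 2 * y)
integral-parity {x} (integral {m} {d} mi di p) = [ even , odd ]′ (parity mi)
  where
  even : (∃[ y ] IsInteger y × m ≡ 2 * y) → _
  even (y , yi , eq) = inj₁ (½ * x , integral yi di (combine₂ ½ ½ p eq (lemma x m d y)) , lemma′ x)
    where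
    lemma : ∀ x m d y →
      ½ * x * (1 + 2 * d) - y ≡ ½ * (x * (1 + 2 * d) - m) + ½ * (m - 2 * y)
    lemma = solve-∀ ℚ-ring
    lemma′ : ∀ x → x ≡ 2 * (½ * x)
    lemma′ = solve-∀ ℚ-ring

  odd : (∃[ y ] IsInteger y × m ≡ 1 + 2 * y) → _
  odd (y , yi , eq) = inj₂ (½ * (x - 1) ,
    integral (isInteger-+ yi (isInteger-neg di)) di (combine₂ ½ ½ p eq (lemma x m d y)) , lemma′ x)
    where
    lemma : ∀ x m d y →
      ½ * (x - 1) * (1 + 2 * d) - (y + (- d)) ≡ ½ * (x * (1 + 2 * d) - m) + ½ * (m - (1 + 2 * y))
    lemma = solve-∀ ℚ-ring
    lemma′ : ∀ x → x ≡ 1 + 2 * (½ * (x - 1))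
    lemma′ = solve-∀ ℚ-ring

-- With x = m / (1 + 2 d) the inverse is (1 + 2 d) / (1 + 2 (d + m)), whose denominator is again
-- odd.
1+2x-unit : Integral x → ∃[ y ] Integral y × (1 + 2 * x) * y ≡ 1
1+2x-unit {x} (integral {m} {d} mi di p) = w ,
  integral (isInteger-+ (isInteger-fromℤ (ℤ.+ 1)) (isInteger-* (isInteger-fromℤ (ℤ.+ 2)) di))
    (isInteger-+ di mi) (combine₂ (1 + 2 * d) (- (2 * w)) inv p (lemma₂ x m d w)) ,
  inv
  where
  lemma₁ : ∀ x m d → (1 + 2 * (d + m)) - 0 ≡ (1 + 2 * d) * (1 + 2 * x - 0) + - 2 * (x * (1 + 2 * d) - m)
  lemma₁ = solve-∀ ℚ-ring

  unit : ∃[ w ] (1 + 2 * x) * w ≡ 1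
  unit = inverse {1 + 2 * x} λ eq → odd≢0 (isInteger-+ di mi) (combine₂ (1 + 2 * d) (- 2) eq p (lemma₁ x m d))

  w = proj₁ unit
  inv = proj₂ unit

  lemma₂ : ∀ x m d w → w * (1 + 2 * (d + m)) - (1 + 2 * d) ≡
    (1 + 2 * d) * ((1 + 2 * x) * w - 1) + - (2 * w) * (x * (1 + 2 * d) - m)
  lemma₂ = solve-∀ ℚ-ring

x*↧x≡↥x : ∀ x → x * fromℤ (ℚ.↧ x) ≡ fromℤ (ℚ.↥ x)
x*↧x≡↥x x@record{} = ℚ.toℚᵘ-injective (ℚᵘ.≃-trans (ℚ.toℚᵘ-homo-* x (fromℤ (ℚ.↧ x)))
  (ℚᵘ.*≡* (trans (ℤ.*-identityʳ (ℚ.↥ x ℤ.* ℚ.↧ x)) (cong (ℚ.↥ x ℤ.*_) (sym (ℤ.*-identityʳ (ℚ.↧ x)))))))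

-- Numerator and denominator in lowest terms are not both even. An odd denominator gives
-- integrality; an even one leaves an odd numerator, so the reciprocal is twice an integral element.
integral-or-reciprocal : x ≢ 0 → Integral x ⊎ (∃[ y ] Integral y × x * (2 * y) ≡ 1)
integral-or-reciprocal {x@record{isCoprime = cop}} x≢0 =
  [ (λ (y , yi , eq) → [ (λ (z , zi , eq′) → ⊥-elim (both-even yi eq zi eq′)) ,
                         (λ (z , zi , eq′) → inj₂ (reciprocal y z yi zi eq eq′)) ]′
                       (parity (isInteger-fromℤ (ℚ.↥ x)))) ,
    (λ (y , yi , eq) → inj₁ (integral (isInteger-fromℤ (ℚ.↥ x)) yi
       (trans (cong (x *_) (sym eq)) (x*↧x≡↥x x)))) ]′
  (parity (isInteger-fromℤ (ℚ.↧ x)))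
  where
  both-even : IsInteger y → fromℤ (ℚ.↧ x) ≡ 2 * y → IsInteger z → fromℤ (ℚ.↥ x) ≡ 2 * z → ⊥
  both-even yi eq zi eq′ with ℕ.recompute cop (even⇒2∣ zi eq′ , even⇒2∣ {i = ℚ.↧ x} yi eq)
  ... | ()

  reciprocal : ∀ y z → IsInteger y → IsInteger z → fromℤ (ℚ.↧ x) ≡ 2 * y → fromℤ (ℚ.↥ x) ≡ 1 + 2 * z →
    ∃[ y ] Integral y × x * (2 * y) ≡ 1
  reciprocal y z yi zi eq eq′ = y * w ,
    integral yi zi (combine₁ y inv (lemma₂ y z w)) ,
    combine₂ w 1 (trans (cong (x *_) (sym eq)) (trans (x*↧x≡↥x x) eq′)) inv (lemma₁ x y z w)
    where
    unit : ∃[ w ] (1 + 2 * z) * w ≡ 1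
    unit = inverse {1 + 2 * z} (odd≢0 zi)
    w = proj₁ unit
    inv = proj₂ unit
    lemma₁ : ∀ x y z w → x * (2 * (y * w)) - 1 ≡
      w * (x * (2 * y) - (1 + 2 * z)) + 1 * ((1 + 2 * z) * w - 1)
    lemma₁ = solve-∀ ℚ-ring
    lemma₂ : ∀ y z w → y * w * (1 + 2 * z) - y ≡ y * ((1 + 2 * z) * w - 1)
    lemma₂ = solve-∀ ℚ-ring

1+2x≢0 : Integral x → 1 + 2 * x ≢ 0
1+2x≢0 {x} xi eq = go (1+2x-unit xi)
  where
  lemma : ∀ u y → 1 - 0 ≡ - 1 * (u * y - 1) + y * (u - 0)
  lemma = solve-∀ ℚ-ring
  go : ¬ (∃[ y ] Integral y × (1 + 2 * x) * y ≡ 1)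
  go (y , _ , inv) = ℚ.1≢0 (combine₂ (- 1) y inv eq (lemma (1 + 2 * x) y))

abstract
  divide : ∀ {n} → Integral x → Integral n → ∃[ q ] Integral q × q * (1 + 2 * x) ≡ n
  divide {x} {n} xi ni = go (1+2x-unit xi)
    where
    lemma : ∀ n u v → n * v * u - n ≡ n * (u * v - 1)
    lemma = solve-∀ ℚ-ring

    go : (∃[ v ] Integral v × (1 + 2 * x) * v ≡ 1) → ∃[ q ] Integral q × q * (1 + 2 * x) ≡ n
    go (v , vi , inv) = n * v , integral-* ni vi , combine₁ n inv (lemma n (1 + 2 * x) v)

divide³ : ∀ {n} → Integral x → Integral n →
  ∃[ q ] Integral q × q * ((1 + 2 * x) * (1 + 2 * x) * (1 + 2 * x)) ≡ n
divide³ {x} {n} xi ni = go₁ (divide xi ni)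
  where
  u = 1 + 2 * x

  lemma : ∀ u n q₁ q₂ q₃ → q₃ * (u * u * u) - n ≡
    u * u * (q₃ * u - q₂) + u * (q₂ * u - q₁) + 1 * (q₁ * u - n)
  lemma = solve-∀ ℚ-ring

  go₁ : ∃[ q₁ ] Integral q₁ × q₁ * u ≡ n → ∃[ q ] Integral q × q * (u * u * u) ≡ n
  go₁ (q₁ , q₁i , eq₁) = go₂ (divide xi q₁i)
    where
    go₂ : ∃[ q₂ ] Integral q₂ × q₂ * u ≡ q₁ → ∃[ q ] Integral q × q * (u * u * u) ≡ n
    go₂ (q₂ , q₂i , eq₂) = go₃ (divide xi q₂i)
      where
      go₃ : ∃[ q₃ ] Integral q₃ × q₃ * u ≡ q₂ → ∃[ q ] Integral q × q * (u * u * u) ≡ n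
      go₃ (q₃ , q₃i , eq₃) = q₃ , q₃i , combine₃ (u * u) u 1 eq₃ eq₂ eq₁ (lemma u n q₁ q₂ q₃)

-- Congruences modulo δ ℤ₍₂₎, for an arbitrary rational δ.

record Congruent (δ x y : ℚ) : Set where
  constructor congruent
  field
    {quotient}         : ℚ
    quotient-integral  : Integral quotient
    difference         : x - y ≡ δ * quotient

variable
  δ x′ y′ : ℚ

congruent-refl : Congruent δ x x
congruent-refl {δ} {x} = congruent (integral-number 0) (lemma δ x)
  where
  lemma : ∀ δ x → x - x ≡ δ * 0
  lemma = solve-∀ ℚ-ring

congruent-trans : Congruent δ x y → Congruent δ y z → Congruent δ x z
congruent-trans {δ} {x} {y} {z} (congruent {c} ci eq) (congruent {d} di eq′) =
  congruent (integral-+ ci di) (combine₂ 1 1 eq eq′ (lemma δ x y z c d))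
  where
  lemma : ∀ δ x y z c d → (x - z) - δ * (c + d) ≡ 1 * ((x - y) - δ * c) + 1 * ((y - z) - δ * d)
  lemma = solve-∀ ℚ-ring

congruent-+ : Congruent δ x x′ → Congruent δ y y′ → Congruent δ (x + y) (x′ + y′)
congruent-+ {δ} {x} {x′} {y} {y′} (congruent {c} ci eq) (congruent {d} di eq′) =
  congruent (integral-+ ci di) (combine₂ 1 1 eq eq′ (lemma δ x x′ y y′ c d))
  where
  lemma : ∀ δ x x′ y y′ c d → ((x + y) - (x′ + y′)) - δ * (c + d) ≡
    1 * ((x - x′) - δ * c) + 1 * ((y - y′) - δ * d)
  lemma = solve-∀ ℚ-ring

congruent-neg : Congruent δ x y → Congruent δ (- x) (- y)
congruent-neg {δ} {x} {y} (congruent {c} ci eq) =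
  congruent (integral-neg ci) (combine₁ (- 1) eq (lemma δ x y c))
  where
  lemma : ∀ δ x y c → (- x - - y) - δ * (- c) ≡ - 1 * ((x - y) - δ * c)
  lemma = solve-∀ ℚ-ring

congruent-minus : Congruent δ x x′ → Congruent δ y y′ → Congruent δ (x - y) (x′ - y′)
congruent-minus {δ} {x} {x′} {y} {y′} (congruent {c} ci eq) (congruent {d} di eq′) =
  congruent (integral-minus ci di) (combine₂ 1 (- 1) eq eq′ (lemma δ x x′ y y′ c d))
  where
  lemma : ∀ δ x x′ y y′ c d → ((x - y) - (x′ - y′)) - δ * (c - d) ≡
    1 * ((x - x′) - δ * c) + - 1 * ((y - y′) - δ * d)
  lemma = solve-∀ ℚ-ring

congruent-* : Integral x → Integral y′ →
  Congruent δ x x′ → Congruent δ y y′ → Congruent δ (x * y) (x′ * y′)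
congruent-* {x} {y′} {δ} {x′} {y} xi yi (congruent {c} ci eq) (congruent {d} di eq′) =
  congruent (integral-+ (integral-* yi ci) (integral-* xi di))
    (combine₂ y′ x eq eq′ (lemma δ x x′ y y′ c d))
  where
  lemma : ∀ δ x x′ y y′ c d → (x * y - x′ * y′) - δ * (y′ * c + x * d) ≡
    y′ * ((x - x′) - δ * c) + x * ((y - y′) - δ * d)
  lemma = solve-∀ ℚ-ring

congruent-scale : Integral z → Congruent δ x y → Congruent δ (z * x) (z * y)
congruent-scale {z} {δ} {x} {y} zi (congruent {c} ci eq) =
  congruent (integral-* zi ci) (combine₁ z eq (lemma z δ x y c))
  where
  lemma : ∀ z δ x y c → (z * x - z * y) - δ * (z * c) ≡ z * ((x - y) - δ * c)
  lemma = solve-∀ ℚ-ring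

congruent-double : Congruent δ x y → Congruent (2 * δ) (2 * x) (2 * y)
congruent-double {δ} {x} {y} (congruent {c} ci eq) =
  congruent ci (combine₁ 2 eq (lemma δ x y c))
  where
  lemma : ∀ δ x y c → (2 * x - 2 * y) - (2 * δ) * c ≡ 2 * ((x - y) - δ * c)
  lemma = solve-∀ ℚ-ring

congruent-weaken : Integral z → Congruent (z * δ) x y → Congruent δ x y
congruent-weaken {z} {δ} {x} {y} zi (congruent {c} ci eq) =
  congruent (integral-* zi ci) (combine₁ 1 eq (lemma z δ x y c))
  where
  lemma : ∀ z δ x y c → (x - y) - δ * (z * c) ≡ 1 * ((x - y) - z * δ * c)
  lemma = solve-∀ ℚ-ring

-- Follows from (q - q′) u = (n - n′) - q′ (u - u′), because u is a unit.
congruent-quotient : ∀ {u u′ n n′ q q′} → Integral x → u ≡ 1 + 2 * x → Integral q′ →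
  q * u ≡ n → q′ * u′ ≡ n′ → Congruent δ n n′ → Congruent δ u u′ → Congruent δ q q′
congruent-quotient {x} {δ} {u′ = u′} {n} {n′} {q} {q′} xi refl q′i eq eq′ (congruent {c} ci n-n′) (congruent {d} di u-u′) =
  go (1+2x-unit xi)
  where
  lemma₁ : ∀ u u′ n n′ q q′ → (q - q′) * u - ((n - n′) - q′ * (u - u′)) ≡
    1 * (q * u - n) + - 1 * (q′ * u′ - n′)
  lemma₁ = solve-∀ ℚ-ring

  lemma₂ : ∀ δ u v n n′ u′ q q′ c d → (q - q′) - δ * (v * (c - q′ * d)) ≡
    - (q - q′) * (u * v - 1) +
    v * ((q - q′) * u - ((n - n′) - q′ * (u - u′))) +
    1 * (v * ((n - n′) - q′ * (u - u′)) - v * (δ * c - q′ * (δ * d)))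
  lemma₂ = solve-∀ ℚ-ring

  u = 1 + 2 * x

  difference-u : (q - q′) * u ≡ (n - n′) - q′ * (u - u′)
  difference-u = combine₂ 1 (- 1) eq eq′ (lemma₁ u u′ n n′ q q′)

  go : (∃[ v ] Integral v × u * v ≡ 1) → Congruent δ q q′
  go (v , vi , inv) = congruent (integral-* vi (integral-minus ci (integral-* q′i di)))
    (combine₃ (- (q - q′)) v 1 inv
      difference-u
      (cong₂ (λ s t → v * (s - q′ * t)) n-n′ u-u′)
      (lemma₂ δ u v n n′ u′ q q′ c d))

-- Iterates of a map that is 2-adically close to a translation.

iterate : {S : Set} → (S → S) → ℕ.ℕ → S → S
iterate T ℕ.zero    s = s
iterate T (ℕ.suc n) s = T (iterate T n s)

-- If T moves a coordinate ζ by a + 2 S with S divisible by a and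
-- 2-Lipschitz, then T ∘ T moves it by 2 a + 2 S′ with S′ of the same kind. Hence
-- the displacement of T ^ (2 ^ i m), m odd, is an odd multiple of 2 ^ i a.
module Dynamics {State : Set} (ζ : State → ℚ) where

  record Translates (a : ℚ) (T : State → State) : Set where
    field
      excess     : State → ℚ
      step       : ∀ s → ζ (T s) - ζ s ≡ a + 2 * excess s
      divisible  : ∀ s → Congruent a (excess s) 0
      lipschitz  : ∀ {δ} s s′ → Congruent δ (ζ s) (ζ s′) →
                   Congruent (2 * δ) (excess s) (excess s′)

  module _ {a : ℚ} {T : State → State} (translates : Translates a T) where
    open Translates translates

    displacement : ∀ s → Congruent (2 * a) (ζ (T s)) (ζ s + a)
    displacement s = go (divisible s)
      where
      lemma : ∀ a z z′ S c → (z′ - (z + a)) - 2 * a * c ≡ 1 * ((z′ - z) - (a + 2 * S)) + 2 * ((S - 0) - a * c)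
      lemma = solve-∀ ℚ-ring

      go : Congruent a (excess s) 0 → Congruent (2 * a) (ζ (T s)) (ζ s + a)
      go (congruent {c} ci eq) =
        congruent ci (combine₂ 1 2 (step s) eq (lemma a (ζ s) (ζ (T s)) (excess s) c))

    displacement-weak : ∀ s → Congruent a (ζ (T s)) (ζ s)
    displacement-weak s = congruent-trans (congruent-weaken (integral-number 2) (displacement s))
      (congruent (integral-number 1) (lemma a (ζ s)))
      where
      lemma : ∀ a z → (z + a) - z ≡ a * 1
      lemma = solve-∀ ℚ-ring

    contracts : ∀ {δ} s s′ → Congruent δ (ζ s) (ζ s′) → Congruent δ (ζ (T s)) (ζ (T s′))
    contracts {δ} s s′ c = go (congruent-+ c (congruent-weaken (integral-number 2)
      (congruent-scale (integral-number 2) (lipschitz s s′ c))))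
      where
      lemma : ∀ a z Tz z′ Tz′ S S′ D → (Tz - Tz′) - D ≡
        1 * ((Tz - z) - (a + 2 * S)) + - 1 * ((Tz′ - z′) - (a + 2 * S′)) +
        1 * (((z + 2 * S) - (z′ + 2 * S′)) - D)
      lemma = solve-∀ ℚ-ring

      go : Congruent δ (ζ s + 2 * excess s) (ζ s′ + 2 * excess s′) → Congruent δ (ζ (T s)) (ζ (T s′))
      go (congruent {d} di eq) = congruent di (combine₃ 1 (- 1) 1 (step s) (step s′) eq
        (lemma a (ζ s) (ζ (T s)) (ζ s′) (ζ (T s′)) (excess s) (excess s′) (δ * d)))

    -- The new excess is S(s) + S(T s). Since T s is congruent to s modulo a, the Lipschitz
    -- condition gives S(T s) ≡ S(s) modulo 2 a, and so the sum is congruent to 2 S(s), which is 0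
    -- modulo 2 a.
    square : Translates (2 * a) (T ∘ T)
    square = record
      { excess    = λ s → excess s + excess (T s)
      ; step      = λ s → combine₂ 1 1 (step s) (step (T s))
          (lemma₁ a (ζ s) (ζ (T s)) (ζ (T (T s))) (excess s) (excess (T s)))
      ; divisible = λ s → go s (lipschitz (T s) s (displacement-weak s)) (divisible s)
      ; lipschitz = λ s s′ c → congruent-+ (lipschitz s s′ c) (lipschitz (T s) (T s′) (contracts s s′ c))
      }
      where
      lemma₁ : ∀ a z z′ z″ S S′ → (z″ - z) - (2 * a + 2 * (S + S′)) ≡
        1 * ((z′ - z) - (a + 2 * S)) + 1 * ((z″ - z′) - (a + 2 * S′))
      lemma₁ = solve-∀ ℚ-ring

      lemma₂ : ∀ a S S′ c d → ((S + S′) - 0) - 2 * a * (c + d) ≡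
        1 * ((S′ - S) - 2 * a * c) + 2 * ((S - 0) - a * d)
      lemma₂ = solve-∀ ℚ-ring

      go : ∀ s → Congruent (2 * a) (excess (T s)) (excess s) → Congruent a (excess s) 0 →
        Congruent (2 * a) (excess s + excess (T s)) 0
      go s (congruent {c} ci eq) (congruent {d} di eq′) =
        congruent (integral-+ ci di) (combine₂ 1 2 eq eq′ (lemma₂ a (excess s) (excess (T s)) c d))

    displacements : ∀ n s → Congruent (2 * a) (ζ (iterate T n s)) (ζ s + a * fromℤ (ℤ.+ n))
    displacements ℕ.zero s = congruent (integral-number 0) (lemma a (ζ s))
      where
      lemma : ∀ a z → z - (z + a * 0) ≡ 2 * a * 0
      lemma = solve-∀ ℚ-ring
    displacements (ℕ.suc n) s = subst (Congruent (2 * a) _)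
      (trans (lemma a (ζ s) (fromℤ (ℤ.+ n))) (cong (λ N → ζ s + a * N) (fromℤ-+ (ℤ.+ 1) (ℤ.+ n))))
      (congruent-trans (displacement (iterate T n s)) (congruent-+ (displacements n s) congruent-refl))
      where
      lemma : ∀ a z N → (z + a * N) + a ≡ z + a * (1 + N)
      lemma = solve-∀ ℚ-ring

    -- Modulo 2 a the displacement after 1 + 2 m steps is (1 + 2 m) a. If it vanished, a times an
    -- odd element of ℤ₍₂₎ would be 0.
    odd-moves : ∀ m s → a ≢ 0 → ζ (iterate T (ℕ.suc (m ℕ.+ m)) s) ≢ ζ s
    odd-moves m s a≢0 fixed = go (displacements (ℕ.suc (m ℕ.+ m)) s)
      where
      M = fromℤ (ℤ.+ m)

      1+M+M : fromℤ (ℤ.+ ℕ.suc (m ℕ.+ m)) ≡ 1 + (M + M)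
      1+M+M = sym (trans (cong (1 +_) (fromℤ-+ (ℤ.+ m) (ℤ.+ m))) (fromℤ-+ (ℤ.+ 1) (ℤ.+ (m ℕ.+ m))))

      lemma : ∀ a z z′ N M c → a * (1 + 2 * (M + c)) - 0 ≡
        1 * (z′ - z) + - 1 * ((z′ - (z + a * N)) - 2 * a * c) + - a * (N - (1 + (M + M)))
      lemma = solve-∀ ℚ-ring

      go : Congruent (2 * a) (ζ (iterate T (ℕ.suc (m ℕ.+ m)) s)) (ζ s + a * fromℤ (ℤ.+ ℕ.suc (m ℕ.+ m))) → ⊥
      go (congruent {c} ci eq) =
        [ a≢0 , 1+2x≢0 (integral-+ (integral-fromℤ (ℤ.+ m)) ci) ]′
        (xy≡0⇒x≡0∨y≡0 (combine₃ 1 (- 1) (- a) fixed eq 1+M+M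
          (lemma a (ζ s) (ζ (iterate T (ℕ.suc (m ℕ.+ m)) s)) (fromℤ (ℤ.+ ℕ.suc (m ℕ.+ m))) M c)))

  iterate-double : ∀ (T : State → State) m s → iterate T (m ℕ.+ m) s ≡ iterate (T ∘ T) m s
  iterate-double T ℕ.zero    s = refl
  iterate-double T (ℕ.suc m) s = trans (cong (λ n → T (iterate T n s)) (ℕ.+-suc m m))
    (cong (T ∘ T) (iterate-double T m s))

  moves : ∀ {a T} → Translates a T → a ≢ 0 → ∀ n s → n ≢ 0 → ζ (iterate T n s) ≢ ζ s
  moves translates a≢0 n = bounded n translates a≢0 n ℕ.≤-refl
    where
    halve : ∀ n → (∃[ m ] n ≡ m ℕ.+ m) ⊎ (∃[ m ] n ≡ ℕ.suc (m ℕ.+ m))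
    halve ℕ.zero    = inj₁ (0 , refl)
    halve (ℕ.suc n) with halve n
    ... | inj₁ (m , refl) = inj₂ (m , refl)
    ... | inj₂ (m , refl) = inj₁ (ℕ.suc m , cong ℕ.suc (sym (ℕ.+-suc m m)))

    -- An even exponent is halved while `T` is replaced by its square; the bound `f` makes this
    -- recursion structural.
    bounded : ∀ f {a T} → Translates a T → a ≢ 0 → ∀ n → n ℕ.≤ f → ∀ s → n ≢ 0 →
      ζ (iterate T n s) ≢ ζ s
    bounded f translates a≢0 ℕ.zero n≤f s n≢0 = ⊥-elim (n≢0 refl)
    bounded (ℕ.suc f) {a} {T} translates a≢0 (ℕ.suc n) (ℕ.s≤s n≤f) s _ = by-parity (halve (ℕ.suc n))
      where
      by-parity : (∃[ m ] ℕ.suc n ≡ m ℕ.+ m) ⊎ (∃[ m ] ℕ.suc n ≡ ℕ.suc (m ℕ.+ m)) →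
        ζ (iterate T (ℕ.suc n) s) ≢ ζ s
      by-parity (inj₁ (ℕ.suc m , eq)) fixed = bounded f (square translates) (xy≢0 {2} (λ ()) a≢0) (ℕ.suc m)
        (ℕ.≤-trans (ℕ.s≤s (ℕ.m≤m+n m m))
          (ℕ.≤-trans (ℕ.≤-reflexive (sym (trans (ℕ.suc-injective eq) (ℕ.+-suc m m)))) n≤f)) s (λ ())
        (trans (cong ζ (trans (sym (iterate-double T (ℕ.suc m) s)) (cong (λ n → iterate T n s) (sym eq)))) fixed)
      by-parity (inj₂ (m , eq)) fixed =
        odd-moves translates m s a≢0 (trans (cong (λ n → ζ (iterate T n s)) (sym eq)) fixed)

-- The chord-and-tangent law in coordinates at infinity.

⊕-chord : ∀ x₁ y₁ x₂ y₂ → x₂ - x₁ ≢ 0 →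
  ∃[ m ] m * (x₂ - x₁) ≡ y₂ - y₁ × aff x₁ y₁ ⊕ aff x₂ y₂ ≡ chord m x₁ y₁ x₂
⊕-chord x₁ y₁ x₂ y₂ x₂≢x₁ with x₂ - x₁ ≟ 0
... | yes eq = ⊥-elim (x₂≢x₁ eq)
... | no  x₂≢x₁ = (y₂ - y₁) * (1/ (x₂ - x₁)) {{≢-nonZero x₂≢x₁}} ,
  combine₁ (y₂ - y₁) (ℚ.*-inverseʳ (x₂ - x₁) {{≢-nonZero x₂≢x₁}})
    (lemma (y₂ - y₁) (x₂ - x₁) ((1/ (x₂ - x₁)) {{≢-nonZero x₂≢x₁}})) ,
  refl
  where
  lemma : ∀ y x x⁻¹ → y * x⁻¹ * x - y ≡ y * (x * x⁻¹ - 1)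
  lemma = solve-∀ ℚ-ring

⊕-tangent : ∀ x₁ y₁ x₂ y₂ → x₂ - x₁ ≡ 0 → y₁ + y₂ ≢ 0 →
  ∃[ m ] m * (y₁ + y₂) ≡ 3 * (x₁ * x₁) × aff x₁ y₁ ⊕ aff x₂ y₂ ≡ chord m x₁ y₁ x₂
⊕-tangent x₁ y₁ x₂ y₂ x₂≡x₁ y₁≢-y₂ with x₂ - x₁ ≟ 0
... | no  x₂≢x₁ = ⊥-elim (x₂≢x₁ x₂≡x₁)
... | yes _ with y₁ + y₂ ≟ 0
... | yes eq = ⊥-elim (y₁≢-y₂ eq)
... | no  y₁≢-y₂ = (x₁ * x₁ + x₁ * x₁ + x₁ * x₁) * (1/ (y₁ + y₂)) {{≢-nonZero y₁≢-y₂}} ,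
  combine₁ (3 * (x₁ * x₁)) (ℚ.*-inverseʳ (y₁ + y₂) {{≢-nonZero y₁≢-y₂}})
    (lemma x₁ (y₁ + y₂) ((1/ (y₁ + y₂)) {{≢-nonZero y₁≢-y₂}})) ,
  refl
  where
  lemma : ∀ x y y⁻¹ → (x * x + x * x + x * x) * y⁻¹ * y - 3 * (x * x) ≡ 3 * (x * x) * (y * y⁻¹ - 1)
  lemma = solve-∀ ℚ-ring

⊕-opposite : ∀ x₁ y₁ x₂ y₂ → x₂ - x₁ ≡ 0 → y₁ + y₂ ≡ 0 → aff x₁ y₁ ⊕ aff x₂ y₂ ≡ ∞
⊕-opposite x₁ y₁ x₂ y₂ x₂≡x₁ y₁≡-y₂ with x₂ - x₁ ≟ 0
... | no  x₂≢x₁ = ⊥-elim (x₂≢x₁ x₂≡x₁)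
... | yes _ with y₁ + y₂ ≟ 0
... | yes _ = refl
... | no y₁≢-y₂ = ⊥-elim (y₁≢-y₂ y₁≡-y₂)

-- In the coordinates z = x / (s y), w = 1 / (s³ y) the curve y² = x³ + k becomes
-- w = z³ + κ w³ with κ = s⁶ k, and ∞ becomes the origin. This is the line
-- w = ℓ z + μ through (1 , ℓ + μ) and (z , ℓ z + μ), whose third intersection
-- with the curve is (- z′ , μ - ℓ z′).
module Secant {κ ℓ μ z z′ : ℚ}
  (base  : ℓ + μ ≡ 1 + κ * ((ℓ + μ) * (ℓ + μ) * (ℓ + μ)))
  (slope : z * z + z + 1 ≡
    ℓ * (1 - κ * ((ℓ * z + μ) * (ℓ * z + μ) + (ℓ * z + μ) * (ℓ + μ) + (ℓ + μ) * (ℓ + μ))))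
  (vieta₁ : (1 + κ * (ℓ * ℓ * ℓ)) * (z′ - z - 1) ≡ 3 * κ * (ℓ * ℓ) * μ)
  where

  V w₁ w w′ : ℚ
  V  = 1 + κ * (ℓ * ℓ * ℓ)
  w₁ = ℓ + μ
  w  = ℓ * z + μ
  w′ = ℓ * z′ - μ

  on-curve : w′ ≡ z′ * z′ * z′ + κ * (w′ * w′ * w′)
  on-curve = combine₃ (- 1) (- (z′ + 1)) (- ((z′ + 1) * (z′ + z))) base slope vieta₁ (lemma κ ℓ μ z z′)
    where
    lemma : ∀ κ ℓ μ z z′ →
      (ℓ * z′ - μ) - (z′ * z′ * z′ + κ * ((ℓ * z′ - μ) * (ℓ * z′ - μ) * (ℓ * z′ - μ))) ≡
      - 1 * (ℓ + μ - (1 + κ * ((ℓ + μ) * (ℓ + μ) * (ℓ + μ)))) +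
      - (z′ + 1) * (z * z + z + 1 - ℓ * (1 - κ * ((ℓ * z + μ) * (ℓ * z + μ) + (ℓ * z + μ) * (ℓ + μ) + (ℓ + μ) * (ℓ + μ)))) +
      - ((z′ + 1) * (z′ + z)) * ((1 + κ * (ℓ * ℓ * ℓ)) * (z′ - z - 1) - 3 * κ * (ℓ * ℓ) * μ)
    lemma = solve-∀ ℚ-ring

  -- 1, z and - z′ are the roots in Z of Z³ + κ (ℓ Z + μ)³ - (ℓ Z + μ), whose leading coefficient is
  -- `V`. The hypothesis `vieta₁` gives their sum; this and `vieta₃` give the other two elementary
  -- symmetric functions.
  vieta₂ : V * (z - z′ - z * z′) ≡ 3 * κ * ℓ * (μ * μ) - ℓ
  vieta₂ = combine₂ (- 1) (- (1 + z)) slope vieta₁ (lemma κ ℓ μ z z′)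
    where
    lemma : ∀ κ ℓ μ z z′ →
      (1 + κ * (ℓ * ℓ * ℓ)) * (z - z′ - z * z′) - (3 * κ * ℓ * (μ * μ) - ℓ) ≡
      - 1 * (z * z + z + 1 - ℓ * (1 - κ * ((ℓ * z + μ) * (ℓ * z + μ) + (ℓ * z + μ) * (ℓ + μ) + (ℓ + μ) * (ℓ + μ)))) +
      - (1 + z) * ((1 + κ * (ℓ * ℓ * ℓ)) * (z′ - z - 1) - 3 * κ * (ℓ * ℓ) * μ)
    lemma = solve-∀ ℚ-ring

  vieta₃ : V * (z * z′) ≡ κ * (μ * μ * μ) - μ
  vieta₃ = combine₃ 1 1 z base slope vieta₁ (lemma κ ℓ μ z z′)
    where
    lemma : ∀ κ ℓ μ z z′ →
      (1 + κ * (ℓ * ℓ * ℓ)) * (z * z′) - (κ * (μ * μ * μ) - μ) ≡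
      1 * (ℓ + μ - (1 + κ * ((ℓ + μ) * (ℓ + μ) * (ℓ + μ)))) +
      1 * (z * z + z + 1 - ℓ * (1 - κ * ((ℓ * z + μ) * (ℓ * z + μ) + (ℓ * z + μ) * (ℓ + μ) + (ℓ + μ) * (ℓ + μ)))) +
      z * ((1 + κ * (ℓ * ℓ * ℓ)) * (z′ - z - 1) - 3 * κ * (ℓ * ℓ) * μ)
    lemma = solve-∀ ℚ-ring

  -- For ℓ ≠ 0 the product of ℓ Z + μ over the three roots is - ℓ³ / V times the value of the cubic
  -- at Z = - μ / ℓ, where only the term Z³ survives. The root - z′ contributes the factor - w′.
  product-w : V * (w₁ * w * w′) ≡ - (μ * μ * μ)
  product-w = combine₃ (ℓ * (μ * μ)) (- (ℓ * ℓ * μ)) (ℓ * ℓ * ℓ) vieta₁ vieta₂ vieta₃ (lemma κ ℓ μ z z′)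
    where
    lemma : ∀ κ ℓ μ z z′ →
      (1 + κ * (ℓ * ℓ * ℓ)) * ((ℓ + μ) * (ℓ * z + μ) * (ℓ * z′ - μ)) - (- (μ * μ * μ)) ≡
      ℓ * (μ * μ) * ((1 + κ * (ℓ * ℓ * ℓ)) * (z′ - z - 1) - 3 * κ * (ℓ * ℓ) * μ) +
      - (ℓ * ℓ * μ) * ((1 + κ * (ℓ * ℓ * ℓ)) * (z - z′ - z * z′) - (3 * κ * ℓ * (μ * μ) - ℓ)) +
      ℓ * ℓ * ℓ * ((1 + κ * (ℓ * ℓ * ℓ)) * (z * z′) - (κ * (μ * μ * μ) - μ))
    lemma = solve-∀ ℚ-ring

  -- Divided by `product-w` this says that the abscissae 1 / w₁, z / w and z′ / w′ add up to (ℓ /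
  -- μ)²: the familiar x₁ + x₂ + x₃ = m².
  sum-x : V * (w₁ * w * z′ + w₁ * z * w′ + w * w′) ≡ - (ℓ * ℓ * μ)
  sum-x = combine₃ (μ * μ) (- (2 * ℓ * μ)) (3 * (ℓ * ℓ)) vieta₁ vieta₂ vieta₃ (lemma κ ℓ μ z z′)
    where
    lemma : ∀ κ ℓ μ z z′ →
      (1 + κ * (ℓ * ℓ * ℓ)) * ((ℓ + μ) * (ℓ * z + μ) * z′ + (ℓ + μ) * z * (ℓ * z′ - μ) + (ℓ * z + μ) * (ℓ * z′ - μ)) - (- (ℓ * ℓ * μ)) ≡
      μ * μ * ((1 + κ * (ℓ * ℓ * ℓ)) * (z′ - z - 1) - 3 * κ * (ℓ * ℓ) * μ) +
      - (2 * ℓ * μ) * ((1 + κ * (ℓ * ℓ * ℓ)) * (z - z′ - z * z′) - (3 * κ * ℓ * (μ * μ) - ℓ)) +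
      3 * (ℓ * ℓ) * ((1 + κ * (ℓ * ℓ * ℓ)) * (z * z′) - (κ * (μ * μ * μ) - μ))
    lemma = solve-∀ ℚ-ring

  -- The scaled coordinates of the two points are a = s² x₁, d = s³ y₁,
  -- b = s² x₂, c = s³ y₂, and n = s m for the slope m of the line joining them.
  module Points (V≢0 : V ≢ 0) (w₁≢0 : w₁ ≢ 0) (w≢0 : w ≢ 0) (a b c d : ℚ)
    (a-eq : a * w₁ ≡ 1) (d-eq : d * w₁ ≡ 1) (b-eq : b * w ≡ z) (c-eq : c * w ≡ 1) where

    b-a : (b - a) * (w₁ * w) ≡ μ * (z - 1)
    b-a = combine₂ w₁ (- w) b-eq a-eq (lemma ℓ μ z a b)
      where
      lemma : ∀ ℓ μ z a b → (b - a) * ((ℓ + μ) * (ℓ * z + μ)) - μ * (z - 1) ≡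
        (ℓ + μ) * (b * (ℓ * z + μ) - z) + - (ℓ * z + μ) * (a * (ℓ + μ) - 1)
      lemma = solve-∀ ℚ-ring

    c-d : (c - d) * (w₁ * w) ≡ - ℓ * (z - 1)
    c-d = combine₂ w₁ (- w) c-eq d-eq (lemma ℓ μ z c d)
      where
      lemma : ∀ ℓ μ z c d → (c - d) * ((ℓ + μ) * (ℓ * z + μ)) - (- ℓ) * (z - 1) ≡
        (ℓ + μ) * (c * (ℓ * z + μ) - 1) + - (ℓ * z + μ) * (d * (ℓ + μ) - 1)
      lemma = solve-∀ ℚ-ring

    d+c : (d + c) * (w₁ * w) ≡ ℓ * (1 + z) + 2 * μ
    d+c = combine₂ w₁ w c-eq d-eq (lemma ℓ μ z c d)
      where
      lemma : ∀ ℓ μ z c d → (d + c) * ((ℓ + μ) * (ℓ * z + μ)) - (ℓ * (1 + z) + 2 * μ) ≡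
        (ℓ + μ) * (c * (ℓ * z + μ) - 1) + (ℓ * z + μ) * (d * (ℓ + μ) - 1)
      lemma = solve-∀ ℚ-ring

    z-1≢0 : b - a ≢ 0 → z - 1 ≢ 0
    z-1≢0 b≢a z≡1 = xy≢0 b≢a (xy≢0 w₁≢0 w≢0) (trans b-a (trans (cong (μ *_) z≡1) (ℚ.*-zeroʳ μ)))

    μ≢0-chord : b - a ≢ 0 → μ ≢ 0
    μ≢0-chord b≢a μ≡0 = xy≢0 b≢a (xy≢0 w₁≢0 w≢0) (trans b-a (trans (cong (_* (z - 1)) μ≡0) (ℚ.*-zeroˡ (z - 1))))

    -- In the scaled affine coordinates x = z / w, y = 1 / w the line w = ℓ z + μ reads 1 = ℓ x + μ
    -- y, which has slope - ℓ / μ.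
    slope-chord : ∀ n → b - a ≢ 0 → n * (b - a) ≡ c - d → n * μ ≡ - ℓ
    slope-chord n b≢a eq = *-cancelˡ (z-1≢0 b≢a)
      (combine₃ (w₁ * w) (- n) 1 eq b-a c-d (lemma ℓ μ z a b c d n))
      where
      lemma : ∀ ℓ μ z a b c d n → (z - 1) * (n * μ) - (z - 1) * (- ℓ) ≡
        (ℓ + μ) * (ℓ * z + μ) * (n * (b - a) - (c - d)) +
        - n * ((b - a) * ((ℓ + μ) * (ℓ * z + μ)) - μ * (z - 1)) +
        1 * ((c - d) * ((ℓ + μ) * (ℓ * z + μ)) - (- ℓ) * (z - 1))
      lemma = solve-∀ ℚ-ring

    μz≡μ : b - a ≡ 0 → μ * (z - 1) ≡ 0
    μz≡μ b≡a = trans (sym b-a) (trans (cong (_* (w₁ * w)) b≡a) (ℚ.*-zeroˡ (w₁ * w)))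

    μ≡0-opposite : b - a ≡ 0 → d + c ≡ 0 → μ ≡ 0
    μ≡0-opposite b≡a c≡-d = [ (λ μ≡0 → μ≡0) , (λ z≡1 → ⊥-elim (xy≢0 {2} (λ ()) w₁≢0
        (combine₂ 1 (- ℓ) (trans (sym d+c) (trans (cong (_* (w₁ * w)) c≡-d) (ℚ.*-zeroˡ (w₁ * w)))) z≡1 (lemma ℓ μ z)))) ]′
      (xy≡0⇒x≡0∨y≡0 (μz≡μ b≡a))
      where
      lemma : ∀ ℓ μ z → 2 * (ℓ + μ) - 0 ≡ 1 * (ℓ * (1 + z) + 2 * μ - 0) + - ℓ * (z - 1 - 0)
      lemma = solve-∀ ℚ-ring

    -- A line with μ = 0 passes through ∞. Then `base` and `slope` give ℓ z (1 + z) = 0, so the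
    -- second point is ∞ (z = 0) or opposite to the first (z = - 1); `w≢0` and the hypothesis
    -- exclude these.
    μ≢0-tangent : d + c ≢ 0 → μ ≢ 0
    μ≢0-tangent c≢-d μ≡0 = [ w≢0 ∘ w≡0 , xy≢0 c≢-d (xy≢0 w₁≢0 w≢0) ∘ trans d+c ∘ 1+z≡0 ]′
      (xy≡0⇒x≡0∨y≡0 (*-cancelˡ ℓ≢0 (with-μ≡0 μ≡0 base slope)))
      where
      ℓ≢0 : ℓ ≢ 0
      ℓ≢0 ℓ≡0 = w₁≢0 (combine₂ 1 1 ℓ≡0 μ≡0 (lemma ℓ μ))
        where
        lemma : ∀ ℓ μ → (ℓ + μ) - 0 ≡ 1 * (ℓ - 0) + 1 * (μ - 0)
        lemma = solve-∀ ℚ-ring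

      lemma₁ : ∀ κ ℓ z → ℓ * (z * (1 + z)) - ℓ * 0 ≡
        (z * z + z + 1) * (ℓ + 0 - (1 + κ * ((ℓ + 0) * (ℓ + 0) * (ℓ + 0)))) +
        1 * (z * z + z + 1 - ℓ * (1 - κ * ((ℓ * z + 0) * (ℓ * z + 0) + (ℓ * z + 0) * (ℓ + 0) + (ℓ + 0) * (ℓ + 0))))
      lemma₁ = solve-∀ ℚ-ring

      with-μ≡0 : ∀ {μ} → μ ≡ 0 → ℓ + μ ≡ 1 + κ * ((ℓ + μ) * (ℓ + μ) * (ℓ + μ)) →
        z * z + z + 1 ≡ ℓ * (1 - κ * ((ℓ * z + μ) * (ℓ * z + μ) + (ℓ * z + μ) * (ℓ + μ) + (ℓ + μ) * (ℓ + μ))) →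
        ℓ * (z * (1 + z)) ≡ ℓ * 0
      with-μ≡0 refl b s = combine₂ (z * z + z + 1) 1 b s (lemma₁ κ ℓ z)

      w≡0 : z ≡ 0 → w ≡ 0
      w≡0 z≡0 = combine₂ ℓ 1 z≡0 μ≡0 (lemma ℓ μ z)
        where
        lemma : ∀ ℓ μ z → (ℓ * z + μ) - 0 ≡ ℓ * (z - 0) + 1 * (μ - 0)
        lemma = solve-∀ ℚ-ring

      1+z≡0 : 1 + z ≡ 0 → ℓ * (1 + z) + 2 * μ ≡ 0
      1+z≡0 eq = combine₂ ℓ 2 eq μ≡0 (lemma ℓ μ z)
        where
        lemma : ∀ ℓ μ z → ℓ * (1 + z) + 2 * μ - 0 ≡ ℓ * (1 + z - 0) + 2 * (μ - 0)
        lemma = solve-∀ ℚ-ring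

    -- As μ ≠ 0, equal abscissae force z = 1. Then d = c = a = 1 / w₁ gives n = 3 / 2 w₁, while
    -- `base` and `slope` give 3 μ = - 2 ℓ w₁.
    slope-tangent : ∀ n → b - a ≡ 0 → d + c ≢ 0 → n * (d + c) ≡ 3 * (a * a) → n * μ ≡ - ℓ
    slope-tangent n b≡a c≢-d eq =
      [ ⊥-elim ∘ μ≢0-tangent c≢-d , (λ z-1≡0 → with-z≡1 (x-y≡0⇒x≡y z-1≡0) slope d+c) ]′
      (xy≡0⇒x≡0∨y≡0 (μz≡μ b≡a))
      where
      lemma₀ : ∀ κ ℓ μ → (3 * μ + 2 * ℓ * (ℓ + μ)) - 0 ≡
        3 * ℓ * (ℓ + μ - (1 + κ * ((ℓ + μ) * (ℓ + μ) * (ℓ + μ)))) +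
        (ℓ + μ) * (1 * 1 + 1 + 1 - ℓ * (1 - κ * ((ℓ * 1 + μ) * (ℓ * 1 + μ) + (ℓ * 1 + μ) * (ℓ + μ) + (ℓ + μ) * (ℓ + μ))))
      lemma₀ = solve-∀ ℚ-ring

      lemma₁ : ∀ ℓ μ a n C → 2 * (ℓ + μ) * n - 3 ≡
        - (n) * (C * ((ℓ + μ) * (ℓ * 1 + μ)) - (ℓ * (1 + 1) + 2 * μ)) +
        (ℓ + μ) * (ℓ + μ) * (n * C - 3 * (a * a)) +
        3 * (a * (ℓ + μ) + 1) * (a * (ℓ + μ) - 1)
      lemma₁ = solve-∀ ℚ-ring

      lemma₂ : ∀ ℓ μ n → 2 * (ℓ + μ) * (n * μ) - 2 * (ℓ + μ) * (- ℓ) ≡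
        μ * (2 * (ℓ + μ) * n - 3) + 1 * (3 * μ + 2 * ℓ * (ℓ + μ) - 0)
      lemma₂ = solve-∀ ℚ-ring

      with-z≡1 : ∀ {z} → z ≡ 1 →
        z * z + z + 1 ≡ ℓ * (1 - κ * ((ℓ * z + μ) * (ℓ * z + μ) + (ℓ * z + μ) * (ℓ + μ) + (ℓ + μ) * (ℓ + μ))) →
        (d + c) * ((ℓ + μ) * (ℓ * z + μ)) ≡ ℓ * (1 + z) + 2 * μ →
        n * μ ≡ - ℓ
      with-z≡1 refl s e = *-cancelˡ (xy≢0 {2} (λ ()) w₁≢0) (combine₂ μ 1 2w₁n≡3 3μ+2ℓw₁≡0 (lemma₂ ℓ μ n))
        where
        2w₁n≡3 : 2 * w₁ * n ≡ 3
        2w₁n≡3 = combine₃ (- n) (w₁ * w₁) (3 * (a * w₁ + 1)) e eq a-eq (lemma₁ ℓ μ a n (d + c))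

        3μ+2ℓw₁≡0 : 3 * μ + 2 * ℓ * w₁ ≡ 0
        3μ+2ℓw₁≡0 = combine₂ (3 * ℓ) w₁ base s (lemma₀ κ ℓ μ)

    x-sum : ∀ n → n * μ ≡ - ℓ → μ ≢ 0 → (n * n - a - b) * w′ ≡ z′
    x-sum n nμ μ≢0 = *-cancelˡ (xy≢0 (xy≢0 μ≢0 μ≢0) (xy≢0 V≢0 (xy≢0 w₁≢0 w≢0)))
      (combine₃ 1 (ℓ * ℓ) (- (μ * μ)) expanded product-w sum-x (lemma₂ V ℓ μ z z′ a b n w₁ w w′))
      where
      lemma₁ : ∀ V ℓ μ z a b n w₁ w w′ →
        μ * μ * (V * (w₁ * w)) * ((n * n - a - b) * w′) -
          (ℓ * ℓ * (V * (w₁ * w * w′)) - μ * μ * (V * (w * w′ + z * w₁ * w′))) ≡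
        (n * μ - ℓ) * (V * (w₁ * w * w′)) * (n * μ - (- ℓ)) +
        - (μ * μ * (V * (w * w′))) * (a * w₁ - 1) + - (μ * μ * (V * (w₁ * w′))) * (b * w - z)
      lemma₁ = solve-∀ ℚ-ring

      expanded : μ * μ * (V * (w₁ * w)) * ((n * n - a - b) * w′) ≡
        ℓ * ℓ * (V * (w₁ * w * w′)) - μ * μ * (V * (w * w′ + z * w₁ * w′))
      expanded = combine₃ ((n * μ - ℓ) * (V * (w₁ * w * w′)))
        (- (μ * μ * (V * (w * w′)))) (- (μ * μ * (V * (w₁ * w′))))
        nμ a-eq b-eq (lemma₁ V ℓ μ z a b n w₁ w w′)

      lemma₂ : ∀ V ℓ μ z z′ a b n w₁ w w′ →
        μ * μ * (V * (w₁ * w)) * ((n * n - a - b) * w′) - μ * μ * (V * (w₁ * w)) * z′ ≡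
        1 * (μ * μ * (V * (w₁ * w)) * ((n * n - a - b) * w′) -
          (ℓ * ℓ * (V * (w₁ * w * w′)) - μ * μ * (V * (w * w′ + z * w₁ * w′)))) +
        ℓ * ℓ * (V * (w₁ * w * w′) - (- (μ * μ * μ))) +
        - (μ * μ) * (V * (w₁ * w * z′ + w₁ * z * w′ + w * w′) - (- (ℓ * ℓ * μ)))
      lemma₂ = solve-∀ ℚ-ring

    y-sum : ∀ n e → n * μ ≡ - ℓ → μ ≢ 0 → e * w′ ≡ z′ → (n * (a - e) - d) * w′ ≡ 1
    y-sum n e nμ μ≢0 ew′ = *-cancelˡ (xy≢0 μ≢0 w₁≢0) 
      (combine₂ 1 (w₁ * ℓ) expanded ew′ (lemma₂ ℓ μ a d e n z′))
      where
      lemma₁ : ∀ ℓ μ a d e n z′ →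
        μ * (ℓ + μ) * ((n * (a - e) - d) * (ℓ * z′ - μ)) - ((ℓ + μ) * (ℓ * e * (ℓ * z′ - μ) - (ℓ * z′ - μ))) ≡
        (a - e) * ((ℓ + μ) * (ℓ * z′ - μ)) * (n * μ - (- ℓ)) +
        - (ℓ * (ℓ * z′ - μ)) * (a * (ℓ + μ) - 1) + - (μ * (ℓ * z′ - μ)) * (d * (ℓ + μ) - 1)
      lemma₁ = solve-∀ ℚ-ring

      expanded : μ * w₁ * ((n * (a - e) - d) * w′) ≡ w₁ * (ℓ * e * w′ - w′)
      expanded = combine₃ ((a - e) * (w₁ * w′)) (- (ℓ * w′)) (- (μ * w′)) nμ a-eq d-eq (lemma₁ ℓ μ a d e n z′)

      lemma₂ : ∀ ℓ μ a d e n z′ →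
        μ * (ℓ + μ) * ((n * (a - e) - d) * (ℓ * z′ - μ)) - μ * (ℓ + μ) * 1 ≡
        1 * (μ * (ℓ + μ) * ((n * (a - e) - d) * (ℓ * z′ - μ)) - ((ℓ + μ) * (ℓ * e * (ℓ * z′ - μ) - (ℓ * z′ - μ)))) +
        (ℓ + μ) * ℓ * (e * (ℓ * z′ - μ) - z′)
      lemma₂ = solve-∀ ℚ-ring

-- For ∞ only w is prescribed, since on the curve w = 0 forces z = 0. An affine point is represented
-- only if y ≠ 0.
Represents : (s : ℚ) → Point → (z w : ℚ) → Set
Represents s ∞         z w = w ≡ 0
Represents s (aff x y) z w = s * s * x * w ≡ z × s * s * s * y * w ≡ 1

xy≡1⇒x≢0 : x * y ≡ 1 → x ≢ 0
xy≡1⇒x≢0 {y = y} eq refl = ℚ.1≢0 (trans (sym eq) (ℚ.*-zeroˡ y))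

xy≡1⇒y≢0 : x * y ≡ 1 → y ≢ 0
xy≡1⇒y≢0 {x} {y} eq = xy≡1⇒x≢0 (trans (ℚ.*-comm y x) eq)

-- `_⊕_` distinguishes chords, tangents and opposite points, whereas the coordinates at infinity
-- have one formula for all of them. Each branch is matched with that formula; for opposite points μ
-- = 0, and `product-w` then leaves w′ = 0.
represents-⊕ : ∀ {κ ℓ μ z z′ w₁ w s x₁ y₁ x₂ y₂} → w₁ ≡ ℓ + μ → w ≡ ℓ * z + μ →
  w₁ ≡ 1 + κ * (w₁ * w₁ * w₁) →
  z * z + z + 1 ≡ ℓ * (1 - κ * (w * w + w * w₁ + w₁ * w₁)) →
  (1 + κ * (ℓ * ℓ * ℓ)) * (z′ - z - 1) ≡ 3 * κ * (ℓ * ℓ) * μ →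
  1 + κ * (ℓ * ℓ * ℓ) ≢ 0 →
  Represents s (aff x₁ y₁) 1 w₁ → Represents s (aff x₂ y₂) z w →
  Represents s (aff x₁ y₁ ⊕ aff x₂ y₂) z′ (ℓ * z′ - μ)
represents-⊕ {κ} {ℓ} {μ} {z} {z′} {_} {_} {s} {x₁} {y₁} {x₂} {y₂} refl refl base slope vieta₁ V≢0 (a-eq , d-eq) (b-eq , c-eq) =
  split-x (x₂ - x₁ ≟ 0)
  where
  module S = Secant {κ} {ℓ} {μ} {z} {z′} base slope vieta₁

  w₁≢0 : S.w₁ ≢ 0
  w₁≢0 = xy≡1⇒y≢0 {s * s * s * y₁} d-eq

  w≢0 : S.w ≢ 0
  w≢0 = xy≡1⇒y≢0 {s * s * s * y₂} c-eq

  s≢0 : s ≢ 0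
  s≢0 refl = ℚ.1≢0 (trans (sym c-eq) (lemma y₂ S.w))
    where
    lemma : ∀ y w → 0 * 0 * 0 * y * w ≡ 0
    lemma = solve-∀ ℚ-ring

  a = s * s * x₁
  b = s * s * x₂
  c = s * s * s * y₂
  d = s * s * s * y₁

  module T = S.Points V≢0 w₁≢0 w≢0 a b c d a-eq d-eq b-eq c-eq

  b-a≡ : b - a ≡ s * s * (x₂ - x₁)
  b-a≡ = lemma s x₁ x₂
    where
    lemma : ∀ s x₁ x₂ → s * s * x₂ - s * s * x₁ ≡ s * s * (x₂ - x₁)
    lemma = solve-∀ ℚ-ring

  d+c≡ : d + c ≡ s * s * s * (y₁ + y₂)
  d+c≡ = lemma s y₁ y₂
    where
    lemma : ∀ s y₁ y₂ → s * s * s * y₁ + s * s * s * y₂ ≡ s * s * s * (y₁ + y₂)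
    lemma = solve-∀ ℚ-ring

  b-a≡0 : x₂ - x₁ ≡ 0 → b - a ≡ 0
  b-a≡0 eq = trans b-a≡ (trans (cong (s * s *_) eq) (ℚ.*-zeroʳ (s * s)))

  b-a≢0 : x₂ - x₁ ≢ 0 → b - a ≢ 0
  b-a≢0 ne eq = xy≢0 (xy≢0 s≢0 s≢0) ne (trans (sym b-a≡) eq)

  d+c≡0 : y₁ + y₂ ≡ 0 → d + c ≡ 0
  d+c≡0 eq = trans d+c≡ (trans (cong (s * s * s *_) eq) (ℚ.*-zeroʳ (s * s * s)))

  d+c≢0 : y₁ + y₂ ≢ 0 → d + c ≢ 0
  d+c≢0 ne eq = xy≢0 (xy≢0 (xy≢0 s≢0 s≢0) s≢0) ne (trans (sym d+c≡) eq)

  represents-chord : ∀ m → s * m * μ ≡ - ℓ → μ ≢ 0 → Represents s (chord m x₁ y₁ x₂) z′ (ℓ * z′ - μ)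
  represents-chord m nμ μ≢0 =
    x-eq ,
    trans (lemma₂ s m x₁ x₃ y₁ (ℓ * z′ - μ)) (T.y-sum (s * m) (s * s * x₃) nμ μ≢0 x-eq)
    where
    x₃ = m * m - x₁ - x₂

    lemma₁ : ∀ s m x₁ x₂ w′ → s * s * (m * m - x₁ - x₂) * w′ ≡ (s * m * (s * m) - s * s * x₁ - s * s * x₂) * w′
    lemma₁ = solve-∀ ℚ-ring

    lemma₂ : ∀ s m x₁ x₃ y₁ w′ → s * s * s * (m * (x₁ - x₃) - y₁) * w′ ≡
      (s * m * (s * s * x₁ - s * s * x₃) - s * s * s * y₁) * w′
    lemma₂ = solve-∀ ℚ-ring

    x-eq : s * s * x₃ * (ℓ * z′ - μ) ≡ z′
    x-eq = trans (lemma₁ s m x₁ x₂ (ℓ * z′ - μ)) (T.x-sum (s * m) nμ μ≢0)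

  Goal : Point → Set
  Goal P = Represents s P z′ (ℓ * z′ - μ)

  from-chord : x₂ - x₁ ≢ 0 → ∃[ m ] m * (x₂ - x₁) ≡ y₂ - y₁ × aff x₁ y₁ ⊕ aff x₂ y₂ ≡ chord m x₁ y₁ x₂ →
    Goal (aff x₁ y₁ ⊕ aff x₂ y₂)
  from-chord x₂≢x₁ (m , m-eq , sum) = subst Goal (sym sum) (represents-chord m
    (T.slope-chord (s * m) (b-a≢0 x₂≢x₁) (combine₁ (s * s * s) m-eq (lemma s m x₁ y₁ x₂ y₂)))
    (T.μ≢0-chord (b-a≢0 x₂≢x₁)))
    where
    lemma : ∀ s m x₁ y₁ x₂ y₂ →
      s * m * (s * s * x₂ - s * s * x₁) - (s * s * s * y₂ - s * s * s * y₁) ≡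
      s * s * s * (m * (x₂ - x₁) - (y₂ - y₁))
    lemma = solve-∀ ℚ-ring

  from-tangent : x₂ - x₁ ≡ 0 → y₁ + y₂ ≢ 0 →
    ∃[ m ] m * (y₁ + y₂) ≡ 3 * (x₁ * x₁) × aff x₁ y₁ ⊕ aff x₂ y₂ ≡ chord m x₁ y₁ x₂ →
    Goal (aff x₁ y₁ ⊕ aff x₂ y₂)
  from-tangent x₂≡x₁ y₁≢-y₂ (m , m-eq , sum) = subst Goal (sym sum) (represents-chord m
    (T.slope-tangent (s * m) (b-a≡0 x₂≡x₁) (d+c≢0 y₁≢-y₂)
      (combine₁ (s * s * s * s) m-eq (lemma s m x₁ y₁ y₂)))
    (T.μ≢0-tangent (d+c≢0 y₁≢-y₂)))
    where
    lemma : ∀ s m x₁ y₁ y₂ →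
      s * m * (s * s * s * y₁ + s * s * s * y₂) - 3 * (s * s * x₁ * (s * s * x₁)) ≡
      s * s * s * s * (m * (y₁ + y₂) - 3 * (x₁ * x₁))
    lemma = solve-∀ ℚ-ring

  from-opposite : μ ≡ 0 → ℓ * z′ - μ ≡ 0
  from-opposite μ≡0 = [ ⊥-elim ∘ V≢0 , [ ⊥-elim ∘ xy≢0 w₁≢0 w≢0 , (λ w′≡0 → w′≡0) ]′ ∘ xy≡0⇒x≡0∨y≡0 ]′
    (xy≡0⇒x≡0∨y≡0 (combine₂ 1 (- (μ * μ)) S.product-w μ≡0 (lemma S.V S.w₁ S.w S.w′ μ)))
    where
    lemma : ∀ V w₁ w w′ μ → V * (w₁ * w * w′) - 0 ≡ 1 * (V * (w₁ * w * w′) - (- (μ * μ * μ))) + - (μ * μ) * (μ - 0)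
    lemma = solve-∀ ℚ-ring

  split-x : Dec (x₂ - x₁ ≡ 0) → Goal (aff x₁ y₁ ⊕ aff x₂ y₂)
  split-x (no  x₂≢x₁) = from-chord x₂≢x₁ (⊕-chord x₁ y₁ x₂ y₂ x₂≢x₁)
  split-x (yes x₂≡x₁) = split-y (y₁ + y₂ ≟ 0)
    where
    split-y : Dec (y₁ + y₂ ≡ 0) → Goal (aff x₁ y₁ ⊕ aff x₂ y₂)
    split-y (no  y₁≢-y₂) = from-tangent x₂≡x₁ y₁≢-y₂ (⊕-tangent x₁ y₁ x₂ y₂ x₂≡x₁ y₁≢-y₂)
    split-y (yes y₁≡-y₂) = subst Goal (sym (⊕-opposite x₁ y₁ x₂ y₂ x₂≡x₁ y₁≡-y₂)) (from-opposite
      (T.μ≡0-opposite (b-a≡0 x₂≡x₁) (d+c≡0 y₁≡-y₂)))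

-- Translation by a point that is 2-adically close to ∞.

-- Addition of P = (1 , w₁) in the coordinates of Secant, with κ = 4 κ′.
module Translation {κ′ w₁ : ℚ} (κ′-integral : Integral κ′) (w₁-integral : Integral w₁)
  (base : w₁ ≡ 1 + 4 * κ′ * (w₁ * w₁ * w₁)) where

  κ : ℚ
  κ = 4 * κ′

  1-integral : Integral 1
  1-integral = integral-number 1

  κ-integral : Integral κ
  κ-integral = integral-* (integral-number 4) κ′-integral

  half-κ-integral : ∀ {t} → Integral t → Integral (2 * κ′ * t)
  half-κ-integral ti = integral-* (integral-* (integral-number 2) κ′-integral) ti

  1+κt : ∀ t → 1 + κ * t ≡ 1 + 2 * (2 * κ′ * t)
  1+κt t = lemma κ′ t
    where
    lemma : ∀ κ′ t → 1 + 4 * κ′ * t ≡ 1 + 2 * (2 * κ′ * t)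
    lemma = solve-∀ ℚ-ring

  1+κt≢0 : ∀ {t} → Integral t → 1 + κ * t ≢ 0
  1+κt≢0 {t} ti eq = 1+2x≢0 (half-κ-integral ti) (trans (sym (1+κt t)) eq)

  -κt : ∀ t → 1 + κ * (- t) ≡ 1 - κ * t
  -κt t = lemma κ t
    where
    lemma : ∀ κ t → 1 + κ * (- t) ≡ 1 - κ * t
    lemma = solve-∀ ℚ-ring

  divide-1+κt : ∀ {t n} → Integral t → Integral n → ∃[ q ] Integral q × q * (1 + κ * t) ≡ n
  divide-1+κt {t} {n} ti ni = go (divide (half-κ-integral ti) ni)
    where
    go : (∃[ q ] Integral q × q * (1 + 2 * (2 * κ′ * t)) ≡ n) → ∃[ q ] Integral q × q * (1 + κ * t) ≡ n
    go (q , qi , eq) = q , qi , trans (cong (q *_) (1+κt t)) eq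

  congruent-quotient-1+κt : ∀ {t t′ n n′ q q′ δ} → Integral t → Integral q′ →
    q * (1 + κ * t) ≡ n → q′ * (1 + κ * t′) ≡ n′ →
    Congruent δ n n′ → Congruent δ t t′ → Congruent δ q q′
  congruent-quotient-1+κt {t} ti q′i eq eq′ n≈n′ t≈t′ =
    congruent-quotient (half-κ-integral ti) (1+κt t) q′i eq eq′ n≈n′
      (congruent-+ (congruent-refl {x = 1}) (congruent-scale κ-integral t≈t′))

  record State : Set where
    constructor state
    field
      ζ w         : ℚ
      z-integral  : Integral ζ
      w-integral  : Integral w
      on-curve    : w ≡ ζ * ζ * ζ + κ * (w * w * w)

  -- The denominator of the slope (w - w₂) / (ζ - z₂) is 1 + κ Φ(w, w₂).
  Φ : ℚ → ℚ → ℚ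
  Φ w w₂ = - (w * w + w * w₂ + w₂ * w₂)

  Φ-integral : ∀ {w w₂} → Integral w → Integral w₂ → Integral (Φ w w₂)
  Φ-integral wi w₂i = integral-neg (integral-+ (integral-+ (integral-* wi wi) (integral-* wi w₂i)) (integral-* w₂i w₂i))

  module Step (p : State) where
    open State p

    abstract
      -- Subtracting the equations of the two points and cancelling ζ - 1 leaves a quotient with
      -- unit denominator. It remains meaningful for ζ = 1, so chord and tangent need no
      -- distinction.
      slope-quotient : ∃[ ℓ ] Integral ℓ × ℓ * (1 + κ * Φ w w₁) ≡ ζ * ζ + ζ + 1
      slope-quotient = divide-1+κt (Φ-integral w-integral w₁-integral)
        (integral-+ (integral-+ (integral-* z-integral z-integral) z-integral) 1-integral)

    ℓ μ : ℚ
    ℓ = proj₁ slope-quotient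
    μ = w₁ - ℓ

    ℓ-integral : Integral ℓ
    ℓ-integral = proj₁ (proj₂ slope-quotient)

    μ-integral : Integral μ
    μ-integral = integral-minus w₁-integral ℓ-integral

    ℓ³-integral : Integral (ℓ * ℓ * ℓ)
    ℓ³-integral = integral-* (integral-* ℓ-integral ℓ-integral) ℓ-integral

    slope : ζ * ζ + ζ + 1 ≡ ℓ * (1 - κ * (w * w + w * w₁ + w₁ * w₁))
    slope = trans (sym (proj₂ (proj₂ slope-quotient))) (cong (ℓ *_) (-κt (w * w + w * w₁ + w₁ * w₁)))

    w₁≡ : w₁ ≡ ℓ + μ
    w₁≡ = lemma w₁ ℓ
      where
      lemma : ∀ w₁ ℓ → w₁ ≡ ℓ + (w₁ - ℓ)
      lemma = solve-∀ ℚ-ring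

    w≡ : w ≡ ℓ * ζ + μ
    w≡ = *-cancelˡ (1+κt≢0 (Φ-integral w-integral w₁-integral))
      (combine₃ 1 (- 1) (ζ - 1) on-curve base slope (lemma κ ℓ ζ w w₁))
      where
      lemma : ∀ κ ℓ ζ w w₁ →
        (1 + κ * (- (w * w + w * w₁ + w₁ * w₁))) * w - (1 + κ * (- (w * w + w * w₁ + w₁ * w₁))) * (ℓ * ζ + (w₁ - ℓ)) ≡
        1 * (w - (ζ * ζ * ζ + κ * (w * w * w))) + - 1 * (w₁ - (1 + κ * (w₁ * w₁ * w₁))) +
        (ζ - 1) * (ζ * ζ + ζ + 1 - ℓ * (1 - κ * (w * w + w * w₁ + w₁ * w₁)))
      lemma = solve-∀ ℚ-ring

    abstract
      -- The sum of the three roots makes the displacement of `ζ` equal to 1 + κ e. The factor κ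
      -- stays outside, because its divisibility by 4 is what the dynamics needs.
      shift-quotient : ∃[ e ] Integral e × e * (1 + κ * (ℓ * ℓ * ℓ)) ≡ 3 * (ℓ * ℓ * μ)
      shift-quotient = divide-1+κt ℓ³-integral
        (integral-* (integral-number 3) (integral-* (integral-* ℓ-integral ℓ-integral) μ-integral))

    e z′ w′ : ℚ
    e  = proj₁ shift-quotient
    z′ = ζ + 1 + κ * e
    w′ = ℓ * z′ - μ

    e-integral : Integral e
    e-integral = proj₁ (proj₂ shift-quotient)

    vieta₁ : (1 + κ * (ℓ * ℓ * ℓ)) * (z′ - ζ - 1) ≡ 3 * κ * (ℓ * ℓ) * μ
    vieta₁ = combine₁ κ (proj₂ (proj₂ shift-quotient)) (lemma κ ℓ μ ζ e)
      where
      lemma : ∀ κ ℓ μ ζ e → (1 + κ * (ℓ * ℓ * ℓ)) * (ζ + 1 + κ * e - ζ - 1) - 3 * κ * (ℓ * ℓ) * μ ≡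
        κ * (e * (1 + κ * (ℓ * ℓ * ℓ)) - 3 * (ℓ * ℓ * μ))
      lemma = solve-∀ ℚ-ring

    V≢0 : 1 + κ * (ℓ * ℓ * ℓ) ≢ 0
    V≢0 = 1+κt≢0 ℓ³-integral

    z′-integral : Integral z′
    z′-integral = integral-+ (integral-+ z-integral 1-integral) (integral-* κ-integral e-integral)

    next : State
    next = state z′ w′ z′-integral (integral-minus (integral-* ℓ-integral z′-integral) μ-integral)
      (go {ℓ} {μ} w₁≡ w≡ base slope vieta₁)
      where
      go : ∀ {ℓ μ ζ z′ w w₁} → w₁ ≡ ℓ + μ → w ≡ ℓ * ζ + μ → w₁ ≡ 1 + κ * (w₁ * w₁ * w₁) →
        ζ * ζ + ζ + 1 ≡ ℓ * (1 - κ * (w * w + w * w₁ + w₁ * w₁)) →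
        (1 + κ * (ℓ * ℓ * ℓ)) * (z′ - ζ - 1) ≡ 3 * κ * (ℓ * ℓ) * μ →
        ℓ * z′ - μ ≡ z′ * z′ * z′ + κ * ((ℓ * z′ - μ) * (ℓ * z′ - μ) * (ℓ * z′ - μ))
      go {ℓ} {μ} refl refl b s v = Secant.on-curve {κ} {ℓ} {μ} b s v

  open State using (ζ; w; z-integral; w-integral; on-curve)

  translate : State → State
  translate p = Step.next p

  module _ {δ} (p q : State) (z≈ : Congruent δ (ζ p) (ζ q)) where
    private
      module P = Step p
      module Q = Step q

    -- The difference of the two curve equations is a unit times w p - w q on one side and the
    -- difference of the cubes of ζ on the other. Hence w depends on ζ in a 2-adically Lipschitz
    -- way.
    congruent-w : Congruent δ (w p) (w q)
    congruent-w = go (congruent-* (integral-* (z-integral p) (z-integral p)) (z-integral q)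
                       (congruent-* (z-integral p) (z-integral q) z≈ z≈) z≈)
      where
      lemma : ∀ κ w w₂ ζ z₂ → (w * (1 + κ * (- (w * w + w * w₂ + w₂ * w₂))) - w₂ * (1 + κ * (- (w * w + w * w₂ + w₂ * w₂)))) -
        (ζ * ζ * ζ - z₂ * z₂ * z₂) ≡
        1 * (w - (ζ * ζ * ζ + κ * (w * w * w))) + - 1 * (w₂ - (z₂ * z₂ * z₂ + κ * (w₂ * w₂ * w₂)))
      lemma = solve-∀ ℚ-ring

      go : Congruent δ (ζ p * ζ p * ζ p) (ζ q * ζ q * ζ q) → Congruent δ (w p) (w q)
      go (congruent {c} ci eq) = congruent-quotient-1+κt (Φ-integral (w-integral p) (w-integral q)) (w-integral q)
        refl refl
        (congruent ci (trans (combine₂ 1 (- 1) (on-curve p) (on-curve q) (lemma κ (w p) (w q) (ζ p) (ζ q))) eq))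
        congruent-refl

    congruent-Φ : Congruent δ (Φ (w p) w₁) (Φ (w q) w₁)
    congruent-Φ = congruent-neg (congruent-+ (congruent-+
      (congruent-* (w-integral p) (w-integral q) congruent-w congruent-w)
      (congruent-* (w-integral p) w₁-integral congruent-w (congruent-refl {x = w₁}))) (congruent-refl {x = w₁ * w₁}))

    congruent-ℓ : Congruent δ P.ℓ Q.ℓ
    congruent-ℓ = congruent-quotient-1+κt (Φ-integral (w-integral p) w₁-integral) Q.ℓ-integral
      (proj₂ (proj₂ P.slope-quotient)) (proj₂ (proj₂ Q.slope-quotient))
      (congruent-+ (congruent-+ (congruent-* (z-integral p) (z-integral q) z≈ z≈) z≈) (congruent-refl {x = 1}))
      congruent-Φ

    congruent-ℓ² : Congruent δ (P.ℓ * P.ℓ) (Q.ℓ * Q.ℓ)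
    congruent-ℓ² = congruent-* P.ℓ-integral Q.ℓ-integral congruent-ℓ congruent-ℓ

    congruent-e : Congruent δ P.e Q.e
    congruent-e = congruent-quotient-1+κt P.ℓ³-integral Q.e-integral
      (proj₂ (proj₂ P.shift-quotient)) (proj₂ (proj₂ Q.shift-quotient))
      (congruent-scale (integral-number 3)
        (congruent-* (integral-* P.ℓ-integral P.ℓ-integral) Q.μ-integral
          congruent-ℓ² (congruent-minus (congruent-refl {x = w₁}) congruent-ℓ)))
      (congruent-* (integral-* P.ℓ-integral P.ℓ-integral) Q.ℓ-integral congruent-ℓ² congruent-ℓ)

  open Dynamics ζ

  -- Of the two factors 2 in κ = 4 κ′, one is the 2 in front of the excess and the other makes the
  -- excess 2-Lipschitz.
  translates : Translates 1 translate
  translates = record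
    { excess    = λ p → 2 * (κ′ * Step.e p)
    ; step      = λ p → lemma₁ κ′ (ζ p) (Step.e p)
    ; divisible = λ p → congruent
        (integral-* (integral-number 2) (integral-* κ′-integral (Step.e-integral p))) (lemma₂ κ′ (Step.e p))
    ; lipschitz = λ p q z≈ → congruent-double (congruent-scale κ′-integral (congruent-e p q z≈))
    }
    where
    lemma₁ : ∀ κ′ ζ e → (ζ + 1 + 4 * κ′ * e) - ζ ≡ 1 + 2 * (2 * (κ′ * e))
    lemma₁ = solve-∀ ℚ-ring

    lemma₂ : ∀ κ′ e → 2 * (κ′ * e) - 0 ≡ 1 * (2 * (κ′ * e))
    lemma₂ = solve-∀ ℚ-ring

  origin : State
  origin = state 0 0 (integral-number 0) (integral-number 0) (lemma κ)
    where
    lemma : ∀ κ → 0 ≡ 0 * 0 * 0 + κ * (0 * 0 * 0)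
    lemma = solve-∀ ℚ-ring

  w≡0⇒z≡0 : ∀ p → w p ≡ 0 → ζ p ≡ 0
  w≡0⇒z≡0 p w≡0 = xxx≡0⇒x≡0 (combine₂ (- 1) (1 - κ * (w p * w p)) (on-curve p) w≡0 (lemma κ (ζ p) (w p)))
    where
    lemma : ∀ κ ζ w → ζ * ζ * ζ - 0 ≡ - 1 * (w - (ζ * ζ * ζ + κ * (w * w * w))) + (1 - κ * (w * w)) * (w - 0)
    lemma = solve-∀ ℚ-ring

  module _ {s x y : ℚ} (x-eq : s * s * x * w₁ ≡ 1) (y-eq : s * s * s * y * w₁ ≡ 1) where

    -- The line joining the origin to P has μ = 0, so e = 0 and the step ends at (1 , w₁), which is
    -- P itself.
    translate-∞ : ∀ p → w p ≡ 0 → ζ p ≡ 0 → Represents s (aff x y) (Step.z′ p) (Step.w′ p)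
    translate-∞ p w≡0 z≡0 = trans (cong (s * s * x *_) w′≡w₁) (trans x-eq (sym z′≡1)) , trans (cong (s * s * s * y *_) w′≡w₁) y-eq
      where
      open Step p using (ℓ; μ; e; z′; w′; w≡; shift-quotient; V≢0)

      μ≡0 : μ ≡ 0
      μ≡0 = combine₃ 1 (- ℓ) (- 1) w≡0 z≡0 w≡ (lemma ℓ μ (ζ p) (w p))
        where
        lemma : ∀ ℓ μ ζ w → μ - 0 ≡ 1 * (w - 0) + - ℓ * (ζ - 0) + - 1 * (w - (ℓ * ζ + μ))
        lemma = solve-∀ ℚ-ring

      e≡0 : e ≡ 0
      e≡0 = [ (λ e≡0 → e≡0) , ⊥-elim ∘ V≢0 ]′ (xy≡0⇒x≡0∨y≡0
        (combine₂ 1 (3 * (ℓ * ℓ)) (proj₂ (proj₂ shift-quotient)) μ≡0 (lemma κ ℓ μ e)))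
        where
        lemma : ∀ κ ℓ μ e → e * (1 + κ * (ℓ * ℓ * ℓ)) - 0 ≡
          1 * (e * (1 + κ * (ℓ * ℓ * ℓ)) - 3 * (ℓ * ℓ * μ)) + 3 * (ℓ * ℓ) * (μ - 0)
        lemma = solve-∀ ℚ-ring

      z′≡1 : z′ ≡ 1
      z′≡1 = combine₂ 1 κ z≡0 e≡0 (lemma κ (ζ p) e)
        where
        lemma : ∀ κ ζ e → (ζ + 1 + κ * e) - 1 ≡ 1 * (ζ - 0) + κ * (e - 0)
        lemma = solve-∀ ℚ-ring

      w′≡w₁ : w′ ≡ w₁
      w′≡w₁ = combine₂ ℓ (- 2) z′≡1 μ≡0 (lemma ℓ w₁ z′)
        where
        lemma : ∀ ℓ w₁ z′ → (ℓ * z′ - (w₁ - ℓ)) - w₁ ≡ ℓ * (z′ - 1) + - 2 * ((w₁ - ℓ) - 0)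
        lemma = solve-∀ ℚ-ring

    represents-translate : ∀ Q p → Represents s Q (ζ p) (w p) →
      Represents s (aff x y ⊕ Q) (Step.z′ p) (Step.w′ p)
    represents-translate ∞ p w≡0 = translate-∞ p w≡0 (w≡0⇒z≡0 p w≡0)
    represents-translate (aff X Y) p r =
      represents-⊕ {κ} {Step.ℓ p} {Step.μ p} {ζ p} (Step.w₁≡ p) (Step.w≡ p) base (Step.slope p) (Step.vieta₁ p) (Step.V≢0 p) (x-eq , y-eq) r

    represents-multiple : ∀ n → Represents s (n · aff x y) (ζ (iterate translate n origin)) (w (iterate translate n origin))
    represents-multiple ℕ.zero    = refl
    represents-multiple (ℕ.suc n) = represents-translate (n · aff x y) (iterate translate n origin) (represents-multiple n)

    infiniteOrder : InfiniteOrder (aff x y)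
    infiniteOrder n n≢0 nP≡∞ = moves translates (λ ()) n origin n≢0
      (w≡0⇒z≡0 (iterate translate n origin)
        (subst (λ Q → Represents s Q (ζ (iterate translate n origin)) (w (iterate translate n origin))) nP≡∞ (represents-multiple n)))

-- From an arbitrary non-torsion point to one 2-adically close to ∞.

HasPointOfInfiniteOrder : ℚ → Set
HasPointOfInfiniteOrder k = ∃[ P ] (Curve k P × InfiniteOrder P)

-- Scaling by s = x / y moves the point to z = 1, w₁ = y² / x³ = 1 + 4 c. Then κ = s⁶ k = 4 c / w₁³,
-- and κ′ = c / w₁³ is integral because w₁ is a unit.
near-infiniteOrder : ∀ {x y k c} → Integral c → x ≢ 0 → y * y ≡ x * x * x + k → k ≡ 4 * c * (x * x * x) →
  HasPointOfInfiniteOrder k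
near-infiniteOrder {x} {y} {k} {c} ci x≢0 curve k≡ = aff x y , curve , order (divide³ ci′ ci) (inverse y≢0)
  where
  w₁ = 1 + 4 * c
  t = x * x * x

  ci′ : Integral (2 * c)
  ci′ = integral-* (integral-number 2) ci

  u≡ : 1 + 2 * (2 * c) ≡ w₁
  u≡ = lemma c
    where
    lemma : ∀ c → 1 + 2 * (2 * c) ≡ 1 + 4 * c
    lemma = solve-∀ ℚ-ring

  w₁≢0 : w₁ ≢ 0
  w₁≢0 eq = 1+2x≢0 ci′ (trans u≡ eq)

  y²≡ : y * y ≡ t * w₁
  y²≡ = combine₂ 1 1 curve k≡ (lemma t (y * y) k c)
    where
    lemma : ∀ t y² k c → y² - t * (1 + 4 * c) ≡ 1 * (y² - (t + k)) + 1 * (k - 4 * c * t)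
    lemma = solve-∀ ℚ-ring

  y≢0 : y ≢ 0
  y≢0 y≡0 = xy≢0 (xy≢0 (xy≢0 x≢0 x≢0) x≢0) w₁≢0
    (trans (sym y²≡) (trans (cong (_* y) y≡0) (ℚ.*-zeroˡ y)))

  w₁-integral : Integral w₁
  w₁-integral = integral-+ (integral-number 1) (integral-* (integral-number 4) ci)

  order : ∃[ κ′ ] Integral κ′ × κ′ * ((1 + 2 * (2 * c)) * (1 + 2 * (2 * c)) * (1 + 2 * (2 * c))) ≡ c →
    ∃[ v ] y * v ≡ 1 → InfiniteOrder (aff x y)
  order (κ′ , κi , κ-eq) (v , v-eq) = Translation.infiniteOrder κi w₁-integral base {s} {x} {y} x-eq y-eq
    where
    s = x * v

    lemma₁ : ∀ v y → v * v * (y * y) - 1 ≡ (y * v + 1) * (y * v - 1)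
    lemma₁ = solve-∀ ℚ-ring

    v²y² : v * v * (t * w₁) ≡ 1
    v²y² = trans (cong (v * v *_) (sym y²≡)) (combine₁ (y * v + 1) v-eq (lemma₁ v y))

    x-eq : s * s * x * w₁ ≡ 1
    x-eq = trans (lemma x v w₁) v²y²
      where
      lemma : ∀ x v w₁ → x * v * (x * v) * x * w₁ ≡ v * v * (x * x * x * w₁)
      lemma = solve-∀ ℚ-ring

    y-eq : s * s * s * y * w₁ ≡ 1
    y-eq = combine₂ (v * v * (t * w₁)) 1 v-eq v²y² (lemma x y v w₁)
      where
      lemma : ∀ x y v w₁ → x * v * (x * v) * (x * v) * y * w₁ - 1 ≡
        v * v * (x * x * x * w₁) * (y * v - 1) + 1 * (v * v * (x * x * x * w₁) - 1)
      lemma = solve-∀ ℚ-ring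

    lemma₂ : ∀ c κ′ → (1 + 4 * c) - (1 + 4 * κ′ * ((1 + 4 * c) * (1 + 4 * c) * (1 + 4 * c))) ≡
      - 4 * (κ′ * ((1 + 2 * (2 * c)) * (1 + 2 * (2 * c)) * (1 + 2 * (2 * c))) - c)
    lemma₂ = solve-∀ ℚ-ring

    base : w₁ ≡ 1 + 4 * κ′ * (w₁ * w₁ * w₁)
    base = combine₁ (- 4) κ-eq (lemma₂ c κ′)

-- With t = x³ and u = 1 / 2y, the double of (x , y).
module Double {x y k u : ℚ} (curve : y * y ≡ x * x * x + k) (u-eq : u * (2 * y) ≡ 1) where
  t u⁶ x₂ y₂ : ℚ
  t  = x * x * x
  u⁶ = u * u * u * (u * u * u)
  x₂ = x * (t - 8 * k) * (u * u)
  y₂ = (t * t + 20 * t * k - 8 * (k * k)) * (u * u * u)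

  u⁶-eq : 64 * ((t + k) * (t + k) * (t + k)) * u⁶ ≡ 1
  u⁶-eq = trans (cong (λ T → 64 * (T * T * T) * u⁶) (sym curve))
    (trans (lemma u y) (cong (λ e → e * e * e * (e * e * e)) u-eq))
    where
    lemma : ∀ u y → 64 * (y * y * (y * y) * (y * y)) * (u * u * u * (u * u * u)) ≡
      u * (2 * y) * (u * (2 * y)) * (u * (2 * y)) * (u * (2 * y) * (u * (2 * y)) * (u * (2 * y)))
    lemma = solve-∀ ℚ-ring

  x₂³≡ : x₂ * x₂ * x₂ ≡ t * ((t - 8 * k) * (t - 8 * k) * (t - 8 * k)) * u⁶
  x₂³≡ = lemma x (t - 8 * k) u
    where
    lemma : ∀ x a u → x * a * (u * u) * (x * a * (u * u)) * (x * a * (u * u)) ≡ x * x * x * (a * a * a) * (u * u * u * (u * u * u))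
    lemma = solve-∀ ℚ-ring

  curve₂ : y₂ * y₂ ≡ x₂ * x₂ * x₂ + k
  curve₂ = combine₂ k (- 1) u⁶-eq x₂³≡ (lemma t k u (x₂ * x₂ * x₂))
    where
    lemma : ∀ t k u x₂³ → (t * t + 20 * t * k - 8 * (k * k)) * (u * u * u) * ((t * t + 20 * t * k - 8 * (k * k)) * (u * u * u)) - (x₂³ + k) ≡
      k * (64 * ((t + k) * (t + k) * (t + k)) * (u * u * u * (u * u * u)) - 1) +
      - 1 * (x₂³ - t * ((t - 8 * k) * (t - 8 * k) * (t - 8 * k)) * (u * u * u * (u * u * u)))
    lemma = solve-∀ ℚ-ring

  k≡x₂³ : ∀ C → C * (t * ((t - 8 * k) * (t - 8 * k) * (t - 8 * k))) ≡ 64 * k * ((t + k) * (t + k) * (t + k)) →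
    k ≡ C * (x₂ * x₂ * x₂)
  k≡x₂³ C eq = combine₃ (- u⁶) (- k) (- C) eq u⁶-eq x₂³≡ (lemma C k u⁶ (x₂ * x₂ * x₂) (t * ((t - 8 * k) * (t - 8 * k) * (t - 8 * k))) ((t + k) * (t + k) * (t + k)))
    where
    lemma : ∀ C k u⁶ x₂³ N M → k - C * x₂³ ≡ - u⁶ * (C * N - 64 * k * M) + - k * (64 * M * u⁶ - 1) + - C * (x₂³ - N * u⁶)
    lemma = solve-∀ ℚ-ring

  x₂³≡k : ∀ E → t * ((t - 8 * k) * (t - 8 * k) * (t - 8 * k)) ≡ E * (64 * k * ((t + k) * (t + k) * (t + k))) →
    x₂ * x₂ * x₂ ≡ k * E
  x₂³≡k E eq = combine₃ u⁶ (E * k) 1 eq u⁶-eq x₂³≡ (lemma E k u⁶ (x₂ * x₂ * x₂) (t * ((t - 8 * k) * (t - 8 * k) * (t - 8 * k))) ((t + k) * (t + k) * (t + k)))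
    where
    lemma : ∀ E k u⁶ x₂³ N M → x₂³ - k * E ≡ u⁶ * (N - E * (64 * k * M)) + E * k * (64 * M * u⁶ - 1) + 1 * (x₂³ - N * u⁶)
    lemma = solve-∀ ℚ-ring

  x₂≢0 : x ≢ 0 → t - 8 * k ≢ 0 → x₂ ≢ 0
  x₂≢0 x≢0 ne = xy≢0 (xy≢0 x≢0 ne) (xy≢0 u≢0 u≢0)
    where
    u≢0 : u ≢ 0
    u≢0 = xy≡1⇒x≢0 u-eq

-- With t = x³ and r = 1 / 3x(t + 4k), the triple of (x , y).
module Triple {x y k r : ℚ} (curve : y * y ≡ x * x * x + k) (r-eq : r * (3 * x * (x * x * x + 4 * k)) ≡ 1) where
  t r⁶ D M p x₃ y₃ : ℚ
  t  = x * x * x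
  r⁶ = r * r * r * (r * r * r)
  p  = t + 4 * k
  D  = t * t * t - 96 * t * t * k + 48 * t * k * k + 64 * k * k * k
  M  = t * t * t * t + 220 * t * t * t * k - 1776 * t * t * k * k - 320 * t * k * k * k - 512 * k * k * k * k
  x₃ = D * (r * r)
  y₃ = y * M * (r * r * r)

  r⁶-eq : 729 * (t * t) * (p * p * p * (p * p * p)) * r⁶ ≡ 1
  r⁶-eq = trans (lemma x p r) (cong (λ e → e * e * e * (e * e * e)) r-eq)
    where
    lemma : ∀ x p r → 729 * (x * x * x * (x * x * x)) * (p * p * p * (p * p * p)) * (r * r * r * (r * r * r)) ≡
      r * (3 * x * p) * (r * (3 * x * p)) * (r * (3 * x * p)) * (r * (3 * x * p) * (r * (3 * x * p)) * (r * (3 * x * p)))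
    lemma = solve-∀ ℚ-ring

  M²≡ : (t + k) * (M * M) ≡ D * D * D + 729 * k * (t * t) * (p * p * p * (p * p * p))
  M²≡ = lemma t k
    where
    lemma : ∀ t k →
      let p = t + 4 * k
          D = t * t * t - 96 * t * t * k + 48 * t * k * k + 64 * k * k * k
          M = t * t * t * t + 220 * t * t * t * k - 1776 * t * t * k * k - 320 * t * k * k * k - 512 * k * k * k * k
      in (t + k) * (M * M) ≡ D * D * D + 729 * k * (t * t) * (p * p * p * (p * p * p))
    lemma = solve-∀ ℚ-ring

  curve₃ : y₃ * y₃ ≡ x₃ * x₃ * x₃ + k
  curve₃ = combine₃ (M * M * r⁶) k r⁶ curve r⁶-eq M²≡ (lemma y (x * x * x) k D M r (p * p * p * (p * p * p)))
    where
    lemma : ∀ y t k D M r p⁶ → y * M * (r * r * r) * (y * M * (r * r * r)) - (D * (r * r) * (D * (r * r)) * (D * (r * r)) + k) ≡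
      M * M * (r * r * r * (r * r * r)) * (y * y - (t + k)) +
      k * (729 * (t * t) * p⁶ * (r * r * r * (r * r * r)) - 1) +
      r * r * r * (r * r * r) * ((t + k) * (M * M) - (D * D * D + 729 * k * (t * t) * p⁶))
    lemma = solve-∀ ℚ-ring

  k≡x₃³ : ∀ C → C * (D * D * D) ≡ 729 * k * (t * t) * (p * p * p * (p * p * p)) → k ≡ C * (x₃ * x₃ * x₃)
  k≡x₃³ C eq = combine₂ (- r⁶) (- k) eq r⁶-eq (lemma C k D r (t * t) (p * p * p * (p * p * p)))
    where
    lemma : ∀ C k D r t² p⁶ → k - C * (D * (r * r) * (D * (r * r)) * (D * (r * r))) ≡
      - (r * r * r * (r * r * r)) * (C * (D * D * D) - 729 * k * t² * p⁶) +
      - k * (729 * t² * p⁶ * (r * r * r * (r * r * r)) - 1)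
    lemma = solve-∀ ℚ-ring

  x₃≢0 : D ≢ 0 → x₃ ≢ 0
  x₃≢0 D≢0 = xy≢0 D≢0 (xy≢0 r≢0 r≢0)
    where
    r≢0 : r ≢ 0
    r≢0 = xy≡1⇒x≢0 r-eq

module _ {k : ℚ} (k≢0 : k ≢ 0) where

  private
    -- At the triple (x₃ , y₃) of (x , y) the quotient k / x₃³ is 4 c.
    infiniteOrder-triple : ∀ {x y E c} → x ≢ 0 → y * y ≡ x * x * x + k → x * x * x ≡ k * E →
      Integral c → E + 4 ≢ 0 → (let D = E * E * E - 96 * E * E + 48 * E + 64) → D ≢ 0 →
      4 * c * (D * D * D) ≡ 729 * (E * E) * ((E + 4) * (E + 4) * (E + 4) * ((E + 4) * (E + 4) * (E + 4))) →
      HasPointOfInfiniteOrder k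
    infiniteOrder-triple {x} {y} {E} {c} x≢0 curve t≡kE ci E+4≢0 D≢0 c-eq = go (inverse 3xp≢0)
      where
      D = E * E * E - 96 * E * E + 48 * E + 64
      q = E + 4

      p≡ : x * x * x + 4 * k ≡ k * q
      p≡ = combine₁ 1 t≡kE (lemma (x * x * x) k E)
        where
        lemma : ∀ t k E → t + 4 * k - k * (E + 4) ≡ 1 * (t - k * E)
        lemma = solve-∀ ℚ-ring

      3xp≢0 : 3 * x * (x * x * x + 4 * k) ≢ 0
      3xp≢0 = xy≢0 (xy≢0 {3} (λ ()) x≢0) (λ eq → xy≢0 k≢0 E+4≢0 (trans (sym p≡) eq))

      go : ∃[ r ] 3 * x * (x * x * x + 4 * k) * r ≡ 1 → HasPointOfInfiniteOrder k
      go (r , r-eq) = near-infiniteOrder {T.x₃} {T.y₃} {k} ci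
        (T.x₃≢0 λ eq → xy≢0 (xy≢0 (xy≢0 k≢0 k≢0) k≢0) D≢0 (trans (sym (D≡ t≡kE)) eq))
        T.curve₃ (T.k≡x₃³ (4 * c) (k-eq t≡kE))
        where
        module T = Triple {x} {y} {k} {r} curve (trans (ℚ.*-comm r (3 * x * (x * x * x + 4 * k))) r-eq)

        lemma₁ : ∀ k E → let t = k * E in
          t * t * t - 96 * t * t * k + 48 * t * k * k + 64 * k * k * k ≡ k * k * k * (E * E * E - 96 * E * E + 48 * E + 64)
        lemma₁ = solve-∀ ℚ-ring

        D≡ : ∀ {t} → t ≡ k * E →
          t * t * t - 96 * t * t * k + 48 * t * k * k + 64 * k * k * k ≡ k * k * k * D
        D≡ refl = lemma₁ k E

        lemma₂ : ∀ k E q C D → (let s = k * k * k) → C * (s * D * (s * D) * (s * D)) -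
          729 * k * (k * E * (k * E)) * (k * q * (k * q) * (k * q) * (k * q * (k * q) * (k * q))) ≡
          s * s * s * (C * (D * D * D) - 729 * (E * E) * (q * q * q * (q * q * q)))
        lemma₂ = solve-∀ ℚ-ring

        k-eq : ∀ {t} → t ≡ k * E → (let D′ = t * t * t - 96 * t * t * k + 48 * t * k * k + 64 * k * k * k) →
          (let p = t + 4 * k) →
          4 * c * (D′ * D′ * D′) ≡ 729 * k * (t * t) * (p * p * p * (p * p * p))
        k-eq refl = trans (cong (λ d → 4 * c * (d * d * d)) (lemma₁ k E))
          (trans (combine₁ (k * k * k * (k * k * k) * (k * k * k)) c-eq (lemma₂ k E q (4 * c) D))
          (cong (λ p → 729 * k * (k * E * (k * E)) * (p * p * p * (p * p * p))) (sym (lemma₃ k E))))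
          where
          lemma₃ : ∀ k E → k * E + 4 * k ≡ k * (E + 4)
          lemma₃ = solve-∀ ℚ-ring

    -- Here E = 4 e with e = 1 + 2 d odd, so E + 4 = 8 (1 + d), and D is 64 times the unit e³ - 24
    -- e² + 3 e + 1. In 729 E² (E + 4)⁶ / D³ the powers of 2 leave 16 · 729 = 4 · 2916.
    infiniteOrder-4·odd : ∀ {x y d} → x ≢ 0 → y * y ≡ x * x * x + k → x * x * x ≡ k * (4 * (1 + 2 * d)) →
      Integral d → x * x * x + 4 * k ≢ 0 → HasPointOfInfiniteOrder k
    infiniteOrder-4·odd {x} {y} {d} x≢0 curve t≡ di p≢0 = go (divide³ mi
      (integral-* (integral-number 2916) (integral-* (integral-* ei ei)
        (integral-* (integral-* (integral-* gi gi) gi) (integral-* (integral-* gi gi) gi)))))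
      where
      e = 1 + 2 * d
      g = 1 + d
      m = 4 * (d * d * d) - 42 * (d * d) - 42 * d - 10

      ei : Integral e
      ei = integral-+ (integral-number 1) (integral-* (integral-number 2) di)

      gi : Integral g
      gi = integral-+ (integral-number 1) di

      mi : Integral m
      mi = integral-minus (integral-minus (integral-minus
        (integral-* (integral-number 4) (integral-* (integral-* di di) di))
        (integral-* (integral-number 42) (integral-* di di)))
        (integral-* (integral-number 42) di)) (integral-number 10)

      D≡ : (let E = 4 * e) → E * E * E - 96 * E * E + 48 * E + 64 ≡ 64 * (1 + 2 * m)
      D≡ = lemma d
        where
        lemma : ∀ d → (let E = 4 * (1 + 2 * d)) → E * E * E - 96 * E * E + 48 * E + 64 ≡
          64 * (1 + 2 * (4 * (d * d * d) - 42 * (d * d) - 42 * d - 10))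
        lemma = solve-∀ ℚ-ring

      E+4≢0 : 4 * e + 4 ≢ 0
      E+4≢0 eq = p≢0 (combine₂ 1 k t≡ eq (lemma k (x * x * x) e))
        where
        lemma : ∀ k t e → t + 4 * k - 0 ≡ 1 * (t - k * (4 * e)) + k * (4 * e + 4 - 0)
        lemma = solve-∀ ℚ-ring

      go : ∃[ c ] Integral c × c * ((1 + 2 * m) * (1 + 2 * m) * (1 + 2 * m)) ≡
        2916 * (e * e * (g * g * g * (g * g * g))) → HasPointOfInfiniteOrder k
      go (c , ci , c-eq) = infiniteOrder-triple {x} {y} x≢0 curve t≡ ci E+4≢0
        (λ eq → xy≢0 {64} (λ ()) (1+2x≢0 mi) (trans (sym D≡) eq))
        (trans (cong (λ D → 4 * c * (D * D * D)) D≡) (combine₁ 1048576 c-eq (lemma c (1 + 2 * m) d)))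
        where
        lemma : ∀ c u d → (let g = 1 + d) → (let e = 1 + 2 * d) → (let q = 4 * e + 4) →
          4 * c * (64 * u * (64 * u) * (64 * u)) - 729 * (4 * e * (4 * e)) * (q * q * q * (q * q * q)) ≡
          1048576 * (c * (u * u * u) - 2916 * (e * e * (g * g * g * (g * g * g))))
        lemma = solve-∀ ℚ-ring

    -- Here E = 16 h, E + 4 = 4 (1 + 4 h), and D is again 64 times a unit, so that 729 E² (E + 4)⁶ /
    -- D³ is 4 · 729 h² times a unit. With E = 8 f, f odd, the factor 4 would be lost.
    infiniteOrder-16 : ∀ {x y h} → x ≢ 0 → y * y ≡ x * x * x + k → x * x * x ≡ k * (16 * h) →
      Integral h → HasPointOfInfiniteOrder k
    infiniteOrder-16 {x} {y} {h} x≢0 curve t≡ hi = go (divide³ mi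
      (integral-* (integral-number 729) (integral-* (integral-* hi hi)
        (integral-* (integral-* (integral-* gi gi) gi) (integral-* (integral-* gi gi) gi)))))
      where
      g = 1 + 2 * (2 * h)
      m = 32 * (h * h * h) - 192 * (h * h) + 6 * h

      2hi : Integral (2 * h)
      2hi = integral-* (integral-number 2) hi

      gi : Integral g
      gi = integral-+ (integral-number 1) (integral-* (integral-number 2) 2hi)

      mi : Integral m
      mi = integral-+ (integral-minus
        (integral-* (integral-number 32) (integral-* (integral-* hi hi) hi))
        (integral-* (integral-number 192) (integral-* hi hi)))
        (integral-* (integral-number 6) hi)

      D≡ : (let E = 16 * h) → E * E * E - 96 * E * E + 48 * E + 64 ≡ 64 * (1 + 2 * m)
      D≡ = lemma h
        where
        lemma : ∀ h → (let E = 16 * h) → E * E * E - 96 * E * E + 48 * E + 64 ≡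
          64 * (1 + 2 * (32 * (h * h * h) - 192 * (h * h) + 6 * h))
        lemma = solve-∀ ℚ-ring

      E+4≢0 : 16 * h + 4 ≢ 0
      E+4≢0 eq = xy≢0 {4} (λ ()) (1+2x≢0 2hi) (trans (lemma h) eq)
        where
        lemma : ∀ h → 4 * (1 + 2 * (2 * h)) ≡ 16 * h + 4
        lemma = solve-∀ ℚ-ring

      go : ∃[ c ] Integral c × c * ((1 + 2 * m) * (1 + 2 * m) * (1 + 2 * m)) ≡
        729 * (h * h * (g * g * g * (g * g * g))) → HasPointOfInfiniteOrder k
      go (c , ci , c-eq) = infiniteOrder-triple {x} {y} x≢0 curve t≡ ci E+4≢0
        (λ eq → xy≢0 {64} (λ ()) (1+2x≢0 mi) (trans (sym D≡) eq))
        (trans (cong (λ D → 4 * c * (D * D * D)) D≡) (combine₁ 1048576 c-eq (lemma c (1 + 2 * m) h)))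
        where
        lemma : ∀ c u h → (let g = 1 + 2 * (2 * h)) → (let q = 16 * h + 4) →
          4 * c * (64 * u * (64 * u) * (64 * u)) - 729 * (16 * h * (16 * h)) * (q * q * q * (q * q * q)) ≡
          1048576 * (c * (u * u * u) - 729 * (h * h * (g * g * g * (g * g * g))))
        lemma = solve-∀ ℚ-ring

    half-inverse : ∀ {y} → y ≢ 0 → ∃[ u ] u * (2 * y) ≡ 1
    half-inverse {y} y≢0 = go (inverse (xy≢0 {2} (λ ()) y≢0))
      where
      go : ∃[ u ] 2 * y * u ≡ 1 → ∃[ u ] u * (2 * y) ≡ 1
      go (u , eq) = u , trans (ℚ.*-comm u (2 * y)) eq

    -- The double has quotient 64 C (1 + C)³ / (1 - 8 C)³, whose denominator is a unit.
    infiniteOrder-integral : ∀ {x y C} → x ≢ 0 → y ≢ 0 → y * y ≡ x * x * x + k → k ≡ C * (x * x * x) →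
      Integral C → HasPointOfInfiniteOrder k
    infiniteOrder-integral {x} {y} {C} x≢0 y≢0 curve k≡ Ci = go (half-inverse y≢0) (divide³ 4Ci
      (integral-* (integral-* (integral-number 16) Ci) (integral-* (integral-* gi gi) gi)))
      where
      t = x * x * x
      g = 1 + C

      gi : Integral g
      gi = integral-+ (integral-number 1) Ci

      4Ci : Integral (- (4 * C))
      4Ci = integral-neg (integral-* (integral-number 4) Ci)

      t-8k≢0 : t - 8 * k ≢ 0
      t-8k≢0 eq = xy≢0 (xy≢0 (xy≢0 x≢0 x≢0) x≢0) (1+2x≢0 4Ci) (combine₂ 1 8 eq k≡ (lemma t k C))
        where
        lemma : ∀ t k C → t * (1 + 2 * (- (4 * C))) - 0 ≡ 1 * (t - 8 * k - 0) + 8 * (k - C * t)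
        lemma = solve-∀ ℚ-ring

      go : ∃[ u ] u * (2 * y) ≡ 1 →
        (let v = 1 + 2 * (- (4 * C))) → ∃[ c ] Integral c × c * (v * v * v) ≡ 16 * C * (g * g * g) →
        HasPointOfInfiniteOrder k
      go (u , u-eq) (c , ci , c-eq) = near-infiniteOrder {T.x₂} {T.y₂} {k} ci (T.x₂≢0 x≢0 t-8k≢0) T.curve₂
        (T.k≡x₂³ (4 * c) (k-eq k≡))
        where
        module T = Double {x} {y} {k} {u} curve u-eq

        lemma : ∀ C c t → (let k = C * t) → (let v = 1 + 2 * (- (4 * C))) →
          4 * c * (t * ((t - 8 * k) * (t - 8 * k) * (t - 8 * k))) - 64 * k * ((t + k) * (t + k) * (t + k)) ≡
          4 * (t * t * t * t) * (c * (v * v * v) - 16 * C * ((1 + C) * (1 + C) * (1 + C)))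
        lemma = solve-∀ ℚ-ring

        k-eq : ∀ {k t} → k ≡ C * t →
          4 * c * (t * ((t - 8 * k) * (t - 8 * k) * (t - 8 * k))) ≡ 64 * k * ((t + k) * (t + k) * (t + k))
        k-eq {k} {t} refl = combine₁ (4 * (t * t * t * t)) c-eq (lemma C c t)

    -- With E = 2 d the double has quotient 4 (1 + 2 d)³ / d (d - 4)³. Both d and d - 4 = f are odd,
    -- hence units.
    infiniteOrder-2·odd : ∀ {x y e} → x ≢ 0 → y ≢ 0 → y * y ≡ x * x * x + k → x * x * x ≡ k * (2 * (1 + 2 * e)) →
      Integral e → HasPointOfInfiniteOrder k
    infiniteOrder-2·odd {x} {y} {e} x≢0 y≢0 curve t≡ ei = go₁ (divide ei (integral-* (integral-* gi gi) gi))
      where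
      t = x * x * x
      d = 1 + 2 * e
      f = 1 + 2 * (e - 2)
      g = 1 + 2 * d

      gi : Integral g
      gi = integral-+ (integral-number 1) (integral-* (integral-number 2)
        (integral-+ (integral-number 1) (integral-* (integral-number 2) ei)))

      fi : Integral (e - 2)
      fi = integral-minus ei (integral-number 2)

      t-8k≢0 : t - 8 * k ≢ 0
      t-8k≢0 eq = xy≢0 (xy≢0 {2} (λ ()) k≢0) (1+2x≢0 fi) (combine₂ 1 (- 1) eq t≡ (lemma t k e))
        where
        lemma : ∀ t k e → 2 * k * (1 + 2 * (e - 2)) - 0 ≡ 1 * (t - 8 * k - 0) + - 1 * (t - k * (2 * (1 + 2 * e)))
        lemma = solve-∀ ℚ-ring

      go₁ : ∃[ q ] Integral q × q * d ≡ g * g * g → HasPointOfInfiniteOrder k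
      go₁ (q , qi , q-eq) = go₂ (half-inverse y≢0) (divide³ fi qi)
        where
        go₂ : ∃[ u ] u * (2 * y) ≡ 1 → ∃[ c ] Integral c × c * (f * f * f) ≡ q → HasPointOfInfiniteOrder k
        go₂ (u , u-eq) (c , ci , c-eq) = near-infiniteOrder {T.x₂} {T.y₂} {k} ci (T.x₂≢0 x≢0 t-8k≢0) T.curve₂
          (T.k≡x₂³ (4 * c) (k-eq {k} t≡))
          where
          module T = Double {x} {y} {k} {u} curve u-eq

          lemma : ∀ e q c k → (let d = 1 + 2 * e) → (let f = 1 + 2 * (e - 2)) → (let g = 1 + 2 * d) →
            (let t = k * (2 * d)) →
            4 * c * (t * ((t - 8 * k) * (t - 8 * k) * (t - 8 * k))) - 64 * k * ((t + k) * (t + k) * (t + k)) ≡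
            64 * (k * k * k * k) * d * (c * (f * f * f) - q) + 64 * (k * k * k * k) * (q * d - g * g * g)
          lemma = solve-∀ ℚ-ring

          k-eq : ∀ {k t} → t ≡ k * (2 * d) →
            4 * c * (t * ((t - 8 * k) * (t - 8 * k) * (t - 8 * k))) ≡ 64 * k * ((t + k) * (t + k) * (t + k))
          k-eq {k} refl = combine₂ (64 * (k * k * k * k) * d) (64 * (k * k * k * k)) c-eq q-eq (lemma e q c k)

    -- With E = 8 f, f = 1 + 2 g, the double has E equal to 512 f g³ / (1 + 8 f)³, divisible by 16.
    -- The excluded value E = 8 is g = 0, where the double has abscissa 0.
    infiniteOrder-8·odd : ∀ {x y g} → x ≢ 0 → y ≢ 0 → y * y ≡ x * x * x + k → x * x * x ≡ k * (8 * (1 + 2 * g)) →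
      Integral g → x * x * x - 8 * k ≢ 0 → HasPointOfInfiniteOrder k
    infiniteOrder-8·odd {x} {y} {g} x≢0 y≢0 curve t≡ gi t-8k≢0 = go (half-inverse y≢0)
      (divide³ 4fi (integral-* (integral-* (integral-number 32) fi) (integral-* (integral-* gi gi) gi)))
      where
      f = 1 + 2 * g

      fi : Integral f
      fi = integral-+ (integral-number 1) (integral-* (integral-number 2) gi)

      4fi : Integral (4 * f)
      4fi = integral-* (integral-number 4) fi

      go : ∃[ u ] u * (2 * y) ≡ 1 →
        (let v = 1 + 2 * (4 * f)) → ∃[ h ] Integral h × h * (v * v * v) ≡ 32 * f * (g * g * g) →
        HasPointOfInfiniteOrder k
      go (u , u-eq) (h , hi , h-eq) = infiniteOrder-16 {T.x₂} {T.y₂} (T.x₂≢0 x≢0 t-8k≢0) T.curve₂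
        (T.x₂³≡k (16 * h) (k-eq {k} t≡)) hi
        where
        module T = Double {x} {y} {k} {u} curve u-eq

        lemma : ∀ g h k → (let f = 1 + 2 * g) → (let v = 1 + 2 * (4 * f)) → (let t = k * (8 * f)) →
          t * ((t - 8 * k) * (t - 8 * k) * (t - 8 * k)) - 16 * h * (64 * k * ((t + k) * (t + k) * (t + k))) ≡
          - 1024 * (k * k * k * k) * (h * (v * v * v) - 32 * f * (g * g * g))
        lemma = solve-∀ ℚ-ring

        k-eq : ∀ {k t} → t ≡ k * (8 * f) →
          t * ((t - 8 * k) * (t - 8 * k) * (t - 8 * k)) ≡ 16 * h * (64 * k * ((t + k) * (t + k) * (t + k)))
        k-eq {k} refl = combine₁ (- 1024 * (k * k * k * k)) h-eq (lemma g h k)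

  -- The excluded points are those of order 2 (y = 0), 3 (x = 0 or x³ = - 4 k) and
  -- 6 (x³ = 8 k).
  torsion-free : ∀ {x y} → x ≢ 0 → y ≢ 0 → y * y ≡ x * x * x + k →
    x * x * x + 4 * k ≢ 0 → x * x * x - 8 * k ≢ 0 → HasPointOfInfiniteOrder k
  torsion-free {x} {y} x≢0 y≢0 curve t+4k≢0 t-8k≢0 = go (inverse t≢0)
    where
    t = x * x * x

    t≢0 : t ≢ 0
    t≢0 = xy≢0 (xy≢0 x≢0 x≢0) x≢0

    go : ∃[ v ] t * v ≡ 1 → HasPointOfInfiniteOrder k
    go (v , tv≡1) = by-valuation₀ (integral-or-reciprocal c≢0)
      where
      c = k * v

      c≢0 : c ≢ 0
      c≢0 = xy≢0 k≢0 (xy≡1⇒y≢0 {t} tv≡1)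

      k≡ct : k ≡ c * t
      k≡ct = combine₁ (- k) tv≡1 (lemma k v t)
        where
        lemma : ∀ k v t → k - k * v * t ≡ - k * (t * v - 1)
        lemma = solve-∀ ℚ-ring

      t≡kE : ∀ {E} → c * E ≡ 1 → t ≡ k * E
      t≡kE {E} eq = combine₂ (k * E) (- t) tv≡1 eq (lemma k v t E)
        where
        lemma : ∀ k v t E → t - k * E ≡ k * E * (t * v - 1) + - t * (k * v * E - 1)
        lemma = solve-∀ ℚ-ring

      scale : ∀ n {d d′ e} → d ≡ d′ → n * d′ ≡ e → t ≡ k * (n * d) → t ≡ k * e
      scale _ refl refl eq = eq

      double₁ : ∀ e → 2 * (2 * e) ≡ 4 * e
      double₁ = solve-∀ ℚ-ring

      double₂ : ∀ e → 4 * (2 * e) ≡ 8 * e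
      double₂ = solve-∀ ℚ-ring

      double₃ : ∀ e → 8 * (2 * e) ≡ 16 * e
      double₃ = solve-∀ ℚ-ring

      by-valuation₃ : ∀ {f} → t ≡ k * (8 * f) →
        (∃[ h ] Integral h × f ≡ 2 * h) ⊎ (∃[ g ] Integral g × f ≡ 1 + 2 * g) → HasPointOfInfiniteOrder k
      by-valuation₃ t≡ (inj₁ (h , hi , eq)) = infiniteOrder-16 {x} {y} x≢0 curve (scale 8 eq (double₃ h) t≡) hi
      by-valuation₃ t≡ (inj₂ (g , gi , eq)) = infiniteOrder-8·odd {x} {y} x≢0 y≢0 curve (scale 8 eq refl t≡) gi t-8k≢0

      by-valuation₂ : ∀ {e} → t ≡ k * (4 * e) →
        (∃[ f ] Integral f × e ≡ 2 * f) ⊎ (∃[ d ] Integral d × e ≡ 1 + 2 * d) → HasPointOfInfiniteOrder k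
      by-valuation₂ t≡ (inj₁ (f , fi , eq)) = by-valuation₃ {f} (scale 4 eq (double₂ f) t≡) (integral-parity fi)
      by-valuation₂ t≡ (inj₂ (d , di , eq)) = infiniteOrder-4·odd {x} {y} x≢0 curve (scale 4 eq refl t≡) di t+4k≢0

      by-valuation₁ : ∀ {d} → t ≡ k * (2 * d) →
        (∃[ e ] Integral e × d ≡ 2 * e) ⊎ (∃[ e ] Integral e × d ≡ 1 + 2 * e) → HasPointOfInfiniteOrder k
      by-valuation₁ t≡ (inj₁ (e , ei , eq)) = by-valuation₂ {e} (scale 2 eq (double₁ e) t≡) (integral-parity ei)
      by-valuation₁ t≡ (inj₂ (e , ei , eq)) = infiniteOrder-2·odd {x} {y} x≢0 y≢0 curve (scale 2 eq refl t≡) ei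

      by-valuation₀ : Integral c ⊎ (∃[ d ] Integral d × c * (2 * d) ≡ 1) → HasPointOfInfiniteOrder k
      by-valuation₀ (inj₁ ci) = infiniteOrder-integral {x} {y} x≢0 y≢0 curve k≡ct ci
      by-valuation₀ (inj₂ (d , di , eq)) = by-valuation₁ {d} (t≡kE eq) (integral-parity di)

-- Polynomial functions with a leading coefficient, and conditions failing only finitely often.

-- The coefficient c may be zero, so that n only bounds the degree.
data Leading : ℕ.ℕ → ℚ → (ℚ → ℚ) → Set where
  constant : ∀ {c f} → (∀ u → f u ≡ c) → Leading 0 c f
  horner   : ∀ {n c f} a g → Leading n c g → (∀ u → f u ≡ a + u * g u) → Leading (ℕ.suc n) c f

leading-resp : ∀ {n c d f g} → c ≡ d → (∀ u → g u ≡ f u) → Leading n c f → Leading n d g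
leading-resp refl g≗f (constant eq)      = constant λ u → trans (g≗f u) (eq u)
leading-resp refl g≗f (horner a h lh eq) = horner a h lh λ u → trans (g≗f u) (eq u)

leading-const : ∀ c → Leading 0 c (λ _ → c)
leading-const c = constant λ _ → refl

leading-var : Leading 1 1 (λ u → u)
leading-var = horner 0 (λ _ → 1) (leading-const 1) lemma
  where
  lemma : ∀ u → u ≡ 0 + u * 1
  lemma = solve-∀ ℚ-ring

leading-raise : ∀ {n c f} → Leading n c f → Leading (ℕ.suc n) 0 f
leading-raise {c = c} (constant eq) = horner c (λ _ → 0) (leading-const 0) λ u → trans (eq u) (lemma c u)
  where
  lemma : ∀ c u → c ≡ c + u * 0
  lemma = solve-∀ ℚ-ring
leading-raise (horner a g lg eq) = horner a g (leading-raise lg) eq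

leading-raise-by : ∀ {n c f} k → Leading n c f → Leading (ℕ.suc k ℕ.+ n) 0 f
leading-raise-by ℕ.zero    l = leading-raise l
leading-raise-by (ℕ.suc k) l = leading-raise (leading-raise-by k l)

leading-+ : ∀ {n c d f g} → Leading n c f → Leading n d g → Leading n (c + d) (λ u → f u + g u)
leading-+ (constant eq) (constant eq′) = constant λ u → cong₂ _+_ (eq u) (eq′ u)
leading-+ (horner a f lf eq) (horner b g lg eq′) =
  horner (a + b) (λ u → f u + g u) (leading-+ lf lg) λ u → trans (cong₂ _+_ (eq u) (eq′ u)) (lemma a b u (f u) (g u))
  where
  lemma : ∀ a b u f g → (a + u * f) + (b + u * g) ≡ (a + b) + u * (f + g)
  lemma = solve-∀ ℚ-ring

leading-scale : ∀ {n c f} e → Leading n c f → Leading n (e * c) (λ u → e * f u)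
leading-scale e (constant eq) = constant λ u → cong (e *_) (eq u)
leading-scale e (horner a f lf eq) =
  horner (e * a) (λ u → e * f u) (leading-scale e lf) λ u → trans (cong (e *_) (eq u)) (lemma e a u (f u))
  where
  lemma : ∀ e a u f → e * (a + u * f) ≡ e * a + u * (e * f)
  lemma = solve-∀ ℚ-ring

leading-neg : ∀ {n c f} → Leading n c f → Leading n (- c) (λ u → - f u)
leading-neg {c = c} {f} l = leading-resp (lemma c) (λ u → sym (lemma (f u))) (leading-scale (- 1) l)
  where
  lemma : ∀ c → - 1 * c ≡ - c
  lemma = solve-∀ ℚ-ring

leading-minus : ∀ {n c d f g} → Leading n c f → Leading n d g → Leading n (c - d) (λ u → f u - g u)
leading-minus lf lg = leading-+ lf (leading-neg lg)

leading-* : ∀ {m n c d f g} → Leading m c f → Leading n d g → Leading (m ℕ.+ n) (c * d) (λ u → f u * g u)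
leading-* {c = c} {g = g} (constant eq) lg = leading-resp refl (λ u → cong (_* g u) (eq u)) (leading-scale c lg)
leading-* {ℕ.suc m} {c = c} {d} {g = g} (horner a f lf eq) lg =
  leading-resp (ℚ.+-identityˡ (c * d)) (λ u → trans (cong (_* g u) (eq u)) (lemma a u (f u) (g u)))
    (leading-+ (leading-raise-by m (leading-scale a lg))
      (horner 0 (λ u → f u * g u) (leading-* lf lg) λ u → sym (ℚ.+-identityˡ (u * (f u * g u)))))
  where
  lemma : ∀ a u f g → (a + u * f) * g ≡ a * g + u * (f * g)
  lemma = solve-∀ ℚ-ring

leading-u³ : Leading 3 1 (λ u → u * u * u)
leading-u³ = leading-resp refl (λ u → refl) (leading-* (leading-* leading-var leading-var) leading-var)

-- Synthetic division by u - x. It lowers the degree bound and keeps the leading coefficient, as the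
-- induction in `leading-generic` requires.
leading-quotient : ∀ {n c f} → Leading (ℕ.suc n) c f → ∀ x →
  ∃[ h ] Leading n c h × (∀ u → f u - f x ≡ (u - x) * h u)
leading-quotient {c = c} {f} (horner a g (constant eq′) eq) x = (λ _ → c) , leading-const c , λ u →
  combine₂ 1 (- 1)
    (trans (eq u) (cong (λ t → a + u * t) (eq′ u))) (trans (eq x) (cong (λ t → a + x * t) (eq′ x)))
    (lemma (f u) (f x) a c u x)
  where
  lemma : ∀ f f′ a c u x → f - f′ - (u - x) * c ≡ 1 * (f - (a + u * c)) + - 1 * (f′ - (a + x * c))
  lemma = solve-∀ ℚ-ring
leading-quotient {f = f} (horner a g lg@(horner _ _ _ _) eq) x = go (leading-quotient lg x)
  where
  lemma : ∀ f f′ a u x g g′ h → f - f′ - (u - x) * (g′ + u * h) ≡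
    1 * (f - (a + u * g)) + - 1 * (f′ - (a + x * g′)) + u * (g - g′ - (u - x) * h)
  lemma = solve-∀ ℚ-ring

  go : ∃[ h ] Leading _ _ h × (∀ u → g u - g x ≡ (u - x) * h u) → _
  go (h , lh , eq′) = (λ u → g x + u * h u) , horner (g x) h lh (λ u → refl) , λ u →
    combine₃ 1 (- 1) u (eq u) (eq x) (eq′ u) (lemma (f u) (f x) a u x (g u) (g x) (h u))

-- Stands for cofiniteness, expressed by its effect on infinite subsets: no list of exceptions has
-- to be produced, and conjunction becomes composition.
Generic : Pred ℚ 0ℓ → Set₁
Generic Q = ∀ {P : Pred ℚ 0ℓ} → Infinite P → Infinite (λ x → P x × Q x)

generic-⇒ : ∀ {Q R} → (∀ {x} → Q x → R x) → Generic Q → Generic R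
generic-⇒ Q⇒R genQ inf xs = go (genQ inf xs)
  where
  go : ∃[ x ] ((_ × _) × _) → ∃[ x ] ((_ × _) × _)
  go (x , (px , qx) , x∉) = x , (px , Q⇒R qx) , x∉

generic-× : ∀ {Q R} → Generic Q → Generic R → Generic (λ x → Q x × R x)
generic-× genQ genR inf xs = go (genR (genQ inf) xs)
  where
  go : ∃[ x ] (((_ × _) × _) × _) → ∃[ x ] ((_ × (_ × _)) × _)
  go (x , ((px , qx) , rx) , x∉) = x , (px , (qx , rx)) , x∉

generic-All : ∀ {A : Set} {Q : A → Pred ℚ 0ℓ} → (∀ a → Generic (Q a)) → ∀ as → Generic (λ x → All (λ a → Q a x) as)
generic-All gen [] inf xs = go (inf xs)
  where
  go : ∃[ x ] (_ × _) → ∃[ x ] ((_ × _) × _)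
  go (x , px , x∉) = x , (px , []) , x∉
generic-All gen (a ∷ as) = generic-⇒ (λ (q , qs) → q ∷ qs) (generic-× (gen a) (generic-All gen as))

-- A member x of P either is not a root or splits off the factor u - x. In the second case the
-- cofactor, of lower degree, is treated on P with x avoided, so roots are found only as they are
-- met.
leading-generic : ∀ {n c f} → c ≢ 0 → Leading n c f → Generic (λ x → f x ≢ 0)
leading-generic c≢0 (constant eq) inf xs = go (inf xs)
  where
  go : ∃[ x ] (_ × _) → ∃[ x ] ((_ × _) × _)
  go (x , px , x∉) = x , (px , λ fx≡0 → c≢0 (trans (sym (eq x)) fx≡0)) , x∉
leading-generic {f = f} c≢0 l@(horner _ _ _ _) {P} inf xs = go (inf xs)
  where
  go : ∃[ x ] (P x × ¬ x ∈ xs) → ∃[ x ] ((P x × f x ≢ 0) × ¬ x ∈ xs)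
  go (x , px , x∉) = split (f x ≟ 0)
    where
    split : Dec (f x ≡ 0) → ∃[ x ] ((P x × f x ≢ 0) × ¬ x ∈ xs)
    split (no  fx≢0) = x , (px , fx≢0) , x∉
    split (yes fx≡0) = factor (leading-quotient l x)
      where
      factor : ∃[ h ] Leading _ _ h × (∀ u → f u - f x ≡ (u - x) * h u) → ∃[ x ] ((P x × f x ≢ 0) × ¬ x ∈ xs)
      factor (h , lh , eq) = other (leading-generic c≢0 lh inf (x ∷ xs))
        where
        other : ∃[ y ] ((P y × h y ≢ 0) × ¬ y ∈ x ∷ xs) → ∃[ x ] ((P x × f x ≢ 0) × ¬ x ∈ xs)
        other (y , (py , hy≢0) , y∉) = y , (py , λ fy≡0 → xy≢0 (λ y-x≡0 → y∉ (here (x-y≡0⇒x≡y y-x≡0))) hy≢0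
          (trans (sym (eq y)) (combine₂ 1 (- 1) fy≡0 fx≡0 (lemma (f y) (f x))))) , λ y∈ → y∉ (there y∈)
          where
          lemma : ∀ a b → a - b - 0 ≡ 1 * (a - 0) + - 1 * (b - 0)
          lemma = solve-∀ ℚ-ring

-- Producing infinitely many t from a family of points.

module Production (a b c : ℚ) where

  sextic : ℚ → ℚ
  sextic t = t * t * (t * t) * (t * t) + a * (t * t * (t * t)) + b * (t * t) + c

  leading-sextic : Leading 6 1 sextic
  leading-sextic = leading-resp refl (λ u → refl)
    (leading-+ (leading-+ (leading-+
      (leading-* (leading-* t² t²) t²)
      (leading-raise-by 1 (leading-scale a (leading-* t² t²))))
      (leading-raise-by 3 (leading-scale b t²)))
      (leading-raise-by 5 (leading-const c)))
    where
    t² : Leading 2 1 (λ t → t * t)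
    t² = leading-* leading-var leading-var

  -- e = 1 encodes y ≠ 0, since x³ + k = y²; e = 4 and e = - 8 are the other exclusions of
  -- `torsion-free`. In this uniform shape one polynomial `numerator` covers all three.
  record TorsionFree (t : ℚ) : Set where
    field
      {x₁ y₁}  : ℚ
      curve    : y₁ * y₁ ≡ x₁ * x₁ * x₁ + sextic t
      x≢0      : x₁ ≢ 0
      x³+ek≢0  : ∀ e → e ∈ 1 ∷ 4 ∷ - 8 ∷ [] → x₁ * x₁ * x₁ + e * sextic t ≢ 0

  infinite-positiveRank : Infinite TorsionFree → Infinite (λ t → PositiveRank (sextic t))
  infinite-positiveRank inf xs = go (leading-generic (λ ()) leading-sextic inf xs)
    where
    go : ∃[ t ] ((TorsionFree t × sextic t ≢ 0) × ¬ t ∈ xs) → ∃[ t ] (PositiveRank (sextic t) × ¬ t ∈ xs)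
    go (t , (tf , k≢0) , t∉) = t , (k≢0 , torsion-free k≢0 {x₁} {y₁} x≢0 y≢0 curve
      (x³+ek≢0 4 (there (here refl)))
      (λ eq → x³+ek≢0 (- 8) (there (there (here refl))) (trans (lemma₂ (x₁ * x₁ * x₁) (sextic t)) eq))) , t∉
      where
      open TorsionFree tf

      lemma₁ : ∀ y x k → x * x * x + 1 * k - 0 ≡ y * (y - 0) + - 1 * (y * y - (x * x * x + k))
      lemma₁ = solve-∀ ℚ-ring

      lemma₂ : ∀ t k → t + - 8 * k ≡ t - 8 * k
      lemma₂ = solve-∀ ℚ-ring

      y≢0 : y₁ ≢ 0
      y≢0 y≡0 = x³+ek≢0 1 (here refl) (combine₂ y₁ (- 1) y≡0 curve (lemma₁ y₁ x₁ (sextic t)))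

  -- P, Q, X are polynomials in u with t² = P / Q and x = X / Q, so that x³ + e k
  -- has numerator X³ + e (P³ + a P² Q + b P Q² + c Q³).
  numerator : (X P Q : ℚ → ℚ) (e u : ℚ) → ℚ
  numerator X P Q e u = X u * X u * X u +
    e * (P u * P u * P u + a * (P u * P u * Q u) + b * (P u * Q u * Q u) + c * (Q u * Q u * Q u))

  leading-numerator : ∀ {n x p q X P Q} e → Leading n x X → Leading n p P → Leading n q Q →
    Leading (n ℕ.+ n ℕ.+ n) (x * x * x + e * (p * p * p + a * (p * p * q) + b * (p * q * q) + c * (q * q * q)))
      (numerator X P Q e)
  leading-numerator e X P Q = leading-+ (leading-* (leading-* X X) X)
    (leading-scale e (leading-+ (leading-+ (leading-+
      (leading-* (leading-* P P) P)
      (leading-scale a (leading-* (leading-* P P) Q)))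
      (leading-scale b (leading-* (leading-* P Q) Q)))
      (leading-scale c (leading-* (leading-* Q Q) Q))))

  -- The case where x outgrows t² as u grows: X³ alone reaches the top degree.
  numerator-generic-X : ∀ {n x p q X P Q} → Leading (ℕ.suc n) x X → Leading n p P → Leading n q Q → x ≢ 0 →
    ∀ e → Generic (λ u → numerator X P Q e u ≢ 0)
  numerator-generic-X {x = x} lX lP lQ x≢0 e = leading-generic
    (λ eq → xy≢0 (xy≢0 x≢0 x≢0) x≢0 (trans (sym (lemma x e a b c)) eq))
    (leading-numerator e lX (leading-raise lP) (leading-raise lQ))
    where
    lemma : ∀ x e a b c → x * x * x + e * (0 * 0 * 0 + a * (0 * 0 * 0) + b * (0 * 0 * 0) + c * (0 * 0 * 0)) ≡ x * x * x
    lemma = solve-∀ ℚ-ring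

  -- The case where t² outgrows x: the top degree comes from e P³ alone.
  numerator-generic-P : ∀ {n x p q X P Q} → Leading n x X → Leading (ℕ.suc n) p P → Leading n q Q → p ≢ 0 →
    ∀ e → e ≢ 0 → Generic (λ u → numerator X P Q e u ≢ 0)
  numerator-generic-P {p = p} lX lP lQ p≢0 e e≢0 = leading-generic
    (λ eq → xy≢0 e≢0 (xy≢0 (xy≢0 p≢0 p≢0) p≢0) (trans (sym (lemma p e a b c)) eq))
    (leading-numerator e (leading-raise lX) lP (leading-raise lQ))
    where
    lemma : ∀ p e a b c → 0 * 0 * 0 + e * (p * p * p + a * (p * p * 0) + b * (p * 0 * 0) + c * (0 * 0 * 0)) ≡ e * (p * p * p)
    lemma = solve-∀ ℚ-ring

  module _ {U : Pred ℚ 0ℓ} (X P Q : ℚ → ℚ)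
    (generic-Q : Generic (λ u → Q u ≢ 0))
    (generic-X : Generic (λ u → X u ≢ 0))
    (generic-t : ∀ t → Generic (λ u → P u - t * t * Q u ≢ 0))
    (generic-e : ∀ e → e ≢ 0 → Generic (λ u → numerator X P Q e u ≢ 0))
    (point : ∀ {u} → U u → Q u ≢ 0 →
      ∃[ t ] ∃[ x ] ∃[ y ] (t * t * Q u ≡ P u × x * Q u ≡ X u × y * y ≡ x * x * x + sextic t))
    where

    private
      Good : List ℚ → Pred ℚ 0ℓ
      Good xs u = (Q u ≢ 0 × X u ≢ 0) ×
        (All (λ t → P u - t * t * Q u ≢ 0) xs ×
         (numerator X P Q 1 u ≢ 0 × (numerator X P Q 4 u ≢ 0 × numerator X P Q (- 8) u ≢ 0)))

      generic-Good : ∀ xs → Generic (Good xs)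
      generic-Good xs = generic-× (generic-× generic-Q generic-X) (generic-× (generic-All generic-t xs)
        (generic-× (generic-e 1 (λ ())) (generic-× (generic-e 4 (λ ())) (generic-e (- 8) (λ ())))))

    infinite-torsionFree : Infinite U → Infinite TorsionFree
    infinite-torsionFree inf xs = go (generic-Good xs inf [])
      where
      go : ∃[ u ] ((U u × Good xs u) × _) → ∃[ t ] (TorsionFree t × ¬ t ∈ xs)
      go (u , (uu , (q≢0 , x≢0) , avoids , n₁≢0 , n₄≢0 , n₈≢0) , _) = make (point uu q≢0)
        where
        make : ∃[ t ] ∃[ x ] ∃[ y ] (t * t * Q u ≡ P u × x * Q u ≡ X u × y * y ≡ x * x * x + sextic t) →
          ∃[ t ] (TorsionFree t × ¬ t ∈ xs)
        make (t , x , y , t-eq , x-eq , curve) = t , record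
          { x₁ = x ; y₁ = y ; curve = curve
          ; x≢0 = λ eq → x≢0 (trans (sym x-eq) (trans (cong (_* Q u) eq) (ℚ.*-zeroˡ (Q u))))
          ; x³+ek≢0 = λ e e∈ eq → numerators e e∈ (combine₁ (Q u * Q u * Q u) eq
              (trans (cong (_- 0) (numerator≡ e)) (lemma₂ (Q u) (x * x * x) (sextic t) e)))
          } , λ t∈ → All.lookup avoids t∈ (trans (cong (_- t * t * Q u) (sym t-eq)) (ℚ.+-inverseʳ (t * t * Q u)))
          where
          lemma₁ : ∀ a b c x t² q e → x * q * (x * q) * (x * q) +
            e * (t² * q * (t² * q) * (t² * q) + a * (t² * q * (t² * q) * q) + b * (t² * q * q * q) + c * (q * q * q)) ≡
            q * q * q * (x * x * x + e * (t² * t² * t² + a * (t² * t²) + b * t² + c))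
          lemma₁ = solve-∀ ℚ-ring

          lemma₂ : ∀ (q x³ k e : ℚ) → q * q * q * (x³ + e * k) - 0ℚ ≡ q * q * q * (x³ + e * k - 0ℚ)
          lemma₂ = solve-∀ ℚ-ring

          numerator≡′ : ∀ {X P} e → x * Q u ≡ X → t * t * Q u ≡ P →
            X * X * X + e * (P * P * P + a * (P * P * Q u) + b * (P * Q u * Q u) + c * (Q u * Q u * Q u)) ≡
            Q u * Q u * Q u * (x * x * x + e * sextic t)
          numerator≡′ e refl refl = lemma₁ a b c x (t * t) (Q u) e

          numerator≡ : ∀ e → numerator X P Q e u ≡ Q u * Q u * Q u * (x * x * x + e * sextic t)
          numerator≡ e = numerator≡′ e x-eq t-eq

          numerators : ∀ e → e ∈ 1 ∷ 4 ∷ - 8 ∷ [] → numerator X P Q e u ≢ 0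
          numerators _ (here refl)                 = n₁≢0
          numerators _ (there (here refl))         = n₄≢0
          numerators _ (there (there (here refl))) = n₈≢0

OnCurve : ℚ → Pred ℚ 0ℓ
OnCurve k u = ∃[ v ] v * v ≡ u * u * u + k

-- At most two affine points, (u , v) and (u , - v), share an abscissa.
infinite-abscissae : ∀ {k} → Infinite (Curve k) → Infinite (OnCurve k)
infinite-abscissae {k} inf xs = avoid xs (∞ ∷ []) (here refl)
  where
  squares : ∀ {v v′} → v * v ≡ v′ * v′ → v ≡ v′ ⊎ v ≡ - v′
  squares {v} {v′} eq = [ inj₁ ∘ x-y≡0⇒x≡y , (λ v+v′≡0 → inj₂ (combine₁ 1 v+v′≡0 (lemma₂ v v′))) ]′
    (xy≡0⇒x≡0∨y≡0 (combine₁ 1 eq (lemma₁ v v′)))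
    where
    lemma₁ : ∀ v v′ → (v - v′) * (v + v′) - 0ℚ ≡ 1ℚ * (v * v - v′ * v′)
    lemma₁ = solve-∀ ℚ-ring

    lemma₂ : ∀ v v′ → v - - v′ ≡ 1ℚ * (v + v′ - 0ℚ)
    lemma₂ = solve-∀ ℚ-ring

  -- `Ps` contains ∞, so every point found is affine. When the abscissa found is the head of the
  -- list, both points above it join `Ps` and the search over the tail is repeated.
  avoid : ∀ xs Ps → ∞ ∈ Ps → ∃[ u ] (OnCurve k u × ¬ u ∈ xs)
  avoid′ : ∀ xs Ps → ∞ ∈ Ps → ∃[ u ] ∃[ v ] (v * v ≡ u * u * u + k × ¬ aff u v ∈ Ps × ¬ u ∈ xs)

  avoid xs Ps ∞∈ = go (avoid′ xs Ps ∞∈)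
    where
    go : ∃[ u ] ∃[ v ] (v * v ≡ u * u * u + k × ¬ aff u v ∈ Ps × ¬ u ∈ xs) → ∃[ u ] (OnCurve k u × ¬ u ∈ xs)
    go (u , v , eq , _ , u∉) = u , (v , eq) , u∉

  avoid′ [] Ps ∞∈ = go (inf Ps)
    where
    go : ∃[ P ] (Curve k P × ¬ P ∈ Ps) → ∃[ u ] ∃[ v ] (v * v ≡ u * u * u + k × ¬ aff u v ∈ Ps × ¬ u ∈ [])
    go (∞       , _  , P∉) = ⊥-elim (P∉ ∞∈)
    go (aff u v , eq , P∉) = u , v , eq , P∉ , λ ()
  avoid′ (x ∷ xs) Ps ∞∈ = go (avoid′ xs Ps ∞∈)
    where
    go : ∃[ u ] ∃[ v ] (v * v ≡ u * u * u + k × ¬ aff u v ∈ Ps × ¬ u ∈ xs) →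
      ∃[ u ] ∃[ v ] (v * v ≡ u * u * u + k × ¬ aff u v ∈ Ps × ¬ u ∈ x ∷ xs)
    go (u , v , eq , P∉ , u∉) = split (u ≟ x)
      where
      split : Dec (u ≡ x) → ∃[ u ] ∃[ v ] (v * v ≡ u * u * u + k × ¬ aff u v ∈ Ps × ¬ u ∈ x ∷ xs)
      split (no u≢x) = u , v , eq , P∉ , λ { (here u≡x) → u≢x u≡x ; (there u∈) → u∉ u∈ }
      split (yes refl) = other (avoid′ xs (aff u v ∷ aff u (- v) ∷ Ps) (there (there ∞∈)))
        where
        other : ∃[ u′ ] ∃[ v′ ] (v′ * v′ ≡ u′ * u′ * u′ + k × ¬ aff u′ v′ ∈ aff u v ∷ aff u (- v) ∷ Ps × ¬ u′ ∈ xs) →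
          ∃[ u′ ] ∃[ v′ ] (v′ * v′ ≡ u′ * u′ * u′ + k × ¬ aff u′ v′ ∈ Ps × ¬ u′ ∈ u ∷ xs)
        other (u′ , v′ , eq′ , P′∉ , u′∉) =
          u′ , v′ , eq′ , (λ P∈ → P′∉ (there (there P∈))) , λ { (here u′≡u) → same u′≡u eq′ P′∉ ; (there u′∈) → u′∉ u′∈ }
          where
          same : ∀ {u′} → u′ ≡ u → v′ * v′ ≡ u′ * u′ * u′ + k → ¬ ¬ aff u′ v′ ∈ aff u v ∷ aff u (- v) ∷ Ps
          same refl eq′ P′∉ = [ (λ v′≡v → P′∉ (here (cong (aff u) v′≡v))) , (λ v′≡-v → P′∉ (there (here (cong (aff u) v′≡-v)))) ]′
            (squares (trans eq′ (sym eq)))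

-- Base point t₀ ≠ 0: a quartic section of the surface.

-- With x = h - t² the equation y² = x³ + g(t) becomes the quartic
-- y² = A t⁴ + B t² + C, where A = 3 h + a, B = b - 3 h², C = h³ + c. A point on it
-- with t = t₀ gives the point t = t₀ p / q, where M = A t₀⁴ and N = B t₀².
duplication : ∀ {p q r} M N C →
  p ≡ M * M - 6 * M * C - 4 * N * C - 3 * C * C →
  q ≡ 3 * M * M + 6 * M * C + 4 * M * N - C * C →
  r ≡ M * M * M * M + 4 * M * M * M * N + 28 * M * M * M * C + 28 * M * M * N * C + 6 * M * M * C * C +
    16 * M * N * N * C + 28 * M * N * C * C + 28 * M * C * C * C + 4 * N * C * C * C + C * C * C * C →
  M * (p * p * (p * p)) + N * (p * p * (q * q)) + C * (q * q * (q * q)) ≡ (M + N + C) * (r * r)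
duplication M N C refl refl refl = lemma M N C
  where
  lemma : ∀ M N C →
    let p = M * M - 6 * M * C - 4 * N * C - 3 * C * C
        q = 3 * M * M + 6 * M * C + 4 * M * N - C * C
        r = M * M * M * M + 4 * M * M * M * N + 28 * M * M * M * C + 28 * M * M * N * C + 6 * M * M * C * C +
            16 * M * N * N * C + 28 * M * N * C * C + 28 * M * C * C * C + 4 * N * C * C * C + C * C * C * C
    in M * (p * p * (p * p)) + N * (p * p * (q * q)) + C * (q * q * (q * q)) ≡ (M + N + C) * (r * r)
  lemma = solve-∀ ℚ-ring

-- x = h - t² cancels t⁶, and h = u + t₀² makes the section pass through the given point. In s = t /
-- t₀ it is y² = M s⁴ + N s² + K with the point (1 , v). Generically, and up to the sign of s, p / q
-- is the remaining intersection with the parabola y = α + β s + γ s² that has contact of order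
-- three there.
quartic-point : ∀ a b c {t₀ u v T h M N K p q r P Q X} →
  T ≡ t₀ * t₀ → h ≡ u + T →
  M ≡ (3 * h + a) * (T * T) → N ≡ (b - 3 * (h * h)) * T → K ≡ h * h * h + c →
  P ≡ T * (p * p) → Q ≡ q * q → X ≡ h * Q - P →
  M * (p * p * (p * p)) + N * (p * p * (q * q)) + K * (q * q * (q * q)) ≡ (M + N + K) * (r * r) →
  v * v ≡ u * u * u + Production.sextic a b c t₀ → Q ≢ 0 →
  ∃[ t ] ∃[ x ] ∃[ y ] (t * t * Q ≡ P × x * Q ≡ X × y * y ≡ x * x * x + Production.sextic a b c t)
quartic-point a b c {t₀} {u} {v} {_} {_} {M} {N} {K} {p} {q} {r} refl refl M≡ N≡ K≡ refl refl refl dup curve Q≢0 =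
  go (inverse q≢0)
  where
  open Production a b c

  h = u + t₀ * t₀
  T = t₀ * t₀

  q≢0 : q ≢ 0
  q≢0 eq = Q≢0 (trans (cong (_* q) eq) (ℚ.*-zeroˡ q))

  lemma₀ : ∀ a b c t₀ u → (let h = u + t₀ * t₀) → (let T = t₀ * t₀) →
    u * u * u + (T * T * T + a * (T * T) + b * T + c) ≡
    (3 * h + a) * (T * T) + (b - 3 * (h * h)) * T + (h * h * h + c)
  lemma₀ = solve-∀ ℚ-ring

  v²≡ : ∀ {M N K} → M ≡ (3 * h + a) * (T * T) → N ≡ (b - 3 * (h * h)) * T → K ≡ h * h * h + c →
    v * v ≡ M + N + K
  v²≡ refl refl refl = trans curve (lemma₀ a b c t₀ u)

  lemma₁ : ∀ t₀ p q i → t₀ * (p * i) * (t₀ * (p * i)) * (q * q) - t₀ * t₀ * (p * p) ≡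
    t₀ * t₀ * (p * p) * (q * i + 1ℚ) * (q * i - 1ℚ)
  lemma₁ = solve-∀ ℚ-ring

  lemma₂ : ∀ h t² Q P → (h - t²) * Q - (h * Q - P) ≡ - 1ℚ * (t² * Q - P)
  lemma₂ = solve-∀ ℚ-ring

  lemma₃ : ∀ v r i S → v * r * (i * i) * (v * r * (i * i)) - S * (r * r) * (i * i * (i * i)) ≡
    r * r * (i * i * (i * i)) * (v * v - S)
  lemma₃ = solve-∀ ℚ-ring

  lemma₄ : ∀ M N K p q i → (let s = p * i) → (let e = q * i) →
    (M * (p * p * (p * p)) + N * (p * p * (q * q)) + K * (q * q * (q * q))) * (i * i * (i * i)) ≡
    M * (s * s * (s * s)) + N * (s * s * (e * e)) + K * (e * e * (e * e))
  lemma₄ = solve-∀ ℚ-ring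

  lemma₅ : ∀ a b c t₀ h s → (let T = t₀ * t₀) → (let t = t₀ * s) → (let x = h - t * t) →
    (3 * h + a) * (T * T) * (s * s * (s * s)) + (b - 3 * (h * h)) * T * (s * s * (1 * 1)) + (h * h * h + c) * (1 * 1 * (1 * 1)) ≡
    x * x * x + (t * t * (t * t) * (t * t) + a * (t * t * (t * t)) + b * (t * t) + c)
  lemma₅ = solve-∀ ℚ-ring

  quartic : ∀ {M N K} → M ≡ (3 * h + a) * (T * T) → N ≡ (b - 3 * (h * h)) * T → K ≡ h * h * h + c →
    ∀ s → (let t = t₀ * s) → (let x = h - t * t) →
    M * (s * s * (s * s)) + N * (s * s * (1 * 1)) + K * (1 * 1 * (1 * 1)) ≡ x * x * x + sextic t
  quartic refl refl refl s = lemma₅ a b c t₀ h s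

  go : ∃[ i ] q * i ≡ 1 →
    ∃[ t ] ∃[ x ] ∃[ y ] (t * t * (q * q) ≡ T * (p * p) × x * (q * q) ≡ h * (q * q) - T * (p * p) ×
      y * y ≡ x * x * x + sextic t)
  go (i , qi≡1) = t , x₁ , y₁ , t-eq , x-eq , trans y²≡ (quartic M≡ N≡ K≡ s)
    where
    s = p * i
    t = t₀ * s
    x₁ = h - t * t
    y₁ = v * r * (i * i)

    t-eq : t * t * (q * q) ≡ T * (p * p)
    t-eq = combine₁ (T * (p * p) * (q * i + 1)) qi≡1 (lemma₁ t₀ p q i)

    x-eq : x₁ * (q * q) ≡ h * (q * q) - T * (p * p)
    x-eq = combine₁ (- 1) t-eq (lemma₂ h (t * t) (q * q) (T * (p * p)))

    y²≡ : y₁ * y₁ ≡ M * (s * s * (s * s)) + N * (s * s * (1 * 1)) + K * (1 * 1 * (1 * 1))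
    y²≡ = trans (combine₁ (r * r * (i * i * (i * i))) (v²≡ M≡ N≡ K≡) (lemma₃ v r i (M + N + K)))
      (trans (cong (_* (i * i * (i * i))) (sym dup))
      (trans (lemma₄ M N K p q i)
        (cong (λ e → M * (s * s * (s * s)) + N * (s * s * (e * e)) + K * (e * e * (e * e))) qi≡1)))

-- The new parameter t₀ p / q would be constantly 0 for t₀ = 0, so a zero base point needs other
-- constructions.
module NonzeroBase (a b c t₀ : ℚ) (t₀≢0 : t₀ ≢ 0) where
  open Production a b c

  T : ℚ
  T = t₀ * t₀

  T≢0 : T ≢ 0
  T≢0 = xy≢0 t₀≢0 t₀≢0

  h M N K p q r P Q X : ℚ → ℚ
  h u = u + T
  M u = (3 * h u + a) * (T * T)
  N u = (b - 3 * (h u * h u)) * T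
  K u = h u * h u * h u + c
  p u = M u * M u - 6 * M u * K u - 4 * N u * K u - 3 * K u * K u
  q u = 3 * M u * M u + 6 * M u * K u + 4 * M u * N u - K u * K u
  r u = M u * M u * M u * M u + 4 * M u * M u * M u * N u + 28 * M u * M u * M u * K u +
        28 * M u * M u * N u * K u + 6 * M u * M u * K u * K u + 16 * M u * N u * N u * K u +
        28 * M u * N u * K u * K u + 28 * M u * K u * K u * K u + 4 * N u * K u * K u * K u +
        K u * K u * K u * K u
  P u = T * (p u * p u)
  Q u = q u * q u
  X u = h u * Q u - P u

  leading-h : Leading 1 1 h
  leading-h = leading-resp refl (λ u → refl) (leading-+ leading-var (leading-raise (leading-const T)))

  leading-M : Leading 1 (3 * (T * T)) M
  leading-M = leading-resp (lemma (T * T)) (λ u → ℚ.*-comm (3 * h u + a) (T * T))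
    (leading-scale (T * T) (leading-+ (leading-scale 3 leading-h) (leading-raise (leading-const a))))
    where
    lemma : ∀ T² → T² * (3 * 1 + 0) ≡ 3 * T²
    lemma = solve-∀ ℚ-ring

  leading-N : Leading 2 (- 3 * T) N
  leading-N = leading-resp (lemma T) (λ u → ℚ.*-comm (b - 3 * (h u * h u)) T)
    (leading-scale T (leading-minus (leading-raise-by 1 (leading-const b)) (leading-scale 3 (leading-* leading-h leading-h))))
    where
    lemma : ∀ T → T * (0 - 3 * (1 * 1)) ≡ - 3 * T
    lemma = solve-∀ ℚ-ring

  leading-K : Leading 3 1 K
  leading-K = leading-resp refl (λ u → refl)
    (leading-+ (leading-* (leading-* leading-h leading-h) leading-h) (leading-raise-by 2 (leading-const c)))

  leading-p : Leading 6 (- 3) p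
  leading-p = leading-resp refl (λ u → refl) (leading-minus (leading-minus (leading-minus
    (leading-raise-by 3 (leading-* leading-M leading-M))
    (leading-raise-by 1 (leading-* (leading-scale 6 leading-M) leading-K)))
    (leading-raise-by 0 (leading-* (leading-scale 4 leading-N) leading-K)))
    (leading-* (leading-scale 3 leading-K) leading-K))

  leading-q : Leading 6 (- 1) q
  leading-q = leading-resp refl (λ u → refl) (leading-minus (leading-+ (leading-+
    (leading-raise-by 3 (leading-* (leading-scale 3 leading-M) leading-M))
    (leading-raise-by 1 (leading-* (leading-scale 6 leading-M) leading-K)))
    (leading-raise-by 2 (leading-* (leading-scale 4 leading-M) leading-N)))
    (leading-* leading-K leading-K))

  -- t tends to 3 t₀ as u tends to infinity, since the leading terms cancel here.
  leading-p-3q : Leading 5 (12 * T) (λ u → p u - 3 * q u)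
  leading-p-3q = leading-resp (lemma₁ T) (λ u → lemma₂ (M u) (N u) (K u)) (leading-minus (leading-minus (leading-minus
    (leading-raise-by 2 (leading-* (leading-scale (- 8) leading-M) leading-M))
    (leading-raise-by 0 (leading-* (leading-scale 24 leading-M) leading-K)))
    (leading-raise-by 1 (leading-* (leading-scale 12 leading-M) leading-N)))
    (leading-* (leading-scale 4 leading-N) leading-K))
    where
    lemma₁ : ∀ T → 0 - 0 - 0 - 4 * (- 3 * T) * 1 ≡ 12 * T
    lemma₁ = solve-∀ ℚ-ring

    lemma₂ : ∀ M N K → M * M - 6 * M * K - 4 * N * K - 3 * K * K - 3 * (3 * M * M + 6 * M * K + 4 * M * N - K * K) ≡
      - 8 * M * M - 24 * M * K - 12 * M * N - 4 * N * K
    lemma₂ = solve-∀ ℚ-ring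

  leading-p+3q : Leading 6 (- 6) (λ u → p u + 3 * q u)
  leading-p+3q = leading-resp refl (λ u → refl) (leading-+ leading-p (leading-scale 3 leading-q))

  leading-P : Leading 12 (T * 9) P
  leading-P = leading-scale T (leading-* leading-p leading-p)

  leading-Q : Leading 12 1 Q
  leading-Q = leading-* leading-q leading-q

  leading-X : Leading 13 1 X
  leading-X = leading-resp refl (λ u → refl) (leading-minus (leading-* leading-h leading-Q) (leading-raise leading-P))

  generic-t : ∀ t → Generic (λ u → P u - t * t * Q u ≢ 0)
  generic-t t = split (T * 9 - t * t * 1 ≟ 0)
    where
    lemma : ∀ T t p q → T * ((p - 3 * q) * (p + 3 * q)) - (T * (p * p) - t * t * (q * q)) ≡
      - (q * q) * (T * 9 - t * t * 1 - 0ℚ)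
    lemma = solve-∀ ℚ-ring

    split : Dec (T * 9 - t * t * 1 ≡ 0) → Generic (λ u → P u - t * t * Q u ≢ 0)
    split (no  ne) = leading-generic ne (leading-minus leading-P (leading-scale (t * t) leading-Q))
    -- For t = ± 3 t₀ the leading terms of P and t² Q cancel. Then P - t² Q = T (p - 3 q) (p + 3 q),
    -- with leading coefficient - 72 T².
    split (yes eq) = generic-⇒ (λ {u} ne eq′ → ne (trans (combine₁ (- (q u * q u)) eq (lemma T t (p u) (q u))) eq′))
      (leading-generic (xy≢0 T≢0 (xy≢0 {12 * T} { - 6 } (xy≢0 {12} (λ ()) T≢0) (λ ())))
        (leading-scale T (leading-* leading-p-3q leading-p+3q)))

  point : ∀ {u} → OnCurve (sextic t₀) u → Q u ≢ 0 →
    ∃[ t ] ∃[ x ] ∃[ y ] (t * t * Q u ≡ P u × x * Q u ≡ X u × y * y ≡ x * x * x + sextic t)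
  point {u} (v , curve) Q≢0 =
    quartic-point a b c {t₀} {u} {v} {T} {h u} {M u} {N u} {K u} {p u} {q u} {r u} {P u} {Q u} {X u}
      refl refl refl refl refl refl refl refl
      (duplication (M u) (N u) (K u) refl refl refl) curve Q≢0

  infinite : Infinite (OnCurve (sextic t₀)) → Infinite TorsionFree
  infinite = infinite-torsionFree {OnCurve (sextic t₀)} X P Q
    (leading-generic (λ ()) leading-Q) (leading-generic (λ ()) leading-X) generic-t
    (λ e _ → numerator-generic-X leading-X leading-P leading-Q (λ ()) e) (λ {u} → point {u})

-- Base point t₀ = 0: pure sextic, tangent construction, rational curve.

xx≢0⇒x≢0 : x * x ≢ 0 → x ≢ 0
xx≢0⇒x≢0 ne refl = ne refl

-- Found by a search: with j = u³ / v² the point is t = (v / u) (5 j - 4) / 2 (j - 2),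
-- x = (v / u)² (j - 1) (j + 4) / (j - 2), y = t³ + 4 (v / u)³ (j - 1).
point-b≡0 : ∀ c {u v V w P Q X} →
  V ≡ u * u * u + c → w ≡ u * u * u + 2 * c →
  P ≡ V * ((u * u * u - 4 * c) * (u * u * u - 4 * c)) → Q ≡ 2 * u * w * (2 * u * w) →
  X ≡ 4 * c * (5 * (u * u * u) + 4 * c) * w →
  v * v ≡ u * u * u + c → Q ≢ 0 →
  ∃[ t ] ∃[ x ] ∃[ y ] (t * t * Q ≡ P × x * Q ≡ X × y * y ≡ x * x * x + Production.sextic 0 0 c t)
point-b≡0 c {u} {v} {X = X} refl refl refl refl refl curve Q≢0 = go (inverse {2 * u * (u * u * u + 2 * c)} (xx≢0⇒x≢0 Q≢0))
  where
  open Production 0 0 c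

  V = u * u * u + c
  w = u * u * u + 2 * c
  k = u * u * u - 4 * c
  D = 2 * u * w

  lemma₁ : ∀ v k V D i → - (v * k * i) * - (v * k * i) * (D * D) - V * (k * k) ≡
    k * k * (D * i * (D * i)) * (v * v - V) + V * (k * k) * (D * i + 1ℚ) * (D * i - 1ℚ)
  lemma₁ = solve-∀ ℚ-ring

  lemma₂ : ∀ X D i → X * (i * i) * (D * D) - X ≡ X * (D * i + 1ℚ) * (D * i - 1ℚ)
  lemma₂ = solve-∀ ℚ-ring

  lemma₃ : ∀ c u v i →
    let s = u * u * u
        V = s + c
        w = s + 2 * c
        k = s - 4 * c
        D = 2 * u * w
        e = 2 * w * i
        E = D * i
        t = - (v * k * i)
        x = 4 * c * (5 * s + 4 * c) * w * (i * i)
        y = t * t * t - 4 * c * v * (e * e * e)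
    in y * y - (x * x * x + (t * t * (t * t) * (t * t) + 0 * (t * t * (t * t)) + 0 * (t * t) + c)) ≡
       64 * c * (w * w * w) * (i * i * i * (i * i * i)) * ((v * v + V) * (k * k * k) + 16 * c * (w * w * w)) * (v * v - V) +
       c * ((E + 1) * (E * E * (E * E) + E * E + 1)) * (E - 1)
  lemma₃ = solve-∀ ℚ-ring

  go : ∃[ i ] D * i ≡ 1 →
    ∃[ t ] ∃[ x ] ∃[ y ] (t * t * (D * D) ≡ V * (k * k) × x * (D * D) ≡ X × y * y ≡ x * x * x + sextic t)
  go (i , inv) = t , X * (i * i) , t * t * t - 4 * c * v * (e * e * e) ,
    combine₂ (k * k * (E * E)) (V * (k * k) * (E + 1)) curve inv (lemma₁ v k V D i) ,
    combine₁ (X * (E + 1)) inv (lemma₂ X D i) ,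
    combine₂ (64 * c * (w * w * w) * (i * i * i * (i * i * i)) * ((v * v + V) * (k * k * k) + 16 * c * (w * w * w)))
      (c * ((E + 1) * (E * E * (E * E) + E * E + 1))) curve inv (lemma₃ c u v i)
    where
    t = - (v * k * i)
    e = 2 * w * i
    E = D * i

-- For a = b = 0 the factor n in `tangent-point` vanishes and the tangent only returns t = 0, whence
-- a separate construction. Here P has degree 9 and Q degree 8, so t is unbounded and t² outgrows x.
module PureSextic (c : ℚ) (c≢0 : c ≢ 0) where
  open Production 0 0 c

  V w k D P Q X : ℚ → ℚ
  V u = u * u * u + c
  w u = u * u * u + 2 * c
  k u = u * u * u - 4 * c
  D u = 2 * u * w u
  P u = V u * (k u * k u)
  Q u = D u * D u
  X u = 4 * c * (5 * (u * u * u) + 4 * c) * w u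

  leading-w : Leading 3 1 w
  leading-w = leading-+ leading-u³ (leading-raise-by 2 (leading-const (2 * c)))

  leading-P : Leading 9 1 P
  leading-P = leading-* (leading-+ leading-u³ (leading-raise-by 2 (leading-const c))) (leading-* leading-k leading-k)
    where
    leading-k : Leading 3 1 k
    leading-k = leading-minus leading-u³ (leading-raise-by 2 (leading-const (4 * c)))

  leading-Q : Leading 8 4 Q
  leading-Q = leading-* leading-D leading-D
    where
    leading-D : Leading 4 2 D
    leading-D = leading-* (leading-scale 2 leading-var) leading-w

  leading-X : Leading 6 (4 * c * 5 * 1) X
  leading-X = leading-* (leading-scale (4 * c) (leading-+ (leading-scale 5 leading-u³) (leading-raise-by 2 (leading-const (4 * c))))) leading-w

  infinite : Infinite (OnCurve c) → Infinite TorsionFree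
  infinite = infinite-torsionFree {OnCurve c} X P Q
    (leading-generic (λ ()) leading-Q)
    (leading-generic (xy≢0 {4 * c * 5} (xy≢0 {4 * c} (xy≢0 {4} (λ ()) c≢0) (λ ())) (λ ())) leading-X)
    (λ t → leading-generic (λ ()) (leading-minus leading-P (leading-raise (leading-scale (t * t) leading-Q))))
    (λ e e≢0 → numerator-generic-P (leading-raise-by 1 leading-X) leading-P leading-Q (λ ()) e e≢0)
    (λ {u} (v , curve) → point-b≡0 c {u} {v} {V u} {w u} {P u} {Q u} {X u} refl refl refl refl refl curve)

-- Subtracting the square of y = t³ + a t / 2 + v leaves a cubic in t, and the
-- tangent at (0 , u) to the curve x³ = 2 v t³ + … meets it in a further point.
tangent-point : ∀ a b c {u v V w n P Q X} →
  V ≡ u * u * u + c → w ≡ 54 * (u * u * u * (u * u * u)) - a * a * a * V →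
  n ≡ (a * a + 12 * b) * (u * u * u) + 4 * (a * a) * c →
  P ≡ 81 * (u * u * u * (u * u * u)) * (n * n) → Q ≡ 16 * V * (w * w) →
  X ≡ 16 * V * u * (w * w) + 12 * a * V * u * n * w →
  v * v ≡ u * u * u + c → Q ≢ 0 →
  ∃[ t ] ∃[ x ] ∃[ y ] (t * t * Q ≡ P × x * Q ≡ X × y * y ≡ x * x * x + Production.sextic a b c t)
tangent-point a b c {u} {v} {n = n} refl refl n-eq refl refl refl curve Q≢0 = go (inverse D≢0)
  where
  open Production a b c

  s = u * u * u
  V = s + c
  w = 54 * (s * s) - a * a * a * V
  D = 4 * v * w

  D≢0 : D ≢ 0
  D≢0 eq = Q≢0 (combine₂ (- (16 * (w * w))) D curve eq (lemma v w V))
    where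
    lemma : ∀ v w V → 16 * V * (w * w) - 0 ≡ - (16 * (w * w)) * (v * v - V) + 4 * v * w * (4 * v * w - 0)
    lemma = solve-∀ ℚ-ring

  n≡ : n ≡ 4 * (a * a) * V - 3 * (a * a) * s + 12 * b * s
  n≡ = trans n-eq (lemma a b c s)
    where
    lemma : ∀ a b c s → (a * a + 12 * b) * s + 4 * (a * a) * c ≡ 4 * (a * a) * (s + c) - 3 * (a * a) * s + 12 * b * s
    lemma = solve-∀ ℚ-ring

  lemma₁ : ∀ v s V w n i → (let D = 4 * v * w) → (let P = 81 * (s * s) * (n * n)) →
    9 * s * n * i * (9 * s * n * i) * (16 * V * (w * w)) - P ≡
    - (P * (16 * (w * w) * (i * i))) * (v * v - V) + P * (D * i + 1ℚ) * (D * i - 1ℚ)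
  lemma₁ = solve-∀ ℚ-ring

  lemma₂ : ∀ a u v V w n i → (u + 3 * a * u * n * v * i) * (16 * V * (w * w)) - (16 * V * u * (w * w) + 12 * a * V * u * n * w) ≡
    12 * a * V * u * n * w * (4 * v * w * i - 1ℚ)
  lemma₂ = solve-∀ ℚ-ring

  lemma₃ : ∀ a b c u v n i →
    let s = u * u * u
        V = s + c
        w = 54 * (s * s) - a * a * a * V
        t = 9 * s * n * i
        x = u + 3 * a * u * n * v * i
        y = t * t * t + ½ * a * t + v
        f = 27 * s * (n * n) * (i * i)
    in y * y - (x * x * x + (t * t * (t * t) * (t * t) + a * (t * t * (t * t)) + b * (t * t) + c)) ≡
       (1 - f * (a * a * a * n * v * i + a * a)) * (v * v - V) +
       f * n * ½ * ½ * (4 * v * w * i - 1) +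
       f * ½ * ½ * (n - (4 * (a * a) * V - 3 * (a * a) * s + 12 * b * s))
  lemma₃ = solve-∀ ℚ-ring

  go : ∃[ i ] D * i ≡ 1 →
    ∃[ t ] ∃[ x ] ∃[ y ] (t * t * (16 * V * (w * w)) ≡ 81 * (s * s) * (n * n) ×
      x * (16 * V * (w * w)) ≡ 16 * V * u * (w * w) + 12 * a * V * u * n * w × y * y ≡ x * x * x + sextic t)
  go (i , inv) = t , u + 3 * a * u * n * v * i , t * t * t + ½ * a * t + v ,
    combine₂ (- (P * (16 * (w * w) * (i * i)))) (P * (D * i + 1)) curve inv (lemma₁ v s V w n i) ,
    combine₁ (12 * a * V * u * n * w) inv (lemma₂ a u v V w n i) ,
    combine₃ (1 - f * (a * a * a * n * v * i + a * a)) (f * n * ½ * ½) (f * ½ * ½) curve inv n≡ (lemma₃ a b c u v n i)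
    where
    t = 9 * s * n * i
    f = 27 * s * (n * n) * (i * i)
    P = 81 * (s * s) * (n * n)

-- t is a multiple of n, whose coefficients are a² + 12 b and 4 a² c; `nondegenerate` says that they
-- do not both vanish. For large u the parameter t tends to 0, while x grows like u.
module ZeroBase (a b c : ℚ) (nondegenerate : a * a + 12 * b ≡ 0 → a * a * c ≢ 0) where
  open Production a b c

  V w n P Q X : ℚ → ℚ
  V u = u * u * u + c
  w u = 54 * (u * u * u * (u * u * u)) - a * a * a * V u
  n u = (a * a + 12 * b) * (u * u * u) + 4 * (a * a) * c
  P u = 81 * (u * u * u * (u * u * u)) * (n u * n u)
  Q u = 16 * V u * (w u * w u)
  X u = 16 * V u * u * (w u * w u) + 12 * a * V u * u * n u * w u

  leading-V : Leading 3 1 V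
  leading-V = leading-+ leading-u³ (leading-raise-by 2 (leading-const c))

  leading-w : Leading 6 54 w
  leading-w = leading-minus (leading-scale 54 (leading-* leading-u³ leading-u³))
    (leading-raise-by 2 (leading-scale (a * a * a) leading-V))

  leading-n : Leading 3 (a * a + 12 * b) n
  leading-n = leading-resp (lemma (a * a + 12 * b)) (λ u → refl)
    (leading-+ (leading-scale (a * a + 12 * b) leading-u³) (leading-raise-by 2 (leading-const (4 * (a * a) * c))))
    where
    lemma : ∀ d → d * 1 + 0 ≡ d
    lemma = solve-∀ ℚ-ring

  leading-P : Leading 12 (81 * (1 * 1) * ((a * a + 12 * b) * (a * a + 12 * b))) P
  leading-P = leading-* (leading-scale 81 (leading-* leading-u³ leading-u³)) (leading-* leading-n leading-n)

  leading-Q : Leading 15 46656 Q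
  leading-Q = leading-* (leading-scale 16 leading-V) (leading-* leading-w leading-w)

  leading-X : Leading 16 46656 X
  leading-X = leading-resp refl (λ u → refl) (leading-+
    (leading-* (leading-* (leading-scale 16 leading-V) leading-var) (leading-* leading-w leading-w))
    (leading-raise-by 2 (leading-* (leading-* (leading-* (leading-scale (12 * a) leading-V) leading-var) leading-n) leading-w)))

  generic-n : Generic (λ u → n u ≢ 0)
  generic-n = split (a * a + 12 * b ≟ 0)
    where
    split : Dec (a * a + 12 * b ≡ 0) → Generic (λ u → n u ≢ 0)
    split (no  ne) = leading-generic ne leading-n
    split (yes eq) = leading-generic (xy≢0 {4} (λ ()) (nondegenerate eq))
      (constant λ u → combine₁ (u * u * u) eq (lemma (a * a) b c (u * u * u)))
      where
      lemma : ∀ a² b c s → (a² + 12 * b) * s + 4 * a² * c - 4 * (a² * c) ≡ s * (a² + 12 * b - 0)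
      lemma = solve-∀ ℚ-ring

  generic-t : ∀ t → Generic (λ u → P u - t * t * Q u ≢ 0)
  generic-t t = split (t ≟ 0)
    where
    lemma : ∀ P Q → P - 0 * 0 * Q ≡ P
    lemma = solve-∀ ℚ-ring

    split : Dec (t ≡ 0) → Generic (λ u → P u - t * t * Q u ≢ 0)
    split (no  t≢0)  = leading-generic (λ eq → xy≢0 {t * t} {46656} (xy≢0 t≢0 t≢0) (λ ()) (trans (sym (lemma′ (t * t))) (cong -_ eq)))
      (leading-minus (leading-raise-by 2 leading-P) (leading-scale (t * t) leading-Q))
      where
      lemma′ : ∀ t² → - (0 - t² * 46656) ≡ t² * 46656
      lemma′ = solve-∀ ℚ-ring
    -- The limit t = 0 is the delicate value: P = 81 u⁶ n² may have lower degree than its bound, so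
    -- its factors are treated separately.
    split (yes refl) = generic-⇒ (λ {u} (u≢0 , n≢0) eq →
        xy≢0 (xy≢0 {81} (λ ()) (xy≢0 (xy≢0 (xy≢0 u≢0 u≢0) u≢0) (xy≢0 (xy≢0 u≢0 u≢0) u≢0))) (xy≢0 n≢0 n≢0)
          (trans (sym (lemma (P u) (Q u))) eq))
      (generic-× (leading-generic (λ ()) leading-var) generic-n)

  infinite : Infinite (OnCurve c) → Infinite TorsionFree
  infinite = infinite-torsionFree {OnCurve c} X P Q
    (leading-generic (λ ()) leading-Q) (leading-generic (λ ()) leading-X) generic-t
    (λ e _ → numerator-generic-X leading-X (leading-raise-by 2 leading-P) leading-Q (λ ()) e)
    (λ {u} (v , curve) → tangent-point a b c {u} {v} {V u} {w u} {n u} {P u} {Q u} {X u} refl refl refl refl refl refl curve)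

-- Here y² = x³ + g(t) contains the rational curve t = 9 u³ / a, x = 3 u²,
-- y = t³ + a t / 2.
module DegenerateBase (a b α : ℚ) (aα≡1 : a * α ≡ 1) (degenerate : a * a + 12 * b ≡ 0) where
  open Production a b 0

  β : ℚ
  β = 81 * (α * α)

  P Q X : ℚ → ℚ
  P u = β * (u * u * u * (u * u * u))
  Q u = 1
  X u = 3 * (u * u)

  leading-P : Leading 6 (β * 1) P
  leading-P = leading-scale β (leading-* leading-u³ leading-u³)

  leading-X : Leading 2 3 X
  leading-X = leading-resp refl (λ u → refl) (leading-scale 3 (leading-* leading-var leading-var))

  β≢0 : β * 1 ≢ 0
  β≢0 = xy≢0 {β} (xy≢0 {81} (λ ()) (xy≢0 α≢0 α≢0)) (λ ())
    where
    α≢0 : α ≢ 0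
    α≢0 = xy≡1⇒y≢0 {a} aα≡1

  -- y = t³ + a t / 2 gives y² - g(t) = (a² / 4 - b) t², which is a² t² / 3 when a² = - 12 b. The
  -- section is therefore the cuspidal cubic x³ = a² t² / 3, parametrised by u.
  point : ∀ u → ∃[ t ] ∃[ x ] ∃[ y ] (t * t * 1 ≡ P u × x * 1 ≡ X u × y * y ≡ x * x * x + sextic t)
  point u = t , 3 * (u * u) , t * t * t + ½ * a * t , lemma₁ α u , ℚ.*-identityʳ (3 * (u * u)) ,
    *-cancelˡ {12} (λ ()) (combine₂ (- (t * t)) (324 * (u * u * u * (u * u * u)) * (a * α + 1)) degenerate aα≡1 (lemma₂ a b α u))
    where
    t = 9 * (u * u * u) * α

    lemma₁ : ∀ α u → 9 * (u * u * u) * α * (9 * (u * u * u) * α) * 1 ≡ 81 * (α * α) * (u * u * u * (u * u * u))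
    lemma₁ = solve-∀ ℚ-ring

    lemma₂ : ∀ a b α u →
      let t = 9 * (u * u * u) * α
          x = 3 * (u * u)
          y = t * t * t + ½ * a * t
      in 12 * (y * y) - 12 * (x * x * x + (t * t * (t * t) * (t * t) + a * (t * t * (t * t)) + b * (t * t) + 0)) ≡
         - (t * t) * (a * a + 12 * b - 0) + 324 * (u * u * u * (u * u * u)) * (a * α + 1) * (a * α - 1)
    lemma₂ = solve-∀ ℚ-ring

  infinite : {U : Pred ℚ 0ℓ} → Infinite U → Infinite TorsionFree
  infinite {U} = infinite-torsionFree {U} X P Q
    (leading-generic (λ ()) (leading-const 1)) (leading-generic (λ ()) leading-X)
    (λ t → leading-generic (λ eq → β≢0 (trans (sym (ℚ.+-identityʳ (β * 1))) eq))
      (leading-minus leading-P (leading-raise-by 5 (leading-scale (t * t) (leading-const 1)))))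
    (λ e e≢0 → numerator-generic-P (leading-raise-by 2 leading-X) leading-P (leading-raise-by 4 (leading-const 1)) β≢0 e e≢0)
    (λ {u} _ _ → point u)

-- Normal form of an even monic sextic, and the choice of construction.

infinite-⇒ : ∀ {P Q : Pred ℚ 0ℓ} → (∀ {x} → P x → Q x) → Infinite P → Infinite Q
infinite-⇒ P⇒Q inf xs = go (inf xs)
  where
  go : ∃[ x ] (_ × _) → ∃[ x ] (_ × _)
  go (x , px , x∉) = x , P⇒Q px , x∉

eval-≋0 : ∀ p t → (∀ n → coeff p n ≡ 0) → eval p t ≡ 0
eval-≋0 []       t eq = refl
eval-≋0 (c ∷ cs) t eq = trans (cong₂ (λ d e → d + t * e) (eq 0) (eval-≋0 cs t (λ n → eq (ℕ.suc n)))) (lemma t)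
  where
  lemma : ∀ t → 0 + t * 0 ≡ 0
  lemma = solve-∀ ℚ-ring

eval-cong : ∀ p q t → p ≋ q → eval p t ≡ eval q t
eval-cong []      q        t p≋q = sym (eval-≋0 q t (λ n → sym (p≋q n)))
eval-cong (c ∷ p) []       t p≋q = eval-≋0 (c ∷ p) t p≋q
eval-cong (c ∷ p) (d ∷ q)  t p≋q =
  cong₂ (λ d e → d + t * e) (p≋q 0) (eval-cong p q t (λ n → p≋q (ℕ.suc n)))

coeff-map-neg : ∀ p n → coeff (List.map -_ p) n ≡ - coeff p n
coeff-map-neg []      n         = refl
coeff-map-neg (c ∷ p) ℕ.zero    = refl
coeff-map-neg (c ∷ p) (ℕ.suc n) = coeff-map-neg p n

-- Multiplication by (-1)ⁿ as iterated negation, the form in which `reflect` acts on the n-th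
-- coefficient.
neg^ : ℕ.ℕ → ℚ → ℚ
neg^ ℕ.zero    c = c
neg^ (ℕ.suc n) c = - neg^ n c

coeff-reflect : ∀ p n → coeff (reflect p) n ≡ neg^ n (coeff p n)
coeff-reflect []      n         = sym (neg^-0 n)
  where
  neg^-0 : ∀ n → neg^ n 0 ≡ 0
  neg^-0 ℕ.zero    = refl
  neg^-0 (ℕ.suc n) = cong -_ (neg^-0 n)
coeff-reflect (c ∷ p) ℕ.zero    = refl
coeff-reflect (c ∷ p) (ℕ.suc n) = trans (coeff-map-neg (reflect p) n) (cong -_ (coeff-reflect p n))

module EvenSextic (g : Poly) (monic : Monic g) (degree : HasDegree g 6) (even : Even g) where
  a b c : ℚ
  a = coeff g 4
  b = coeff g 2
  c = coeff g 0

  open Production a b c public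

  x≡-x⇒x≡0 : x ≡ - x → x ≡ 0
  x≡-x⇒x≡0 {x} eq = combine₁ ½ eq (lemma x)
    where
    lemma : ∀ x → x - 0 ≡ ½ * (x - - x)
    lemma = solve-∀ ℚ-ring

  coeff-odd : ∀ n → (∀ x → neg^ n x ≡ - x) → coeff g n ≡ 0
  coeff-odd n odd = x≡-x⇒x≡0 (trans (even n) (trans (coeff-reflect g n) (odd (coeff g n))))

  -- `Monic` carries a degree of its own, which must be 6 because degrees are unique.
  leading-coeff : coeff g 6 ≡ 1
  leading-coeff = go monic
    where
    go : Monic g → coeff g 6 ≡ 1
    go (d , (d≢0 , above-d) , d≡1) = split (ℕ.<-cmp d 6)
      where
      split : Tri (d ℕ.< 6) (d ≡ 6) (6 ℕ.< d) → coeff g 6 ≡ 1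
      split (tri< d<6 _ _)  = ⊥-elim (proj₁ degree (above-d 6 d<6))
      split (tri≈ _ refl _) = d≡1
      split (tri> _ _ 6<d)  = ⊥-elim (d≢0 (proj₂ degree d 6<d))

  normal : Poly
  normal = c ∷ 0 ∷ b ∷ 0 ∷ a ∷ 0 ∷ 1 ∷ []

  g≋normal : g ≋ normal
  g≋normal 0 = refl
  g≋normal 1 = coeff-odd 1 (λ x → refl)
  g≋normal 2 = refl
  g≋normal 3 = coeff-odd 3 lemma
    where
    lemma : ∀ x → - (- (- x)) ≡ - x
    lemma = solve-∀ ℚ-ring
  g≋normal 4 = refl
  g≋normal 5 = coeff-odd 5 lemma
    where
    lemma : ∀ x → - (- (- (- (- x)))) ≡ - x
    lemma = solve-∀ ℚ-ring
  g≋normal 6 = leading-coeff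
  g≋normal (ℕ.suc (ℕ.suc (ℕ.suc (ℕ.suc (ℕ.suc (ℕ.suc (ℕ.suc n))))))) = proj₂ degree _ (ℕ.m≤m+n 7 n)

  eval≡sextic : ∀ t → eval g t ≡ sextic t
  eval≡sextic t = trans (eval-cong g normal t g≋normal) (lemma a b c t)
    where
    lemma : ∀ a b c t → c + t * (0 + t * (b + t * (0 + t * (a + t * (0 + t * (1 + t * 0)))))) ≡
      t * t * (t * t) * (t * t) + a * (t * t * (t * t)) + b * (t * t) + c
    lemma = solve-∀ ℚ-ring

  sextic-0 : sextic 0 ≡ c
  sextic-0 = lemma a b c
    where
    lemma : ∀ a b c → 0 * 0 * (0 * 0) * (0 * 0) + a * (0 * 0 * (0 * 0)) + b * (0 * 0) + c ≡ c
    lemma = solve-∀ ℚ-ring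

  nonzero-tail : ¬ (g ≋ t^ 6) → a ≡ 0 → b ≡ 0 → c ≢ 0
  nonzero-tail g≢t⁶ a≡0 b≡0 c≡0 = g≢t⁶ g≋t⁶
    where
    g≋t⁶ : g ≋ t^ 6
    g≋t⁶ 0 = c≡0
    g≋t⁶ 1 = g≋normal 1
    g≋t⁶ 2 = b≡0
    g≋t⁶ 3 = g≋normal 3
    g≋t⁶ 4 = a≡0
    g≋t⁶ 5 = g≋normal 5
    g≋t⁶ 6 = g≋normal 6
    g≋t⁶ n@(ℕ.suc (ℕ.suc (ℕ.suc (ℕ.suc (ℕ.suc (ℕ.suc (ℕ.suc _))))))) = g≋normal n

-- The tangent construction fails only if a² + 12 b = 0 and a² c = 0. If a = 0, then b = 0 and c ≠ 0
-- because g ≠ t⁶; if a ≠ 0, then c = 0 and the rational curve applies. For g = t⁶ the cuspidal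
-- fibre y² = x³ at t₀ = 0 would have infinitely many points although no fibre has positive rank.
infinite-zeroBase : ∀ {a b c} → (a ≡ 0 → b ≡ 0 → c ≢ 0) → Infinite (OnCurve c) →
  Infinite (Production.TorsionFree a b c)
infinite-zeroBase {a} {b} {c} tail≢0 inf = split-d (a * a + 12 * b ≟ 0)
  where
  open Production using (TorsionFree)

  b≡0 : ∀ {a} → a ≡ 0 → a * a + 12 * b ≡ 0 → b ≡ 0
  b≡0 refl eq = *-cancelˡ {12} (λ ()) (trans (lemma b) eq)
    where
    lemma : ∀ b → 12 * b ≡ 0 * 0 + 12 * b
    lemma = solve-∀ ℚ-ring

  pure : ∀ {a b} → a ≡ 0 → b ≡ 0 → c ≢ 0 → Infinite (TorsionFree a b c)
  pure refl refl c≢0 = PureSextic.infinite c c≢0 inf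

  degenerate : ∀ {c} → c ≡ 0 → a * a + 12 * b ≡ 0 → ∃[ α ] a * α ≡ 1 → Infinite (OnCurve c) → Infinite (TorsionFree a b c)
  degenerate refl eq (α , aα≡1) inf = DegenerateBase.infinite a b α aα≡1 eq inf

  split-d : Dec (a * a + 12 * b ≡ 0) → Infinite (TorsionFree a b c)
  split-d (no  d≢0) = ZeroBase.infinite a b c (λ d≡0 → ⊥-elim (d≢0 d≡0)) inf
  split-d (yes d≡0) = split-a (a ≟ 0)
    where
    split-a : Dec (a ≡ 0) → Infinite (TorsionFree a b c)
    split-a (yes a≡0) = pure a≡0 (b≡0 a≡0 d≡0) (tail≢0 a≡0 (b≡0 a≡0 d≡0))
    split-a (no  a≢0) = split-c (c ≟ 0)
      where
      split-c : Dec (c ≡ 0) → Infinite (TorsionFree a b c)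
      split-c (no  c≢0) = ZeroBase.infinite a b c (λ _ → xy≢0 (xy≢0 a≢0 a≢0) c≢0) inf
      split-c (yes c≡0) = degenerate c≡0 d≡0 (inverse a≢0) inf

theorem3p2 : (g : Poly) → Monic g → HasDegree g 6 → Even g → ¬ (g ≋ t^ 6) →
    ∃[ t₀ ] Infinite (Curve (eval g t₀)) →
    Infinite (λ (t₁ : ℚ) → PositiveRank (eval g t₁))
theorem3p2 g monic degree even g≢t⁶ (t₀ , inf) =
  infinite-⇒ (λ {t} → subst PositiveRank (sym (eval≡sextic t))) (infinite-positiveRank (torsionFree (t₀ ≟ 0) on-curve))
  where
  open EvenSextic g monic degree even

  on-curve : Infinite (OnCurve (sextic t₀))
  on-curve = subst (Infinite ∘ OnCurve) (eval≡sextic t₀) (infinite-abscissae inf)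

  torsionFree : ∀ {t₀} → Dec (t₀ ≡ 0) → Infinite (OnCurve (sextic t₀)) → Infinite TorsionFree
  torsionFree {t₀} (no  t₀≢0) inf = NonzeroBase.infinite a b c t₀ t₀≢0 inf
  torsionFree      (yes refl) inf = infinite-zeroBase (nonzero-tail g≢t⁶) (subst (Infinite ∘ OnCurve) sextic-0 inf)
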